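{- For any $\epsilon>0$ there is an algorithm that runs in polynomial time (for fixed $\epsilon$) and is a $(1,1+\epsilon)$-reapproximation algorithm for $R(\Pi_{ID})$, the reoptimization version of makespan minimization on identical machines with $\{0,1\}$ transition costs. That is, given an initial instance $\mathcal{I}_0=(\mathcal{M}_0,\mathcal{J}_0)$, an initial assignment $\sigma_0:\mathcal{J}_0\to\mathcal{M}_0$, and a new instance $\mathcal{I}=(\mathcal{M},\mathcal{J})$, it outputs an assignment $\sigma:\mathcal{J}\to\mathcal{M}$ for $\mathcal{I}$ whose makespan is at most $(1+\epsilon)$ times the minimal makespan for $\mathcal{I}$ and whose total transition cost is at most the minimal total transition cost from $\sigma_0$ to an optimal (minimum makespan) assignment for $\mathcal{I}$.
   Context: $\Pi_{ID}$ denotes makespan minimization on identical machines: each job $j\in\mathcal{J}$ has a processing time $p_j$ (the same on every machine), an assignment is a map $\sigma:\mathcal{J}\to\mathcal{M}$, and the makespan is $\max_{i\in\mathcal{M}}\sum_{j:\sigma(j)=i}p_j$. In the reoptimization version, $\mathcal{I}_0=(\mathcal{M}_0,\mathcal{J}_0)$ is an instance with some initial assignment $\sigma_0:\mathcal{J}_0\to\mathcal{M}_0$, and $\mathcal{I}=(\mathcal{M},\mathcal{J})$ is a new instance derived from $\mathcal{I}_0$ by addition or removal of jobs and/or machines. The transition cost of job $j\in\mathcal{J}$ for an assignment $\sigma:\mathcal{J}\to\mathcal{M}$ is $c_{\sigma_0}(j,\sigma)=1$ if $j\notin\mathcal{J}_0$, or if $j\in\mathcal{J}_0$ and $\sigma_0(j)\ne\sigma(j)$;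 otherwise $c_{\sigma_0}(j,\sigma)=0$. The total transition cost of $\sigma$ is $\sum_{j\in\mathcal{J}}c_{\sigma_0}(j,\sigma)$. An $(r,\rho)$-reapproximation algorithm outputs, for every input, an assignment of makespan at most $\rho$ times the minimal makespan for $\mathcal{I}$ and of total transition cost at most $r$ times the minimal total transition cost to an optimal assignment for $\mathcal{I}$. Polynomial time means polynomial in $|\mathcal{I}_0|$ and $|\mathcal{I}|$. -}

module Defs where

open import Data.Bool using (Bool; true; false; if_then_else_)
open import Data.Digit using (toDigits)
open import Data.Fin using (toℕ)
open import Data.Integer using (+_)
open import Data.List using (List; []; _∷_; map; filter; foldr)
open import Data.List.Membership.Propositional using (_∈_)
import Data.List.Membership.DecPropositional as DecMembership
open import Data.List.Relation.Unary.All as All using (All; []; _∷_)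
open import Data.List.Relation.Unary.Unique.Propositional using (Unique)
open import Data.Nat using (ℕ; zero; suc; _+_; _*_; _∸_; _^_; _⊔_; _≤_; _≤ᵇ_; _≟_)
open import Data.Nat.ListAction using (sum)
open import Data.Nat.Logarithm using (⌊log₂_⌋)
open import Data.Product using (_×_; _,_; proj₁; proj₂; ∃-syntax)
open import Data.Product.Properties using (≡-dec)
open import Data.Rational as ℚ using (ℚ)
open import Relation.Binary.Definitions using (DecidableEquality)
open import Relation.Binary.PropositionalEquality using (_≡_)
open import Relation.Nullary.Decidable using (does; _×-dec_)

Machine : Set
Machine = ℕ

-- A job is a name together with its processing time.  A job belonging to
-- two instances therefore has the same processing time in both, so that any
-- instance arises from any other by adding and removing jobs and machines.
Job : Set
Job = ℕ × ℕ

time : Job → ℕ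
time = proj₂

_≟ᴶ_ : DecidableEquality Job
_≟ᴶ_ = ≡-dec _≟_ _≟_

open DecMembership _≟ᴶ_ using (_∈?_)

record Instance : Set where
  field
    machines        : List Machine
    jobs            : List Job
    machines-unique : Unique machines
    jobs-unique     : Unique jobs

open Instance public

-- Maps from the jobs of an instance to its machines are given as functions
-- on all of Job; their values outside the instance are irrelevant to every
-- notion below.
IsAssignment : Instance → (Job → Machine) → Set
IsAssignment I σ = ∀ {j} → j ∈ jobs I → σ j ∈ machines I

load : Instance → (Job → Machine) → Machine → ℕ
load I σ i = sum (map time (filter (λ j → σ j ≟ i) (jobs I)))

makespan : Instance → (Job → Machine) → ℕ
makespan I σ = foldr _⊔_ 0 (map (load I σ) (machines I))

IsOptimal : Instance → (Job → Machine) → Set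
IsOptimal I σ = IsAssignment I σ ×
                (∀ τ → IsAssignment I τ → makespan I σ ≤ makespan I τ)

jobCost : Instance → (Job → Machine) → Job → (Job → Machine) → ℕ
jobCost I₀ σ₀ j σ =
  if does ((j ∈? jobs I₀) ×-dec (σ₀ j ≟ σ j)) then 0 else 1

transitionCost : Instance → (Job → Machine) → Instance → (Job → Machine) → ℕ
transitionCost I₀ σ₀ I σ = sum (map (λ j → jobCost I₀ σ₀ j σ) (jobs I))

-- An instance without any assignment (jobs but no machines) is excluded as
-- new instance, since no output would be possible for it.
record Input : Set where
  field
    initial      : Instance
    σ₀           : Job → Machine
    σ₀-assigns   : IsAssignment initial σ₀
    new          : Instance
    new-feasible : ∃[ τ ] IsAssignment new τ

open Input public

IsMinimum : {A : Set} → (A → Set) → (A → ℕ) → ℕ → Set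
IsMinimum P f m = (∃[ x ] P x × f x ≡ m) × (∀ x → P x → m ≤ f x)

fromℕ : ℕ → ℚ
fromℕ n = + n ℚ./ 1

-- Both minima exist, by new-feasible and since only finitely many
-- assignments differ on the jobs of I; they are unique as minima.
IsReapproximate : ℚ → ℚ → Input → (Job → Machine) → Set
IsReapproximate r ρ x σ =
  IsAssignment I σ ×
  (∀ m → IsMinimum (IsAssignment I) (makespan I) m →
         fromℕ (makespan I σ) ℚ.≤ ρ ℚ.* fromℕ m) ×
  (∀ m → IsMinimum (IsOptimal I) cost m →
         fromℕ (cost σ) ℚ.≤ r ℚ.* fromℕ m)
  where
  I    = new x
  cost = transitionCost (initial x) (σ₀ x) I

-- Algorithms are programs of a strict first-order functional language over
-- booleans, binary naturals, pairs and lists, with values eval and running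
-- time cost.
infixr 6 _⊗_

data Ty : Set where
  bool nat : Ty
  _⊗_      : Ty → Ty → Ty
  list     : Ty → Ty

⟦_⟧ : Ty → Set
⟦ bool ⟧  = Bool
⟦ nat ⟧   = ℕ
⟦ A ⊗ B ⟧ = ⟦ A ⟧ × ⟦ B ⟧
⟦ list A ⟧ = List ⟦ A ⟧

bitLength : ℕ → ℕ
bitLength n = suc ⌊log₂ n ⌋

size : ∀ A → ⟦ A ⟧ → ℕ
size bool     _       = 1
size nat      n       = bitLength n
size (A ⊗ B)  (x , y) = size A x + size B y
size (list A) xs      = suc (sum (map (λ x → suc (size A x)) xs))

Ctx : Set
Ctx = List Ty

Env : Ctx → Set
Env = All ⟦_⟧

infix 4 _⊢_

data _⊢_ (Γ : Ctx) : Ty → Set where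
  var            : ∀ {A} → A ∈ Γ → Γ ⊢ A
  let′           : ∀ {A B} → Γ ⊢ A → A ∷ Γ ⊢ B → Γ ⊢ B
  true′ false′   : Γ ⊢ bool
  if′            : ∀ {A} → Γ ⊢ bool → Γ ⊢ A → Γ ⊢ A → Γ ⊢ A
  lit            : ℕ → Γ ⊢ nat
  add monus mul  : Γ ⊢ nat → Γ ⊢ nat → Γ ⊢ nat
  leq            : Γ ⊢ nat → Γ ⊢ nat → Γ ⊢ bool
  digits         : Γ ⊢ nat → Γ ⊢ list nat
  pair           : ∀ {A B} → Γ ⊢ A → Γ ⊢ B → Γ ⊢ A ⊗ B
  fst            : ∀ {A B} → Γ ⊢ A ⊗ B → Γ ⊢ A
  snd            : ∀ {A B} → Γ ⊢ A ⊗ B → Γ ⊢ B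
  nil            : ∀ {A} → Γ ⊢ list A
  cons           : ∀ {A} → Γ ⊢ A → Γ ⊢ list A → Γ ⊢ list A
  uncons         : ∀ {A B} → Γ ⊢ list A → Γ ⊢ B → A ∷ list A ∷ Γ ⊢ B → Γ ⊢ B
  fold           : ∀ {A B} → A ∷ B ∷ Γ ⊢ B → Γ ⊢ B → Γ ⊢ list A → Γ ⊢ B

unconsᴸ : {A B : Set} → List A → B → (A → List A → B) → B
unconsᴸ []       b f = b
unconsᴸ (x ∷ xs) b f = f x xs

eval : ∀ {Γ A} → Γ ⊢ A → Env Γ → ⟦ A ⟧
eval (var x)        ρ = All.lookup ρ x
eval (let′ s t)     ρ = eval t (eval s ρ ∷ ρ)
eval true′          ρ = true
eval false′         ρ = false
eval (if′ b s t)    ρ = if eval b ρ then eval s ρ else eval t ρ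
eval (lit n)        ρ = n
eval (add s t)      ρ = eval s ρ + eval t ρ
eval (monus s t)    ρ = eval s ρ ∸ eval t ρ
eval (mul s t)      ρ = eval s ρ * eval t ρ
eval (leq s t)      ρ = eval s ρ ≤ᵇ eval t ρ
eval (digits t)     ρ = map toℕ (proj₁ (toDigits 2 (eval t ρ)))
eval (pair s t)     ρ = eval s ρ , eval t ρ
eval (fst t)        ρ = proj₁ (eval t ρ)
eval (snd t)        ρ = proj₂ (eval t ρ)
eval nil            ρ = []
eval (cons s t)     ρ = eval s ρ ∷ eval t ρ
eval (uncons l s t) ρ = unconsᴸ (eval l ρ) (eval s ρ) (λ x xs → eval t (x ∷ xs ∷ ρ))
eval (fold t s l)   ρ = foldr (λ x y → eval t (x ∷ y ∷ ρ)) (eval s ρ) (eval l ρ)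

-- c x y is the cost of computing f x y.
foldCost : {A B : Set} → (A → B → B) → (A → B → ℕ) → B → List A → ℕ
foldCost f c b []       = 0
foldCost f c b (x ∷ xs) = foldCost f c b xs + c x (foldr f b xs)

-- Running time up to constant factors.  Every evaluation step costs one
-- unit, values being shared through pointers rather than copied; arithmetic
-- is charged in addition by the bit lengths of its operands (quadratically
-- for multiplication).  As digits makes loops over the bits of a number
-- possible, cost bounded by a polynomial in the bit size of the input
-- captures the functions that Turing machines compute in polynomial time.
cost : ∀ {Γ A} → Γ ⊢ A → Env Γ → ℕ
cost (var x)        ρ = 1
cost (let′ s t)     ρ = 1 + cost s ρ + cost t (eval s ρ ∷ ρ)
cost true′          ρ = 1
cost false′         ρ = 1
cost (if′ b s t)    ρ = 1 + cost b ρ + (if eval b ρ then cost s ρ else cost t ρ)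
cost (lit n)        ρ = bitLength n
cost (add s t)      ρ = 1 + cost s ρ + cost t ρ + (bitLength (eval s ρ) + bitLength (eval t ρ))
cost (monus s t)    ρ = 1 + cost s ρ + cost t ρ + (bitLength (eval s ρ) + bitLength (eval t ρ))
cost (mul s t)      ρ = 1 + cost s ρ + cost t ρ + (bitLength (eval s ρ) * bitLength (eval t ρ))
cost (leq s t)      ρ = 1 + cost s ρ + cost t ρ + (bitLength (eval s ρ) + bitLength (eval t ρ))
cost (digits t)     ρ = 1 + cost t ρ + bitLength (eval t ρ)
cost (pair s t)     ρ = 1 + cost s ρ + cost t ρ
cost (fst t)        ρ = 1 + cost t ρ
cost (snd t)        ρ = 1 + cost t ρ
cost nil            ρ = 1
cost (cons s t)     ρ = 1 + cost s ρ + cost t ρ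
cost (uncons l s t) ρ =
  1 + cost l ρ + unconsᴸ (eval l ρ) (cost s ρ) (λ x xs → cost t (x ∷ xs ∷ ρ))
cost (fold t s l)   ρ =
  1 + cost s ρ + cost l ρ +
  foldCost (λ x y → eval t (x ∷ y ∷ ρ)) (λ x y → 1 + cost t (x ∷ y ∷ ρ))
           (eval s ρ) (eval l ρ)

jobTy instanceTy tableTy inputTy : Ty
jobTy      = nat ⊗ nat
instanceTy = list nat ⊗ list jobTy
tableTy    = list (jobTy ⊗ nat)
inputTy    = instanceTy ⊗ tableTy ⊗ instanceTy

encodeInstance : Instance → ⟦ instanceTy ⟧
encodeInstance I = machines I , jobs I

table : Instance → (Job → Machine) → ⟦ tableTy ⟧
table I σ = map (λ j → j , σ j) (jobs I)

encodeInput : Input → ⟦ inputTy ⟧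
encodeInput x = encodeInstance (initial x) , table (initial x) (σ₀ x) , encodeInstance (new x)

∣_∣ : Instance → ℕ
∣ I ∣ = size instanceTy (encodeInstance I)

Algorithm : Set
Algorithm = inputTy ∷ [] ⊢ tableTy

run : Algorithm → Input → ⟦ tableTy ⟧
run P x = eval P (encodeInput x ∷ [])

runningTime : Algorithm → Input → ℕ
runningTime P x = cost P (encodeInput x ∷ [])

IsPolynomialTime : Algorithm → Set
IsPolynomialTime P =
  ∃[ c ] ∃[ k ] ∀ x → runningTime P x ≤ c * (∣ initial x ∣ + ∣ new x ∣) ^ k + c

IsReapproximationAlgorithm : ℚ → ℚ → Algorithm → Set
IsReapproximationAlgorithm r ρ P =
  ∀ x → ∃[ σ ] run P x ≡ table (new x) σ × IsReapproximate r ρ x σ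

-- Fix a large constant E.  For a guess T of the makespan, jobs longer than
-- T/E are big, and they are rounded down to multiples of T/E².  A machine has
-- room for at most E of them, so there are only constantly many
-- configurations, that is, lists of the rounded sizes of its big jobs.  A
-- configuration reserves a slot for each of its sizes and leaves the rest of
-- T to the small jobs.  Given the configuration of a machine, the largest
-- number of jobs which can stay on it is found greedily, shortest jobs first.
-- Dynamic programming over the machines, indexed by the number of slots of
-- each size used so far, chooses configurations with exactly one slot per big
-- job such that as many jobs as possible stay.  All other jobs are
-- counted as moved wherever they go: the big ones fill the empty slots, and
-- the small ones go to machines whose small jobs do not yet exceed the room.
-- This yields makespan at most (1 + 2/E) T, and if T is at least the optimum,
-- then an optimal assignment takes part in the dynamic program, so that at
-- least as many jobs stay as in that assignment.
--
-- Hence T must not be below the optimum, but close to it: T is the least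
-- makespan that the construction yields on a grid of guesses, one of which is
-- slightly above the optimum.
--
-- The running time is controlled by equipping programs with a polynomial that
-- bounds their cost and the size of their value.
module Submission where

open import Defs
open import Algebra.Properties.CommutativeSemigroup using (interchange)
open import Data.Bool as Bool using (Bool; true; false; if_then_else_; not; T; _∧_)
open import Data.Bool.ListAction using (any)
open import Data.Bool.Properties using (T?; ¬-not)
open import Data.Empty using (⊥; ⊥-elim)
import Data.Integer as ℤ
import Data.Integer.Properties as ℤₚ
open import Data.List using (List; []; _∷_; _++_; map; filter; filterᵇ; foldr; foldl; length; concat; concatMap; reverse; upTo)
import Data.List.Membership.DecPropositional as DecMembership
open import Data.List.Membership.Propositional using (_∈_; _∉_; find; lose)
open import Data.List.Membership.Propositional.Properties using (∈-upTo⁺; ∈-upTo⁻; ∈-map⁺; ∈-map⁻; ∈-concatMap⁺; ∈-concatMap⁻; ∈-filter⁺; ∈-filter⁻; ∈-++⁺ˡ; ∈-++⁺ʳ; ∈-++⁻; ∈-∃++)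
open import Data.List.Properties using (map-++; map-∘; map-cong; map-id; map-upTo; length-map; length-++; length-filter; length-upTo; length-reverse; reverse-foldl; unfold-reverse)
open import Data.List.Relation.Binary.Permutation.Propositional using (_↭_; ↭-refl; ↭-sym; ↭-trans; ↭-prep; ↭-swap; ↭-reflexive; ↭⇒↭ₛ)
open import Data.List.Relation.Binary.Permutation.Propositional.Properties using (∈-resp-↭; All-resp-↭; ↭-length; ↭-reverse; ++-comm; shift) renaming (map⁺ to ↭-map⁺)
import Data.List.Relation.Binary.Permutation.Setoid.Properties as SetoidPermutation
open import Data.List.Relation.Binary.Sublist.Propositional using (_⊆_; []; _∷_; _∷ʳ_)
open import Data.List.Relation.Binary.Sublist.Propositional.Properties using (All-resp-⊆; Any-resp-⊆; filter-⊆) renaming (reverse⁺ to ⊆-reverse⁺)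
open import Data.List.Relation.Unary.All as All using (All; []; _∷_)
open import Data.List.Relation.Unary.All.Properties using () renaming (++⁺ to All-++⁺; map⁺ to All-map⁺)
open import Data.List.Relation.Unary.AllPairs as AllPairs using (AllPairs; []; _∷_)
open import Data.List.Relation.Unary.AllPairs.Properties using () renaming (++⁺ to AllPairs-++⁺; filter⁺ to AllPairs-filter⁺)
open import Data.List.Relation.Unary.Any using (here; there)
open import Data.List.Relation.Unary.Unique.Propositional using (Unique)
open import Data.List.Relation.Unary.Unique.Propositional.Properties using (upTo⁺) renaming (++⁺ to Unique-++⁺)
open import Data.Nat
open import Data.Nat.DivMod using (_%_; m<n⇒m%n≡m; [m+kn]%n≡m%n)
open import Data.Nat.ListAction using (sum)
open import Data.Nat.ListAction.Properties using (sum-++; sum-↭)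
open import Data.Nat.Logarithm using (⌊log₂_⌋; ⌊log₂⌋-mono-≤; ⌊log₂⌊n/2⌋⌋≡⌊log₂n⌋∸1)
open import Data.Nat.Properties
open import Data.Nat.Solver using (module +-*-Solver)
open import Data.Product using (_×_; _,_; proj₁; proj₂; ∃-syntax; Σ-syntax)
open import Data.Rational as ℚ using (ℚ; 0ℚ; 1ℚ; mkℚ; toℚᵘ)
import Data.Rational.Properties as ℚₚ
open import Data.Rational.Unnormalised as ℚᵘ using (mkℚᵘ)
import Data.Rational.Unnormalised.Properties as ℚᵘₚ
open import Data.Sum using (_⊎_; inj₁; inj₂)
open import Function using (_∘_; id; flip; case_of_)
open import Relation.Binary.PropositionalEquality
open import Relation.Nullary using (¬_; Dec; yes; no; does; contradiction)
open import Relation.Nullary.Decidable using (_×-dec_; dec-true; dec-false)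

open +-*-Solver using (solve; _:+_; _:*_; _:=_; con)
open DecMembership _≟ᴶ_ using (_∈?_)

-- The factor 1 for the transition cost leaves no slack on that side, so every relaxation has to go
-- to the makespan. Big sizes are therefore only rounded down: whatever an assignment of makespan at
-- most `T` keeps in place then fits the configurations that this assignment induces. The price is a
-- load of `(N + E + E) * U` instead of `N * U`: at most `E` slots per machine are exceeded by at
-- most `U` each, and a room by at most one small job, that is, by `E * U`.
--
-- The language has no division. A guess is thus represented by `U = E * T`, and times are scaled by
-- `S = E * E * E`; then `T`, `T/E` and `T/E²` turn into `N * U`, `E * U` and `U`.
--
-- A grid guess may lie below the optimum, and nothing tells so. The makespan of an actual
-- assignment, however, is never below the optimum. So the construction runs on the whole grid,
-- every outcome is completed to some assignment, and the least makespan `G` found is used as the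
-- guess of a final run. The two runs lose `1 + 2/E` each and the grid loses `1 + 1/E`.

+-interchange : ∀ m n o p → (m + n) + (o + p) ≡ (m + o) + (n + p)
+-interchange = interchange +-commutativeSemigroup

-- Polynomial bounds

data Pol : Set where
  X           : Pol
  κ           : ℕ → Pol
  _⊞_ _⊠_ _⊚_ : Pol → Pol → Pol

infixl 6 _⊞_
infixl 7 _⊠_
infixr 8 _⊚_

⟪_⟫ : Pol → ℕ → ℕ
⟪ X ⟫     n = n
⟪ κ c ⟫   n = c
⟪ p ⊞ q ⟫ n = ⟪ p ⟫ n + ⟪ q ⟫ n
⟪ p ⊠ q ⟫ n = ⟪ p ⟫ n * ⟪ q ⟫ n
⟪ p ⊚ q ⟫ n = ⟪ p ⟫ (⟪ q ⟫ n)

⟪⟫-mono : ∀ p {m n} → m ≤ n → ⟪ p ⟫ m ≤ ⟪ p ⟫ n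
⟪⟫-mono X       m≤n = m≤n
⟪⟫-mono (κ c)   m≤n = ≤-refl
⟪⟫-mono (p ⊞ q) m≤n = +-mono-≤ (⟪⟫-mono p m≤n) (⟪⟫-mono q m≤n)
⟪⟫-mono (p ⊠ q) m≤n = *-mono-≤ (⟪⟫-mono p m≤n) (⟪⟫-mono q m≤n)
⟪⟫-mono (p ⊚ q) m≤n = ⟪⟫-mono p (⟪⟫-mono q m≤n)

n≤2^n : ∀ n → n ≤ 2 ^ n
n≤2^n zero    = z≤n
n≤2^n (suc n) = begin
  1 + n          ≤⟨ +-mono-≤ (m^n>0 2 n) (n≤2^n n) ⟩
  2 ^ n + 2 ^ n  ≡⟨ cong (2 ^ n +_) (+-identityʳ (2 ^ n)) ⟨
  2 * 2 ^ n      ∎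
  where open ≤-Reasoning

m+n≤2*m*n : ∀ {m n} → 1 ≤ m → 1 ≤ n → m + n ≤ 2 * (m * n)
m+n≤2*m*n {m} {n} 1≤m 1≤n = begin
  m + n          ≡⟨ cong₂ _+_ (*-identityʳ m) (*-identityˡ n) ⟨
  m * 1 + 1 * n  ≤⟨ +-mono-≤ (*-monoʳ-≤ m 1≤n) (*-monoˡ-≤ n 1≤m) ⟩
  m * n + m * n  ≡⟨ cong (m * n +_) (+-identityʳ (m * n)) ⟨
  2 * (m * n)    ∎
  where open ≤-Reasoning

-- The base `2 + n` instead of `n` lets powers absorb constants and sums even at `n = 0`:
-- `c ≤ 2 ^ c`, and the sum of two positive numbers is at most twice their product.
⟪⟫-≤-^ : ∀ p → ∃[ k ] ∀ n → ⟪ p ⟫ n ≤ (2 + n) ^ k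
⟪⟫-≤-^ X = 1 , λ n → ≤-trans (m≤n+m n 2) (≤-reflexive (sym (*-identityʳ (2 + n))))
⟪⟫-≤-^ (κ c) = c , λ n → ≤-trans (n≤2^n c) (^-monoˡ-≤ c (m≤m+n 2 n))
⟪⟫-≤-^ (p ⊞ q) with ⟪⟫-≤-^ p | ⟪⟫-≤-^ q
... | a , p≤ | b , q≤ = suc (a + b) , λ n → begin
  ⟪ p ⟫ n + ⟪ q ⟫ n              ≤⟨ +-mono-≤ (p≤ n) (q≤ n) ⟩
  (2 + n) ^ a + (2 + n) ^ b      ≤⟨ m+n≤2*m*n (m^n>0 (2 + n) a) (m^n>0 (2 + n) b) ⟩
  2 * ((2 + n) ^ a * (2 + n) ^ b) ≡⟨ cong (2 *_) (^-distribˡ-+-* (2 + n) a b) ⟨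
  2 * (2 + n) ^ (a + b)          ≤⟨ *-monoˡ-≤ ((2 + n) ^ (a + b)) (m≤m+n 2 n) ⟩
  (2 + n) ^ suc (a + b)          ∎
  where open ≤-Reasoning
⟪⟫-≤-^ (p ⊠ q) with ⟪⟫-≤-^ p | ⟪⟫-≤-^ q
... | a , p≤ | b , q≤ = a + b , λ n →
  ≤-trans (*-mono-≤ (p≤ n) (q≤ n)) (≤-reflexive (sym (^-distribˡ-+-* (2 + n) a b)))
⟪⟫-≤-^ (p ⊚ q) with ⟪⟫-≤-^ p | ⟪⟫-≤-^ q
... | a , p≤ | b , q≤ = suc (suc b) * a , λ n → begin
  ⟪ p ⟫ (⟪ q ⟫ n)                 ≤⟨ p≤ (⟪ q ⟫ n) ⟩
  (2 + ⟪ q ⟫ n) ^ a               ≤⟨ ^-monoˡ-≤ a (+-monoʳ-≤ 2 (q≤ n)) ⟩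
  (2 + (2 + n) ^ b) ^ a           ≤⟨ ^-monoˡ-≤ a (+-mono-≤ (*-monoʳ-≤ 2 (m^n>0 (2 + n) b)) (m≤m+n _ _)) ⟩
  (2 * (2 + n) ^ b + 2 * (2 + n) ^ b) ^ a ≡⟨ cong (λ x → (2 * (2 + n) ^ b + x) ^ a) (+-identityʳ _) ⟨
  (2 * (2 * (2 + n) ^ b)) ^ a     ≤⟨ ^-monoˡ-≤ a (*-mono-≤ (m≤m+n 2 n) (*-monoˡ-≤ ((2 + n) ^ b) (m≤m+n 2 n))) ⟩
  ((2 + n) ^ suc (suc b)) ^ a     ≡⟨ ^-*-assoc (2 + n) (suc (suc b)) a ⟩
  (2 + n) ^ (suc (suc b) * a)     ∎
  where open ≤-Reasoning

⟪⟫-polynomial : ∀ p → ∃[ c ] ∃[ k ] ∀ n → ⟪ p ⟫ n ≤ c * n ^ k + c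
⟪⟫-polynomial p with ⟪⟫-≤-^ p
... | k , p≤ = 3 ^ k , k , λ n → ≤-trans (p≤ n) (bound n)
  where
  open ≤-Reasoning
  bound : ∀ n → (2 + n) ^ k ≤ 3 ^ k * n ^ k + 3 ^ k
  bound zero    = ≤-trans (^-monoˡ-≤ k (n≤1+n 2)) (m≤n+m (3 ^ k) _)
  bound (suc n) = begin
    (3 + n) ^ k            ≤⟨ ^-monoˡ-≤ k (+-monoʳ-≤ 3 (m≤m+n n (2 * n))) ⟩
    (3 + 3 * n) ^ k        ≡⟨ cong (_^ k) (*-suc 3 n) ⟨
    (3 * suc n) ^ k        ≡⟨ ^-distribʳ-* 3 (suc n) k ⟩
    3 ^ k * suc n ^ k      ≤⟨ m≤m+n _ _ ⟩
    3 ^ k * suc n ^ k + 3 ^ k ∎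
    where
    ^-distribʳ-* : ∀ a b k → (a * b) ^ k ≡ a ^ k * b ^ k
    ^-distribʳ-* a b zero    = refl
    ^-distribʳ-* a b (suc k) = trans (cong (a * b *_) (^-distribʳ-* a b k)) ([m*n]*[o*p]≡[m*o]*[n*p] a b (a ^ k) (b ^ k))

-- Bit lengths of sums and products

⌊log₂⌋-< : ∀ k {n} → n < 2 ^ suc k → ⌊log₂ n ⌋ ≤ k
⌊log₂⌋-< zero    {zero}  _ = z≤n
⌊log₂⌋-< zero    {suc zero} _ = z≤n
⌊log₂⌋-< zero    {suc (suc n)} (s≤s (s≤s ()))
⌊log₂⌋-< (suc k) {n} n< = begin
  ⌊log₂ n ⌋             ≤⟨ m≤n+m∸n ⌊log₂ n ⌋ 1 ⟩
  1 + (⌊log₂ n ⌋ ∸ 1)   ≡⟨ cong suc (⌊log₂⌊n/2⌋⌋≡⌊log₂n⌋∸1 n) ⟨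
  1 + ⌊log₂ ⌊ n /2⌋ ⌋   ≤⟨ s≤s (⌊log₂⌋-< k (*-cancelˡ-< 2 ⌊ n /2⌋ (2 ^ suc k) (≤-<-trans 2*⌊n/2⌋≤n n<))) ⟩
  suc k                 ∎
  where
  open ≤-Reasoning
  2*⌊n/2⌋≤n : 2 * ⌊ n /2⌋ ≤ n
  2*⌊n/2⌋≤n = begin
    2 * ⌊ n /2⌋           ≡⟨ cong (⌊ n /2⌋ +_) (+-identityʳ ⌊ n /2⌋) ⟩
    ⌊ n /2⌋ + ⌊ n /2⌋     ≤⟨ +-monoʳ-≤ ⌊ n /2⌋ (⌊n/2⌋≤⌈n/2⌉ n) ⟩
    ⌊ n /2⌋ + ⌈ n /2⌉     ≡⟨ ⌊n/2⌋+⌈n/2⌉≡n n ⟩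
    n                     ∎

n<2^bitLength : ∀ n → n < 2 ^ bitLength n
n<2^bitLength n = go n ≤-refl
  where
  open ≤-Reasoning
  -- The bound `b` serves as fuel, since halving is not structural recursion.
  go : ∀ b {n} → n ≤ b → n < 2 ^ bitLength n
  go b       {zero}        _   = s≤s z≤n
  go b       {suc zero}    _   = s≤s (s≤s z≤n)
  go (suc b) {suc (suc n)} (s≤s n≤b) = begin-strict
    2+n                          ≡⟨ ⌊n/2⌋+⌈n/2⌉≡n 2+n ⟨
    ⌊ 2+n /2⌋ + ⌈ 2+n /2⌉        ≤⟨ +-monoʳ-≤ ⌊ 2+n /2⌋ (⌊n/2⌋-mono (n≤1+n (suc 2+n))) ⟩
    ⌊ 2+n /2⌋ + suc ⌊ 2+n /2⌋    <⟨ +-mono-<-≤ half half ⟩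
    2 ^ L + 2 ^ L                ≡⟨ cong (2 ^ L +_) (+-identityʳ (2 ^ L)) ⟨
    2 ^ suc L                    ≡⟨ cong (λ l → 2 ^ suc l) L≡ ⟩
    2 ^ bitLength 2+n            ∎
    where
    2+n = suc (suc n)
    L   = bitLength ⌊ 2+n /2⌋
    1≤log : 1 ≤ ⌊log₂ 2+n ⌋
    1≤log = ⌊log₂⌋-mono-≤ {2} {2+n} (s≤s (s≤s z≤n))
    L≡ : L ≡ ⌊log₂ 2+n ⌋
    L≡ = trans (cong suc (⌊log₂⌊n/2⌋⌋≡⌊log₂n⌋∸1 2+n)) (m+[n∸m]≡n 1≤log)
    half : ⌊ 2+n /2⌋ < 2 ^ L
    half = go b (≤-trans (s≤s (⌊n/2⌋≤n n)) n≤b)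

bitLength-mono : ∀ {m n} → m ≤ n → bitLength m ≤ bitLength n
bitLength-mono m≤n = s≤s (⌊log₂⌋-mono-≤ m≤n)

bitLength-* : ∀ m n → bitLength (m * n) ≤ bitLength m + bitLength n
bitLength-* m n = s≤s (⌊log₂⌋-< _ (begin-strict
    m * n                        ≤⟨ *-monoʳ-≤ m (<⇒≤ (n<2^bitLength n)) ⟩
    m * 2 ^ suc b                <⟨ *-monoˡ-< (2 ^ suc b) {{m^n≢0 2 (suc b)}} (n<2^bitLength m) ⟩
    2 ^ suc a * 2 ^ suc b        ≡⟨ ^-distribˡ-+-* 2 (suc a) (suc b) ⟨
    2 ^ suc (a + suc b)          ∎))
  where
  open ≤-Reasoning
  a = ⌊log₂ m ⌋
  b = ⌊log₂ n ⌋

bitLength-+ : ∀ m n → bitLength (m + n) ≤ bitLength m + bitLength n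
bitLength-+ m n = s≤s (⌊log₂⌋-< _ (begin-strict
    m + n                        <⟨ +-mono-<-≤ (n<2^bitLength m) (<⇒≤ (n<2^bitLength n)) ⟩
    2 ^ suc a + 2 ^ suc b        ≤⟨ +-mono-≤ (^-monoʳ-≤ 2 (s≤s (m≤m+n a b))) (^-monoʳ-≤ 2 (s≤s (m≤n+m b a))) ⟩
    2 ^ suc (a + b) + 2 ^ suc (a + b) ≡⟨ cong (2 ^ suc (a + b) +_) (+-identityʳ _) ⟨
    2 ^ suc (suc (a + b))        ≡⟨ cong (λ k → 2 ^ suc k) (+-suc a b) ⟨
    2 ^ suc (a + suc b)          ∎))
  where
  open ≤-Reasoning
  a = ⌊log₂ m ⌋
  b = ⌊log₂ n ⌋

bitLength-≤-suc : ∀ n → bitLength n ≤ suc n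
bitLength-≤-suc n =
  s≤s (⌊log₂⌋-< n (≤-<-trans (n≤2^n n) (^-monoʳ-< 2 (s≤s (s≤s z≤n)) (n<1+n n))))

-- Renaming of terms

Ren : Ctx → Ctx → Set
Ren Γ Δ = ∀ {A} → A ∈ Γ → A ∈ Δ

ext : ∀ {Γ Δ A} → Ren Γ Δ → Ren (A ∷ Γ) (A ∷ Δ)
ext r (here refl) = here refl
ext r (there x)   = there (r x)

ren : ∀ {Γ Δ A} → Ren Γ Δ → Γ ⊢ A → Δ ⊢ A
ren r (var x)        = var (r x)
ren r (let′ s t)     = let′ (ren r s) (ren (ext r) t)
ren r true′          = true′
ren r false′         = false′
ren r (if′ b s t)    = if′ (ren r b) (ren r s) (ren r t)
ren r (lit n)        = lit n
ren r (add s t)      = add (ren r s) (ren r t)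
ren r (monus s t)    = monus (ren r s) (ren r t)
ren r (mul s t)      = mul (ren r s) (ren r t)
ren r (leq s t)      = leq (ren r s) (ren r t)
ren r (digits t)     = digits (ren r t)
ren r (pair s t)     = pair (ren r s) (ren r t)
ren r (fst t)        = fst (ren r t)
ren r (snd t)        = snd (ren r t)
ren r nil            = nil
ren r (cons s t)     = cons (ren r s) (ren r t)
ren r (uncons l s t) = uncons (ren r l) (ren r s) (ren (ext (ext r)) t)
ren r (fold t s l)   = fold (ren (ext (ext r)) t) (ren r s) (ren r l)

record Agree {Γ Δ} (r : Ren Γ Δ) (ρ : Env Γ) (δ : Env Δ) : Set where
  constructor agreeing
  field lookup≡ : ∀ {A} (x : A ∈ Γ) → All.lookup δ (r x) ≡ All.lookup ρ x

open Agree

agree-ext : ∀ {Γ Δ A} {r : Ren Γ Δ} {ρ δ} {x y : ⟦ A ⟧} →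
            y ≡ x → Agree r ρ δ → Agree (ext r) (x ∷ ρ) (y ∷ δ)
agree-ext {Γ} {A = A} {r} {ρ} {δ} {x} {y} y≡x a = agreeing lookup≡′
  where
  lookup≡′ : ∀ {B} (z : B ∈ A ∷ Γ) → All.lookup (y ∷ δ) (ext r z) ≡ All.lookup (x ∷ ρ) z
  lookup≡′ (here refl) = y≡x
  lookup≡′ (there z)   = lookup≡ a z

-- Bodies under binders agree only pointwise after renaming, so this and the next two congruences
-- stand in for function extensionality.
unconsᴸ-cong : {A B : Set} {l l′ : List A} {b b′ : B} {f f′ : A → List A → B} →
               l ≡ l′ → b ≡ b′ → (∀ x xs → f x xs ≡ f′ x xs) →
               unconsᴸ l b f ≡ unconsᴸ l′ b′ f′
unconsᴸ-cong {l = []}    refl b≡ f≡ = b≡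
unconsᴸ-cong {l = _ ∷ _} refl b≡ f≡ = f≡ _ _

foldr-cong′ : {A B : Set} {l l′ : List A} {b b′ : B} {f f′ : A → B → B} →
              (∀ x y → f x y ≡ f′ x y) → b ≡ b′ → l ≡ l′ → foldr f b l ≡ foldr f′ b′ l′
foldr-cong′ {l = []}    f≡ b≡ refl = b≡
foldr-cong′ {l = x ∷ l} {f′ = f′} f≡ b≡ refl =
  trans (f≡ x _) (cong (f′ x) (foldr-cong′ {l = l} f≡ b≡ refl))

foldCost-cong : {A B : Set} {l l′ : List A} {b b′ : B} {f f′ : A → B → B} {c c′ : A → B → ℕ} →
                (∀ x y → f x y ≡ f′ x y) → (∀ x y → c x y ≡ c′ x y) → b ≡ b′ → l ≡ l′ →
                foldCost f c b l ≡ foldCost f′ c′ b′ l′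
foldCost-cong {l = []}    f≡ c≡ b≡ refl = refl
foldCost-cong {l = x ∷ l} {c′ = c′} f≡ c≡ b≡ refl =
  cong₂ _+_ (foldCost-cong {l = l} f≡ c≡ b≡ refl)
            (trans (c≡ x _) (cong (c′ x) (foldr-cong′ {l = l} f≡ b≡ refl)))

eval-ren : ∀ {Γ Δ A} (r : Ren Γ Δ) (t : Γ ⊢ A) {ρ δ} → Agree r ρ δ →
           eval (ren r t) δ ≡ eval t ρ
eval-ren r (var x)        a = lookup≡ a x
eval-ren r (let′ s t)     a = eval-ren (ext r) t (agree-ext (eval-ren r s a) a)
eval-ren r true′          a = refl
eval-ren r false′         a = refl
eval-ren r (if′ b s t) {ρ} a rewrite eval-ren r b a with eval b ρ
... | true  = eval-ren r s a
... | false = eval-ren r t a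
eval-ren r (lit n)        a = refl
eval-ren r (add s t)      a = cong₂ _+_ (eval-ren r s a) (eval-ren r t a)
eval-ren r (monus s t)    a = cong₂ _∸_ (eval-ren r s a) (eval-ren r t a)
eval-ren r (mul s t)      a = cong₂ _*_ (eval-ren r s a) (eval-ren r t a)
eval-ren r (leq s t)      a = cong₂ _≤ᵇ_ (eval-ren r s a) (eval-ren r t a)
eval-ren r (digits t)     a rewrite eval-ren r t a = refl
eval-ren r (pair s t)     a = cong₂ _,_ (eval-ren r s a) (eval-ren r t a)
eval-ren r (fst t)        a = cong proj₁ (eval-ren r t a)
eval-ren r (snd t)        a = cong proj₂ (eval-ren r t a)
eval-ren r nil            a = refl
eval-ren r (cons s t)     a = cong₂ _∷_ (eval-ren r s a) (eval-ren r t a)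
eval-ren r (uncons l s t) a =
  unconsᴸ-cong (eval-ren r l a) (eval-ren r s a)
    λ x xs → eval-ren (ext (ext r)) t (agree-ext refl (agree-ext refl a))
eval-ren r (fold t s l)   a =
  foldr-cong′ (λ x y → eval-ren (ext (ext r)) t (agree-ext refl (agree-ext refl a)))
              (eval-ren r s a) (eval-ren r l a)

-- A variable costs 1 at any position of the context, so weakening a program is free.
cost-ren : ∀ {Γ Δ A} (r : Ren Γ Δ) (t : Γ ⊢ A) {ρ δ} → Agree r ρ δ →
           cost (ren r t) δ ≡ cost t ρ
cost-ren r (var x)        a = refl
cost-ren r (let′ s t)     a =
  cong₂ (λ m n → suc (m + n)) (cost-ren r s a)
        (cost-ren (ext r) t (agree-ext (eval-ren r s a) a))
cost-ren r true′          a = refl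
cost-ren r false′         a = refl
cost-ren r (if′ b s t) {ρ} a rewrite cost-ren r b a | eval-ren r b a with eval b ρ
... | true  = cong (suc (cost b ρ) +_) (cost-ren r s a)
... | false = cong (suc (cost b ρ) +_) (cost-ren r t a)
cost-ren r (lit n)        a = refl
cost-ren r (add s t)      a
  rewrite cost-ren r s a | cost-ren r t a | eval-ren r s a | eval-ren r t a = refl
cost-ren r (monus s t)    a
  rewrite cost-ren r s a | cost-ren r t a | eval-ren r s a | eval-ren r t a = refl
cost-ren r (mul s t)      a
  rewrite cost-ren r s a | cost-ren r t a | eval-ren r s a | eval-ren r t a = refl
cost-ren r (leq s t)      a
  rewrite cost-ren r s a | cost-ren r t a | eval-ren r s a | eval-ren r t a = refl
cost-ren r (digits t)     a rewrite cost-ren r t a | eval-ren r t a = refl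
cost-ren r (pair s t)     a = cong₂ (λ m n → suc (m + n)) (cost-ren r s a) (cost-ren r t a)
cost-ren r (fst t)        a = cong suc (cost-ren r t a)
cost-ren r (snd t)        a = cong suc (cost-ren r t a)
cost-ren r nil            a = refl
cost-ren r (cons s t)     a = cong₂ (λ m n → suc (m + n)) (cost-ren r s a) (cost-ren r t a)
cost-ren r (uncons l s t) a =
  cong₂ (λ m n → suc (m + n)) (cost-ren r l a)
    (unconsᴸ-cong (eval-ren r l a) (cost-ren r s a)
      λ x xs → cost-ren (ext (ext r)) t (agree-ext refl (agree-ext refl a)))
cost-ren r (fold t s l)   a =
  cong₂ _+_ (cong₂ (λ m n → suc (m + n)) (cost-ren r s a) (cost-ren r l a))
    (foldCost-cong
      (λ x y → eval-ren (ext (ext r)) t (agree-ext refl (agree-ext refl a)))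
      (λ x y → cong suc (cost-ren (ext (ext r)) t (agree-ext refl (agree-ext refl a))))
      (eval-ren r s a) (eval-ren r l a))

-- Programs with polynomial bounds

sizeEnv : ∀ {Γ} → Env Γ → ℕ
sizeEnv []            = 0
sizeEnv (_∷_ {A} x ρ) = size A x + sizeEnv ρ

lookup-size : ∀ {Γ A} (ρ : Env Γ) (x : A ∈ Γ) → size A (All.lookup ρ x) ≤ sizeEnv ρ
lookup-size (_∷_ {A} v ρ) (here refl) = m≤m+n (size A v) (sizeEnv ρ)
lookup-size (_∷_ {A} v ρ) (there x)   = ≤-trans (lookup-size ρ x) (m≤n+m (sizeEnv ρ) (size A v))

infix 4 _⊩_

-- The intended function `fn` is kept beside the term, so that correctness proofs work with `fn` and
-- never unfold `eval`. Cost and result size are bounded together because the cost of a composite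
-- depends on the sizes of intermediate values.
record _⊩_ (Γ : Ctx) (A : Ty) : Set where
  constructor mk
  field
    tm      : Γ ⊢ A
    fn      : Env Γ → ⟦ A ⟧
    bd      : Pol
    eval≡   : ∀ ρ → eval tm ρ ≡ fn ρ
    cost≤   : ∀ ρ → cost tm ρ ≤ ⟪ bd ⟫ (sizeEnv ρ)
    size≤   : ∀ ρ → size A (fn ρ) ≤ ⟪ bd ⟫ (sizeEnv ρ)

open _⊩_ public

recast : ∀ {Γ A} (p : Γ ⊩ A) (g : Env Γ → ⟦ A ⟧) → (∀ ρ → fn p ρ ≡ g ρ) → Γ ⊩ A
recast {A = A} p g eq = mk (tm p) g (bd p) (λ ρ → trans (eval≡ p ρ) (eq ρ)) (cost≤ p)
  (λ ρ → ≤-trans (≤-reflexive (cong (size A) (sym (eq ρ)))) (size≤ p ρ))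

-- `restrict` forgets the entries outside the smaller context. As this cannot enlarge the
-- environment, the polynomial of a program survives weakening unchanged.
record Thinning (Γ Δ : Ctx) : Set where
  field
    thin     : Ren Γ Δ
    restrict : Env Δ → Env Γ
    agree    : ∀ δ → Agree thin (restrict δ) δ
    shrinks  : ∀ δ → sizeEnv (restrict δ) ≤ sizeEnv δ

open Thinning

thinning : ∀ {Γ Δ A} → Thinning Γ Δ → Γ ⊩ A → Δ ⊩ A
thinning θ p = mk (ren (thin θ) (tm p)) (λ δ → fn p (restrict θ δ)) (bd p)
  (λ δ → trans (eval-ren (thin θ) (tm p) (agree θ δ)) (eval≡ p (restrict θ δ)))
  (λ δ → ≤-trans (≤-reflexive (cost-ren (thin θ) (tm p) (agree θ δ)))
           (≤-trans (cost≤ p (restrict θ δ)) (⟪⟫-mono (bd p) (shrinks θ δ))))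
  (λ δ → ≤-trans (size≤ p (restrict θ δ)) (⟪⟫-mono (bd p) (shrinks θ δ)))

wk : ∀ {Γ A B} → Γ ⊩ A → B ∷ Γ ⊩ A
wk {B = B} = thinning record
  { thin     = there
  ; restrict = λ { (_ ∷ ρ) → ρ }
  ; agree    = λ { (_ ∷ ρ) → agreeing λ _ → refl }
  ; shrinks  = λ { (x ∷ ρ) → m≤n+m (sizeEnv ρ) (size B x) }
  }

wk₁ : ∀ {Γ A B C} → A ∷ Γ ⊩ C → A ∷ B ∷ Γ ⊩ C
wk₁ {A = A} {B} = thinning record
  { thin     = ext there
  ; restrict = λ { (x ∷ _ ∷ ρ) → x ∷ ρ }
  ; agree    = λ { (x ∷ y ∷ ρ) → agree-ext refl (agreeing λ _ → refl) }
  ; shrinks  = λ { (x ∷ y ∷ ρ) → +-monoʳ-≤ (size A x) (m≤n+m (sizeEnv ρ) (size B y)) }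
  }

varᴾ : ∀ {Γ A} → A ∈ Γ → Γ ⊩ A
varᴾ x = mk (var x) (λ ρ → All.lookup ρ x) (κ 1 ⊞ X) (λ _ → refl)
  (λ ρ → s≤s z≤n) (λ ρ → ≤-trans (lookup-size ρ x) (n≤1+n _))

v0 : ∀ {Γ A} → A ∷ Γ ⊩ A
v0 = varᴾ (here refl)
v1 : ∀ {Γ A B} → B ∷ A ∷ Γ ⊩ A
v1 = varᴾ (there (here refl))
v2 : ∀ {Γ A B C} → C ∷ B ∷ A ∷ Γ ⊩ A
v2 = varᴾ (there (there (here refl)))
v3 : ∀ {Γ A B C D} → D ∷ C ∷ B ∷ A ∷ Γ ⊩ A
v3 = varᴾ (there (there (there (here refl))))

letᴾ : ∀ {Γ A B} → Γ ⊩ A → A ∷ Γ ⊩ B → Γ ⊩ B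
letᴾ {A = A} {B} s t = mk (let′ (tm s) (tm t)) (λ ρ → fn t (fn s ρ ∷ ρ))
  -- The body runs in an environment enlarged by a value of size at most `bd s`, whence the
  -- composition of polynomials.
  (κ 1 ⊞ bd s ⊞ bd t ⊚ (bd s ⊞ X))
  (λ ρ → trans (cong (λ x → eval (tm t) (x ∷ ρ)) (eval≡ s ρ)) (eval≡ t (fn s ρ ∷ ρ)))
  (λ ρ → +-mono-≤ (s≤s (cost≤ s ρ))
    (≤-trans (≤-reflexive (cong (λ x → cost (tm t) (x ∷ ρ)) (eval≡ s ρ)))
             (≤-trans (cost≤ t (fn s ρ ∷ ρ)) (arg ρ))))
  (λ ρ → ≤-trans (≤-trans (size≤ t (fn s ρ ∷ ρ)) (arg ρ)) (m≤n+m _ _))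
  where
  arg : ∀ ρ → ⟪ bd t ⟫ (sizeEnv (fn s ρ ∷ ρ)) ≤ ⟪ bd t ⟫ (⟪ bd s ⟫ (sizeEnv ρ) + sizeEnv ρ)
  arg ρ = ⟪⟫-mono (bd t) (+-monoˡ-≤ (sizeEnv ρ) (size≤ s ρ))

trueᴾ falseᴾ : ∀ {Γ} → Γ ⊩ bool
trueᴾ  = mk true′ (λ _ → true) (κ 1) (λ _ → refl) (λ _ → ≤-refl) (λ _ → ≤-refl)
falseᴾ = mk false′ (λ _ → false) (κ 1) (λ _ → refl) (λ _ → ≤-refl) (λ _ → ≤-refl)

ifᴾ : ∀ {Γ A} → Γ ⊩ bool → Γ ⊩ A → Γ ⊩ A → Γ ⊩ A
ifᴾ {Γ} {A} b s t = mk (if′ (tm b) (tm s) (tm t)) (λ ρ → if fn b ρ then fn s ρ else fn t ρ)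
  (κ 1 ⊞ bd b ⊞ (bd s ⊞ bd t)) ev
  (λ ρ → +-mono-≤ (s≤s (cost≤ b ρ)) (branch (eval (tm b) ρ) (cost≤ s ρ) (cost≤ t ρ)))
  sz
  where
  ev : ∀ ρ → eval (if′ (tm b) (tm s) (tm t)) ρ ≡ (if fn b ρ then fn s ρ else fn t ρ)
  ev ρ rewrite eval≡ b ρ | eval≡ s ρ | eval≡ t ρ = refl
  branch : ∀ c {k l m n} → k ≤ m → l ≤ n → (if c then k else l) ≤ m + n
  branch true  {m = m} {n} k≤ l≤ = ≤-trans k≤ (m≤m+n m n)
  branch false {m = m} {n} k≤ l≤ = ≤-trans l≤ (m≤n+m n m)
  sz : ∀ ρ → size A (if fn b ρ then fn s ρ else fn t ρ) ≤ _
  sz ρ with fn b ρ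
  ... | true  = ≤-trans (size≤ s ρ) (≤-trans (m≤m+n _ _) (m≤n+m _ (1 + ⟪ bd b ⟫ (sizeEnv ρ))))
  ... | false = ≤-trans (size≤ t ρ) (≤-trans (m≤n+m _ _) (m≤n+m _ (1 + ⟪ bd b ⟫ (sizeEnv ρ))))

litᴾ : ∀ {Γ} → ℕ → Γ ⊩ nat
litᴾ n = mk (lit n) (λ _ → n) (κ (bitLength n)) (λ _ → refl) (λ _ → ≤-refl) (λ _ → ≤-refl)

addᴾ monusᴾ mulᴾ : ∀ {Γ} → Γ ⊩ nat → Γ ⊩ nat → Γ ⊩ nat
addᴾ s t = mk (add (tm s) (tm t)) (λ ρ → fn s ρ + fn t ρ)
  (κ 1 ⊞ bd s ⊞ bd t ⊞ (bd s ⊞ bd t)) (λ ρ → cong₂ _+_ (eval≡ s ρ) (eval≡ t ρ))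
  (λ ρ → +-mono-≤ (+-mono-≤ (s≤s (cost≤ s ρ)) (cost≤ t ρ))
    (≤-trans (≤-reflexive (cong₂ (λ m n → bitLength m + bitLength n) (eval≡ s ρ) (eval≡ t ρ)))
             (+-mono-≤ (size≤ s ρ) (size≤ t ρ))))
  (λ ρ → ≤-trans (bitLength-+ (fn s ρ) (fn t ρ))
           (≤-trans (+-mono-≤ (size≤ s ρ) (size≤ t ρ))
             (m≤n+m _ (1 + ⟪ bd s ⟫ (sizeEnv ρ) + ⟪ bd t ⟫ (sizeEnv ρ)))))
monusᴾ s t = mk (monus (tm s) (tm t)) (λ ρ → fn s ρ ∸ fn t ρ)
  (κ 1 ⊞ bd s ⊞ bd t ⊞ (bd s ⊞ bd t)) (λ ρ → cong₂ _∸_ (eval≡ s ρ) (eval≡ t ρ))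
  (λ ρ → +-mono-≤ (+-mono-≤ (s≤s (cost≤ s ρ)) (cost≤ t ρ))
    (≤-trans (≤-reflexive (cong₂ (λ m n → bitLength m + bitLength n) (eval≡ s ρ) (eval≡ t ρ)))
             (+-mono-≤ (size≤ s ρ) (size≤ t ρ))))
  (λ ρ → ≤-trans (bitLength-mono (m∸n≤m (fn s ρ) (fn t ρ)))
           (≤-trans (size≤ s ρ) (≤-trans (m≤m+n _ (⟪ bd t ⟫ (sizeEnv ρ)))
             (m≤n+m _ (1 + ⟪ bd s ⟫ (sizeEnv ρ) + ⟪ bd t ⟫ (sizeEnv ρ))))))
mulᴾ s t = mk (mul (tm s) (tm t)) (λ ρ → fn s ρ * fn t ρ)
  (κ 1 ⊞ bd s ⊞ bd t ⊞ (bd s ⊠ bd t)) (λ ρ → cong₂ _*_ (eval≡ s ρ) (eval≡ t ρ))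
  (λ ρ → +-mono-≤ (+-mono-≤ (s≤s (cost≤ s ρ)) (cost≤ t ρ))
    (≤-trans (≤-reflexive (cong₂ (λ m n → bitLength m * bitLength n) (eval≡ s ρ) (eval≡ t ρ)))
             (*-mono-≤ (size≤ s ρ) (size≤ t ρ))))
  (λ ρ → ≤-trans (bitLength-* (fn s ρ) (fn t ρ))
           (≤-trans (+-mono-≤ (size≤ s ρ) (size≤ t ρ))
             (≤-trans (n≤1+n _) (m≤m+n _ _))))

leqᴾ : ∀ {Γ} → Γ ⊩ nat → Γ ⊩ nat → Γ ⊩ bool
leqᴾ s t = mk (leq (tm s) (tm t)) (λ ρ → fn s ρ ≤ᵇ fn t ρ)
  (κ 1 ⊞ bd s ⊞ bd t ⊞ (bd s ⊞ bd t)) (λ ρ → cong₂ _≤ᵇ_ (eval≡ s ρ) (eval≡ t ρ))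
  (λ ρ → +-mono-≤ (+-mono-≤ (s≤s (cost≤ s ρ)) (cost≤ t ρ))
    (≤-trans (≤-reflexive (cong₂ (λ m n → bitLength m + bitLength n) (eval≡ s ρ) (eval≡ t ρ)))
             (+-mono-≤ (size≤ s ρ) (size≤ t ρ))))
  (λ ρ → s≤s z≤n)

pairᴾ : ∀ {Γ A B} → Γ ⊩ A → Γ ⊩ B → Γ ⊩ A ⊗ B
pairᴾ s t = mk (pair (tm s) (tm t)) (λ ρ → fn s ρ , fn t ρ) (κ 1 ⊞ bd s ⊞ bd t)
  (λ ρ → cong₂ _,_ (eval≡ s ρ) (eval≡ t ρ))
  (λ ρ → +-mono-≤ (s≤s (cost≤ s ρ)) (cost≤ t ρ))
  (λ ρ → ≤-trans (+-mono-≤ (size≤ s ρ) (size≤ t ρ)) (n≤1+n _))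

fstᴾ : ∀ {Γ A B} → Γ ⊩ A ⊗ B → Γ ⊩ A
fstᴾ t = mk (fst (tm t)) (λ ρ → proj₁ (fn t ρ)) (κ 1 ⊞ bd t)
  (λ ρ → cong proj₁ (eval≡ t ρ)) (λ ρ → s≤s (cost≤ t ρ))
  (λ ρ → ≤-trans (m≤m+n _ _) (≤-trans (size≤ t ρ) (n≤1+n _)))

sndᴾ : ∀ {Γ A B} → Γ ⊩ A ⊗ B → Γ ⊩ B
sndᴾ t = mk (snd (tm t)) (λ ρ → proj₂ (fn t ρ)) (κ 1 ⊞ bd t)
  (λ ρ → cong proj₂ (eval≡ t ρ)) (λ ρ → s≤s (cost≤ t ρ))
  (λ ρ → ≤-trans (m≤n+m _ _) (≤-trans (size≤ t ρ) (n≤1+n _)))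

nilᴾ : ∀ {Γ A} → Γ ⊩ list A
nilᴾ = mk nil (λ _ → []) (κ 1) (λ _ → refl) (λ _ → ≤-refl) (λ _ → ≤-refl)

consᴾ : ∀ {Γ A} → Γ ⊩ A → Γ ⊩ list A → Γ ⊩ list A
consᴾ {A = A} s t = mk (cons (tm s) (tm t)) (λ ρ → fn s ρ ∷ fn t ρ) (κ 1 ⊞ bd s ⊞ bd t)
  (λ ρ → cong₂ _∷_ (eval≡ s ρ) (eval≡ t ρ))
  (λ ρ → +-mono-≤ (s≤s (cost≤ s ρ)) (cost≤ t ρ))
  (λ ρ → ≤-trans (≤-reflexive (cong suc (sym (+-suc (size A (fn s ρ)) _))))
           (s≤s (+-mono-≤ (size≤ s ρ) (size≤ t ρ))))

unconsᴾ : ∀ {Γ A B} → Γ ⊩ list A → Γ ⊩ B → A ∷ list A ∷ Γ ⊩ B → Γ ⊩ B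
unconsᴾ {Γ} {A} {B} l s t = mk (uncons (tm l) (tm s) (tm t)) f
  (κ 1 ⊞ bd l ⊞ (bd s ⊞ bd t ⊚ (bd l ⊞ X)))
  (λ ρ → unconsᴸ-cong (eval≡ l ρ) (eval≡ s ρ) (λ x xs → eval≡ t (x ∷ xs ∷ ρ)))
  (λ ρ → +-mono-≤ (s≤s (cost≤ l ρ))
    (≤-trans (≤-reflexive (unconsᴸ-cong {f = λ x xs → cost (tm t) (x ∷ xs ∷ ρ)} (eval≡ l ρ) refl (λ _ _ → refl)))
             (branch ρ (fn l ρ) (size≤ l ρ) (cost≤ s ρ) (cost≤ t))))
  (λ ρ → ≤-trans (≤-trans (≤-reflexive (distrib (fn l ρ)))
                          (branch ρ (fn l ρ) (size≤ l ρ) (size≤ s ρ) (size≤ t)))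
                 (m≤n+m _ (1 + ⟪ bd l ⟫ (sizeEnv ρ))))
  where
  f : Env Γ → ⟦ B ⟧
  f ρ = unconsᴸ (fn l ρ) (fn s ρ) (λ x xs → fn t (x ∷ xs ∷ ρ))
  distrib : ∀ {b} {g : ⟦ A ⟧ → List ⟦ A ⟧ → ⟦ B ⟧} xs →
            size B (unconsᴸ xs b g) ≡ unconsᴸ xs (size B b) (λ x xs → size B (g x xs))
  distrib []      = refl
  distrib (_ ∷ _) = refl
  branch : ∀ ρ (xs : List ⟦ A ⟧) {c d : ℕ} {e : Env (A ∷ list A ∷ Γ) → ℕ} {n} → size (list A) xs ≤ n →
           c ≤ d → (∀ δ → e δ ≤ ⟪ bd t ⟫ (sizeEnv δ)) →
           unconsᴸ xs c (λ x xs → e (x ∷ xs ∷ ρ)) ≤ d + ⟪ bd t ⟫ (n + sizeEnv ρ)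
  branch ρ []       xs≤ c≤ e≤ = ≤-trans c≤ (m≤m+n _ _)
  branch ρ (x ∷ xs) {n = n} xs≤ c≤ e≤ = ≤-trans (e≤ (x ∷ xs ∷ ρ)) (≤-trans (⟪⟫-mono (bd t) (begin
    size A x + (size (list A) xs + sizeEnv ρ)  ≡⟨ +-assoc (size A x) _ _ ⟨
    size A x + size (list A) xs + sizeEnv ρ    ≤⟨ +-monoˡ-≤ (sizeEnv ρ) (≤-trans (≤-reflexive (+-suc (size A x) _)) (≤-trans (n≤1+n _) xs≤)) ⟩
    n + sizeEnv ρ ∎)) (m≤n+m _ _))
    where open ≤-Reasoning

size-∷ : ∀ A x xs → size (list A) (x ∷ xs) ≡ suc (size A x + size (list A) xs)
size-∷ A x xs = cong suc (sym (+-suc (size A x) _))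

length≤size : ∀ A xs → length xs ≤ size (list A) xs
length≤size A []       = z≤n
length≤size A (x ∷ xs) = ≤-trans (s≤s (≤-trans (length≤size A xs) (m≤n+m _ (size A x))))
                                 (≤-reflexive (sym (size-∷ A x xs)))

-- `g` bounds each accumulator by the size of the part already folded, and `h` bounds a step by the
-- sizes of its arguments. By monotonicity each step costs at most what the whole list would allow.
foldCost-≤ : ∀ {A B} {f : ⟦ A ⟧ → ⟦ B ⟧ → ⟦ B ⟧} {c b} {g : ℕ → ℕ} → (∀ {m n} → m ≤ n → g m ≤ g n) →
             {h : ℕ → ℕ} → (∀ {m n} → m ≤ n → h m ≤ h n) →
             (∀ x y → c x y ≤ h (size A x + size B y)) →
             (∀ ys → size B (foldr f b ys) ≤ g (size (list A) ys)) → ∀ n xs → size (list A) xs ≤ n →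
             foldCost f c b xs ≤ length xs * h (n + g n)
foldCost-≤ g-mono h-mono c≤ f≤ n [] xs≤ = z≤n
foldCost-≤ {A} {B} {f} {c} {b} {g} g-mono {h} h-mono c≤ f≤ n (x ∷ xs) xs≤ = begin
  foldCost f c b xs + c x (foldr f b xs)     ≤⟨ +-mono-≤ (foldCost-≤ {A} {B} g-mono h-mono c≤ f≤ n xs tail≤) (c≤ x _) ⟩
  length xs * h (n + g n) + h (size A x + size B (foldr f b xs))
    ≤⟨ +-monoʳ-≤ (length xs * h (n + g n)) (h-mono (+-mono-≤ head≤ (≤-trans (f≤ xs) (g-mono tail≤)))) ⟩
  length xs * h (n + g n) + h (n + g n)      ≡⟨ +-comm _ (h (n + g n)) ⟩
  length (x ∷ xs) * h (n + g n)              ∎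
  where
  open ≤-Reasoning
  all≤ : suc (size A x + size (list A) xs) ≤ n
  all≤ = ≤-trans (≤-reflexive (sym (size-∷ A x xs))) xs≤
  tail≤ : size (list A) xs ≤ n
  tail≤ = ≤-trans (≤-trans (m≤n+m _ (size A x)) (n≤1+n _)) all≤
  head≤ : size A x ≤ n
  head≤ = ≤-trans (≤-trans (m≤m+n (size A x) _) (n≤1+n _)) all≤

foldFn : ∀ {Γ A B} → A ∷ B ∷ Γ ⊩ B → Γ ⊩ B → Env Γ → List ⟦ A ⟧ → ⟦ B ⟧
foldFn t s ρ = foldr (λ x y → fn t (x ∷ y ∷ ρ)) (fn s ρ)

-- The only place where a polynomial bound on a result has to be supplied:
-- iterating a polynomially bounded step may well grow exponentially.
foldᴾ : ∀ {Γ A B} (t : A ∷ B ∷ Γ ⊩ B) (s : Γ ⊩ B) (l : Γ ⊩ list A) (b : Pol) →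
        (∀ ρ ys → size B (foldFn t s ρ ys) ≤ ⟪ b ⟫ (sizeEnv ρ + size (list A) ys)) → Γ ⊩ B
foldᴾ {Γ} {A} {B} t s l b b≤ = mk (fold (tm t) (tm s) (tm l)) (λ ρ → foldFn t s ρ (fn l ρ))
  (κ 1 ⊞ bd s ⊞ bd l ⊞ bd l ⊠ (κ 1 ⊞ bd t ⊚ (bd l ⊞ b ⊚ (X ⊞ bd l) ⊞ X)) ⊞ b ⊚ (X ⊞ bd l))
  (λ ρ → foldr-cong′ (λ x y → eval≡ t (x ∷ y ∷ ρ)) (eval≡ s ρ) (eval≡ l ρ))
  (λ ρ → ≤-trans (+-mono-≤ (s≤s (+-mono-≤ (cost≤ s ρ) (cost≤ l ρ))) (fc ρ)) (m≤m+n _ _))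
  (λ ρ → ≤-trans (b≤ ρ (fn l ρ)) (≤-trans (⟪⟫-mono b (+-monoʳ-≤ (sizeEnv ρ) (size≤ l ρ))) (m≤n+m _ _)))
  where
  open ≤-Reasoning
  fc : ∀ ρ → foldCost (λ x y → eval (tm t) (x ∷ y ∷ ρ)) (λ x y → 1 + cost (tm t) (x ∷ y ∷ ρ))
               (eval (tm s) ρ) (eval (tm l) ρ) ≤ _
  fc ρ = begin
    _ ≡⟨ foldCost-cong {c′ = λ x y → 1 + cost (tm t) (x ∷ y ∷ ρ)}
           (λ x y → eval≡ t (x ∷ y ∷ ρ)) (λ x y → refl) (eval≡ s ρ) (eval≡ l ρ) ⟩
    foldCost (λ x y → fn t (x ∷ y ∷ ρ)) (λ x y → 1 + cost (tm t) (x ∷ y ∷ ρ)) (fn s ρ) (fn l ρ)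
      ≤⟨ foldCost-≤ {A} {B} {g = λ m → ⟪ b ⟫ (sizeEnv ρ + m)} (λ m≤ → ⟪⟫-mono b (+-monoʳ-≤ (sizeEnv ρ) m≤))
           {h = λ m → 1 + ⟪ bd t ⟫ (m + sizeEnv ρ)} (λ m≤ → s≤s (⟪⟫-mono (bd t) (+-monoˡ-≤ (sizeEnv ρ) m≤)))
           (λ x y → s≤s (≤-trans (cost≤ t (x ∷ y ∷ ρ)) (⟪⟫-mono (bd t) (≤-reflexive (sym (+-assoc (size A x) (size B y) (sizeEnv ρ)))))))
           (b≤ ρ) (⟪ bd l ⟫ (sizeEnv ρ)) (fn l ρ) (size≤ l ρ) ⟩
    length (fn l ρ) * _ ≤⟨ *-monoˡ-≤ _ (≤-trans (length≤size A (fn l ρ)) (size≤ l ρ)) ⟩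
    _ ∎

-- Finite sums

∑ : {A : Set} → List A → (A → ℕ) → ℕ
∑ xs f = sum (map f xs)

infix 5 [_]∙_

[_]∙_ : Bool → ℕ → ℕ
[ b ]∙ n = if b then n else 0

module _ {A : Set} where

  ∑-cong : ∀ (xs : List A) {f g} → (∀ {x} → x ∈ xs → f x ≡ g x) → ∑ xs f ≡ ∑ xs g
  ∑-cong []       h = refl
  ∑-cong (x ∷ xs) h = cong₂ _+_ (h (here refl)) (∑-cong xs (h ∘ there))

  ∑-mono : ∀ (xs : List A) {f g} → (∀ {x} → x ∈ xs → f x ≤ g x) → ∑ xs f ≤ ∑ xs g
  ∑-mono []       h = z≤n
  ∑-mono (x ∷ xs) h = +-mono-≤ (h (here refl)) (∑-mono xs (h ∘ there))

  ∑-++ : ∀ (xs ys : List A) f → ∑ (xs ++ ys) f ≡ ∑ xs f + ∑ ys f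
  ∑-++ xs ys f = trans (cong sum (map-++ f xs ys)) (sum-++ (map f xs) (map f ys))

  ∑-↭ : ∀ {xs ys : List A} f → xs ↭ ys → ∑ xs f ≡ ∑ ys f
  ∑-↭ f p = sum-↭ (↭-map⁺ f p)

  ∑-+ : ∀ (xs : List A) f g → ∑ xs (λ x → f x + g x) ≡ ∑ xs f + ∑ xs g
  ∑-+ []       f g = refl
  ∑-+ (x ∷ xs) f g = trans (cong (f x + g x +_) (∑-+ xs f g)) (+-interchange (f x) (g x) _ _)

  ∑-* : ∀ c (xs : List A) f → ∑ xs (λ x → c * f x) ≡ c * ∑ xs f
  ∑-* c []       f = sym (*-zeroʳ c)
  ∑-* c (x ∷ xs) f = trans (cong (c * f x +_) (∑-* c xs f)) (sym (*-distribˡ-+ c (f x) _))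

  ∑-const : ∀ (xs : List A) c → ∑ xs (λ _ → c) ≡ length xs * c
  ∑-const []       c = refl
  ∑-const (x ∷ xs) c = cong (c +_) (∑-const xs c)

  ∑-zero : ∀ (xs : List A) {f} → (∀ {x} → x ∈ xs → f x ≡ 0) → ∑ xs f ≡ 0
  ∑-zero xs h = trans (∑-cong xs h) (trans (∑-const xs 0) (*-zeroʳ (length xs)))

  ∑-filter : ∀ p (xs : List A) f → ∑ (filterᵇ p xs) f ≡ ∑ xs (λ x → [ p x ]∙ f x)
  ∑-filter p []       f = refl
  ∑-filter p (x ∷ xs) f with p x
  ... | true  = cong (f x +_) (∑-filter p xs f)
  ... | false = ∑-filter p xs f

  length-∑ : ∀ (xs : List A) → length xs ≡ ∑ xs (λ _ → 1)
  length-∑ xs = sym (trans (∑-const xs 1) (*-identityʳ _))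

  ∈⇒≤∑ : ∀ {x} {xs : List A} f → x ∈ xs → f x ≤ ∑ xs f
  ∈⇒≤∑ f (here refl) = m≤m+n _ _
  ∈⇒≤∑ {xs = y ∷ _} f (there x∈) = ≤-trans (∈⇒≤∑ f x∈) (m≤n+m _ (f y))

  ∑-≤-length : ∀ (xs : List A) {f} → (∀ x → f x ≤ 1) → ∑ xs f ≤ length xs
  ∑-≤-length xs h = ≤-trans (∑-mono xs (λ {x} _ → h x)) (≤-reflexive (sym (length-∑ xs)))

∑-map : {A B : Set} (g : A → B) (xs : List A) (f : B → ℕ) → ∑ (map g xs) f ≡ ∑ xs (f ∘ g)
∑-map g xs f = cong sum (sym (map-∘ xs))

∑-swap : {A B : Set} (xs : List A) (ys : List B) (f : A → B → ℕ) →
         ∑ xs (λ x → ∑ ys (f x)) ≡ ∑ ys (λ y → ∑ xs (λ x → f x y))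
∑-swap []       ys f = sym (∑-zero ys (λ _ → refl))
∑-swap (x ∷ xs) ys f = trans (cong (∑ ys (f x) +_) (∑-swap xs ys f)) (sym (∑-+ ys (f x) _))

∑-concatMap : {A B : Set} (g : A → List B) (xs : List A) (f : B → ℕ) →
              ∑ (concatMap g xs) f ≡ ∑ xs (λ x → ∑ (g x) f)
∑-concatMap g []       f = refl
∑-concatMap g (x ∷ xs) f = trans (∑-++ (g x) _ f) (cong (∑ (g x) f +_) (∑-concatMap g xs f))

[]∙-≤ : ∀ b n → [ b ]∙ n ≤ n
[]∙-≤ true  n = ≤-refl
[]∙-≤ false n = z≤n

≡ᵇ-refl : ∀ n → (n ≡ᵇ n) ≡ true
≡ᵇ-refl zero    = refl
≡ᵇ-refl (suc n) = ≡ᵇ-refl n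

≡ᵇ-true : ∀ m n → (m ≡ᵇ n) ≡ true → m ≡ n
≡ᵇ-true m n eq = ≡ᵇ⇒≡ m n (subst T (sym eq) _)

≢⇒≡ᵇ-false : ∀ {m n} → m ≢ n → (m ≡ᵇ n) ≡ false
≢⇒≡ᵇ-false {m} {n} m≢n with m ≡ᵇ n in eq
... | true  = contradiction (≡ᵇ-true m n eq) m≢n
... | false = refl

≡ᵇ-sym : ∀ m n → (m ≡ᵇ n) ≡ (n ≡ᵇ m)
≡ᵇ-sym zero    zero    = refl
≡ᵇ-sym zero    (suc n) = refl
≡ᵇ-sym (suc m) zero    = refl
≡ᵇ-sym (suc m) (suc n) = ≡ᵇ-sym m n

≤ᵇ-true : ∀ {m n} → (m ≤ᵇ n) ≡ true → m ≤ n
≤ᵇ-true {m} {n} eq = ≤ᵇ⇒≤ m n (subst T (sym eq) _)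

≤⇒≤ᵇ-true : ∀ {m n} → m ≤ n → (m ≤ᵇ n) ≡ true
≤⇒≤ᵇ-true {m} {n} m≤n with m ≤ᵇ n | ≤⇒≤ᵇ m≤n
... | true | _ = refl

≤ᵇ-false : ∀ {m n} → (m ≤ᵇ n) ≡ false → n < m
≤ᵇ-false {m} {n} eq = ≰⇒> λ m≤n → case trans (sym eq) (≤⇒≤ᵇ-true m≤n) of λ ()

∑-∉ : ∀ {y} xs (f : ℕ → ℕ) → y ∉ xs → ∑ xs (λ x → [ y ≡ᵇ x ]∙ f x) ≡ 0
∑-∉ {y} xs f y∉ = ∑-zero xs λ {x} x∈ →
  cong ([_]∙ f x) (≢⇒≡ᵇ-false {y} {x} λ { refl → y∉ x∈ })

∑-single : ∀ {y xs} (f : ℕ → ℕ) → Unique xs → y ∈ xs → ∑ xs (λ x → [ y ≡ᵇ x ]∙ f x) ≡ f y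
∑-single {y} {x ∷ xs} f (x≢ ∷ u) (here refl) = begin
  ([ y ≡ᵇ y ]∙ f y) + ∑ xs (λ x → [ y ≡ᵇ x ]∙ f x)
    ≡⟨ cong₂ _+_ (cong ([_]∙ f y) (≡ᵇ-refl y)) (∑-∉ xs f (λ y∈ → All.lookup x≢ y∈ refl)) ⟩
  f y + 0  ≡⟨ +-identityʳ (f y) ⟩
  f y      ∎
  where open ≡-Reasoning
∑-single {y} {x ∷ xs} f (x≢ ∷ u) (there y∈) =
  trans (cong (λ b → ([ b ]∙ f x) + ∑ xs (λ x → [ y ≡ᵇ x ]∙ f x))
              (≢⇒≡ᵇ-false {y} {x} λ { refl → All.lookup x≢ y∈ refl }))
        (∑-single f u y∈)

count : ℕ → List ℕ → ℕ
count c xs = ∑ xs (λ x → if x ≡ᵇ c then 1 else 0)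

-- Exhibits the sum as a function of the multiplicities, so that lists with equal counts have equal
-- sums.
∑-by-count : ∀ d xs (f : ℕ → ℕ) → (∀ {x} → x ∈ xs → x < d) →
             ∑ xs f ≡ ∑ (upTo d) (λ c → count c xs * f c)
∑-by-count d xs f xs< = begin
  ∑ xs f
    ≡⟨ ∑-cong xs (λ x∈ → sym (∑-single f (upTo⁺ d) (∈-upTo⁺ (xs< x∈)))) ⟩
  ∑ xs (λ x → ∑ (upTo d) (λ c → [ x ≡ᵇ c ]∙ f c))
    ≡⟨ ∑-swap xs (upTo d) _ ⟩
  ∑ (upTo d) (λ c → ∑ xs (λ x → [ x ≡ᵇ c ]∙ f c))
    ≡⟨ ∑-cong (upTo d) (λ {c} _ → trans (∑-cong xs (λ {x} _ → sel (x ≡ᵇ c) (f c)))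
                                  (trans (∑-* (f c) xs _) (*-comm (f c) _))) ⟩
  ∑ (upTo d) (λ c → count c xs * f c) ∎
  where
  open ≡-Reasoning
  sel : ∀ b n → [ b ]∙ n ≡ n * (if b then 1 else 0)
  sel true  n = sym (*-identityʳ n)
  sel false n = sym (*-zeroʳ n)

count≤length : ∀ c xs → count c xs ≤ length xs
count≤length c xs = ∑-≤-length xs λ x → le (x ≡ᵇ c)
  where
  le : ∀ b → (if b then 1 else 0) ≤ 1
  le true  = ≤-refl
  le false = z≤n

-- Greedy placement of jobs

-- Built from `foldr`, `unconsᴸ` and `if` alone, so that the program for it has this value
-- definitionally. Several functions below owe their form to the same aim.
extract : {A : Set} → (A → Bool) → List A → List A × List A
extract {A} p = foldr pick ([] , [])
  where
  pick : A → List A × List A → List A × List A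
  pick y acc = unconsᴸ (proj₁ acc)
    (if p y then (y ∷ [] , proj₂ acc) else ([] , y ∷ proj₂ acc))
    (λ _ _ → proj₁ acc , y ∷ proj₂ acc)

data Extracted {A : Set} (p : A → Bool) (xs : List A) : List A × List A → Set where
  none : All (λ x → p x ≡ false) xs → Extracted p xs ([] , xs)
  one  : ∀ {y ys} → p y ≡ true → xs ↭ y ∷ ys → Extracted p xs (y ∷ [] , ys)

extracted : {A : Set} (p : A → Bool) (xs : List A) → Extracted p xs (extract p xs)
extracted p []       = none []
extracted p (x ∷ xs) with extract p xs | extracted p xs
... | _ | one py perm = one py (↭-trans (↭-prep x perm) (↭-swap x _ ↭-refl))
... | _ | none ps with p x in px
...   | true  = one px ↭-refl
...   | false = none (px ∷ ps)

eqJob : Job → Job → Bool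
eqJob i j = (proj₁ i ≡ᵇ proj₁ j) ∧ (proj₂ i ≡ᵇ proj₂ j)

-- A resource (i , true , c) is a slot on machine i reserved for a job of
-- class c, and (i , false , v) is a room of size v for small jobs.
Resource : Set
Resource = ℕ × Bool × ℕ

Placed : Set
Placed = List (Job × Machine)

Stage : Set
Stage = Placed × List Resource

module Rounding (E : ℕ) where

  N S : ℕ
  N = E * E
  S = N * E

  w : Job → ℕ
  w j = S * time j

  levels : ℕ → List ℕ
  levels zero    = []
  levels (suc n) = suc n ∷ levels n

  -- The guess T is given by the unit U = E * T, to which the scaling of the
  -- processing times is adapted: S * T is N * U.
  big : ℕ → Job → Bool
  big U j = not (w j ≤ᵇ E * U)

  -- For `U > 0` this is the integer quotient of `w j` by `U`, capped at `N`, obtained by counting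
  -- multiples in the absence of division.
  cls : ℕ → Job → ℕ
  cls U j = ∑ (levels N) (λ k → if k * U ≤ᵇ w j then 1 else 0)

  matches : ℕ → Job → Resource → Bool
  matches U j r =
    if big U j
    then (if proj₁ (proj₂ r) then proj₂ (proj₂ r) ≡ᵇ cls U j else false)
    else (if proj₁ (proj₂ r) then false else w j ≤ᵇ proj₂ (proj₂ r))

  place₁ : ℕ → Job → Stage → Stage
  place₁ U j s =
    unconsᴸ (proj₁ (extract (matches U j) (proj₂ s))) s
      (λ r _ → (j , proj₁ r) ∷ proj₁ s ,
               (if proj₁ (proj₂ r)
                then proj₂ (extract (matches U j) (proj₂ s))
                else (proj₁ r , false , proj₂ (proj₂ r) ∸ w j) ∷
                     proj₂ (extract (matches U j) (proj₂ s))))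

  place : ℕ → List Resource → List Job → Stage
  place U rs js = foldr (place₁ U) ([] , rs) js

  -- A view of `place₁` without its nested conditionals; all invariants of placing are proved by
  -- cases on it.
  data Step (U : ℕ) (j : Job) : Stage → Stage → Set where
    skip : ∀ {as rs} → All (λ r → matches U j r ≡ false) rs → Step U j (as , rs) (as , rs)
    slot : ∀ {as rs i rest} → big U j ≡ true → rs ↭ (i , true , cls U j) ∷ rest →
           Step U j (as , rs) ((j , i) ∷ as , rest)
    room : ∀ {as rs i v rest} → big U j ≡ false → w j ≤ v → rs ↭ (i , false , v) ∷ rest →
           Step U j (as , rs) ((j , i) ∷ as , (i , false , v ∸ w j) ∷ rest)

  place₁-step : ∀ U j s → Step U j s (place₁ U j s)
  place₁-step U j (as , rs)
    with extract (matches U j) rs | extracted (matches U j) rs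
  ... | _ | none ns = skip ns
  ... | _ | one {i , b , v} m p with big U j in bg
  place₁-step U j (as , rs) | _ | one {i , true , v} m p | true
    rewrite ≡ᵇ-true v (cls U j) m = slot bg p
  place₁-step U j (as , rs) | _ | one {i , false , v} () p | true
  place₁-step U j (as , rs) | _ | one {i , true , v} () p | false
  place₁-step U j (as , rs) | _ | one {i , false , v} m p | false = room bg (≤ᵇ-true m) p

  place-ind : ∀ {ℓ} U {P : Stage → Set ℓ} js {s} → P s →
              (∀ {j s s′} → j ∈ js → Step U j s s′ → P s → P s′) → P (foldr (place₁ U) s js)
  place-ind U []       p0 ps = p0
  place-ind U (j ∷ js) p0 ps =
    ps (here refl) (place₁-step U j _) (place-ind U js p0 (ps ∘ there))

  slotOf : ℕ → Resource → ℕ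
  slotOf c (_ , true  , v) = if v ≡ᵇ c then 1 else 0
  slotOf c (_ , false , v) = 0

  roomOf : Resource → ℕ
  roomOf (_ , true  , v) = 0
  roomOf (_ , false , v) = v

  isRoom : Resource → ℕ
  isRoom (_ , true  , v) = 0
  isRoom (_ , false , v) = 1

  classOf : ℕ → ℕ → Job → ℕ
  classOf U c j = [ big U j ]∙ (if cls U j ≡ᵇ c then 1 else 0)

  smallOf : ℕ → Job → ℕ
  smallOf U j = [ not (big U j) ]∙ w j

  -- Rooms may be exceeded by h.
  spaceOf : ℕ → ℕ → ℕ → Resource → ℕ
  spaceOf U h i (m , true  , v) = [ m ≡ᵇ i ]∙ (suc v * U)
  spaceOf U h i (m , false , v) = [ m ≡ᵇ i ]∙ (v + h)

  loadOf : ℕ → Job × Machine → ℕ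
  loadOf i (j , m) = [ m ≡ᵇ i ]∙ w j

  -- A conservation law, like `step-rooms` below: a step only converts a slot, or part of a room,
  -- into the job that takes it. What is still free can later be computed from what was opened.
  step-slots : ∀ U c {j s s′} → Step U j s s′ →
               ∑ (proj₂ s′) (slotOf c) + ∑ (proj₁ s′) (classOf U c ∘ proj₁)
               ≡ ∑ (proj₂ s) (slotOf c) + ∑ (proj₁ s) (classOf U c ∘ proj₁)
  step-slots U c (skip _) = refl
  step-slots U c {j} (slot {as} {rs} {i} {rest} b p) rewrite b | ∑-↭ (slotOf c) p = begin
    ∑ rest (slotOf c) + (x + A)  ≡⟨ +-assoc (∑ rest (slotOf c)) x A ⟨
    ∑ rest (slotOf c) + x + A    ≡⟨ cong (_+ A) (+-comm (∑ rest (slotOf c)) x) ⟩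
    x + ∑ rest (slotOf c) + A    ∎
    where
    open ≡-Reasoning
    x = if cls U j ≡ᵇ c then 1 else 0
    A = ∑ as (classOf U c ∘ proj₁)
  step-slots U c (room b _ p) rewrite b | ∑-↭ (slotOf c) p = refl

  step-rooms : ∀ U {j s s′} → Step U j s s′ →
               ∑ (proj₂ s′) roomOf + ∑ (proj₁ s′) (smallOf U ∘ proj₁)
               ≡ ∑ (proj₂ s) roomOf + ∑ (proj₁ s) (smallOf U ∘ proj₁)
  step-rooms U (skip _) = refl
  step-rooms U (slot b p) rewrite b | ∑-↭ roomOf p = refl
  step-rooms U {j} (room {as} {rs} {i} {v} {rest} b w≤v p) rewrite b | ∑-↭ roomOf p = begin
    v ∸ w j + R + (w j + A)      ≡⟨ +-interchange (v ∸ w j) R (w j) A ⟩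
    v ∸ w j + w j + (R + A)      ≡⟨ cong (_+ (R + A)) (m∸n+n≡m w≤v) ⟩
    v + (R + A)                  ≡⟨ +-assoc v R A ⟨
    v + R + A                    ∎
    where
    open ≡-Reasoning
    R = ∑ rest roomOf
    A = ∑ as (smallOf U ∘ proj₁)

  step-isRoom : ∀ U {j s s′} → Step U j s s′ → ∑ (proj₂ s′) isRoom ≡ ∑ (proj₂ s) isRoom
  step-isRoom U (skip _)     = refl
  step-isRoom U (slot _ p)   = sym (∑-↭ isRoom p)
  step-isRoom U (room _ _ p) = sym (∑-↭ isRoom p)

  -- A slot is charged in advance for the longest job of its class. Load plus space is therefore a
  -- potential that never grows, and the initial space bounds the final load.
  step-space : ∀ U h i {j s s′} → (big U j ≡ true → w j ≤ suc (cls U j) * U) → Step U j s s′ →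
               ∑ (proj₁ s′) (loadOf i) + ∑ (proj₂ s′) (spaceOf U h i)
               ≤ ∑ (proj₁ s) (loadOf i) + ∑ (proj₂ s) (spaceOf U h i)
  step-space U h i w≤ (skip _) = ≤-refl
  step-space U h i {j} w≤ (slot {as} {rs} {m} {rest} b p) rewrite ∑-↭ (spaceOf U h i) p = begin
    x + A + R      ≡⟨ cong (_+ R) (+-comm x A) ⟩
    A + x + R      ≡⟨ +-assoc A x R ⟩
    A + (x + R)    ≤⟨ +-monoʳ-≤ A (+-monoˡ-≤ R (x≤ (m ≡ᵇ i))) ⟩
    A + _          ∎
    where
    open ≤-Reasoning
    x = loadOf i (j , m)
    A = ∑ as (loadOf i)
    R = ∑ rest (spaceOf U h i)
    x≤ : ∀ b → [ b ]∙ w j ≤ [ b ]∙ (suc (cls U j) * U)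
    x≤ true  = w≤ b
    x≤ false = z≤n
  step-space U h i {j} w≤ (room {as} {rs} {m} {v} {rest} b w≤v p) rewrite ∑-↭ (spaceOf U h i) p =
    ≤-reflexive (begin
    x + A + (y + R)     ≡⟨ cong (_+ (y + R)) (+-comm x A) ⟩
    A + x + (y + R)     ≡⟨ +-assoc A x (y + R) ⟩
    A + (x + (y + R))   ≡⟨ cong (A +_) (+-assoc x y R) ⟨
    A + (x + y + R)     ≡⟨ cong (λ z → A + (z + R)) (x+y (m ≡ᵇ i)) ⟩
    A + _               ∎)
    where
    open ≡-Reasoning
    x = loadOf i (j , m)
    y = [ m ≡ᵇ i ]∙ (v ∸ w j + h)
    A = ∑ as (loadOf i)
    R = ∑ rest (spaceOf U h i)
    x+y : ∀ b → ([ b ]∙ w j) + ([ b ]∙ (v ∸ w j + h)) ≡ [ b ]∙ (v + h)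
    x+y true  = trans (sym (+-assoc (w j) _ h)) (cong (_+ h) (m+[n∸m]≡n w≤v))
    x+y false = refl

  module _ {P : Machine → Set} where

    OnMachines : Stage → Set
    OnMachines (as , rs) = All (P ∘ proj₂) as × All (P ∘ proj₁) rs

    step-machines : ∀ U {j s s′} → Step U j s s′ → OnMachines s → OnMachines s′
    step-machines U (skip _) ps = ps
    step-machines U (slot _ p) (pa , pr) with All-resp-↭ p pr
    ... | px ∷ pxs = px ∷ pa , pxs
    step-machines U (room _ _ p) (pa , pr) with All-resp-↭ p pr
    ... | px ∷ pxs = px ∷ pa , px ∷ pxs

  place-jobs : ∀ U rs js → map proj₁ (proj₁ (place U rs js)) ⊆ js
  place-jobs U rs []       = []
  place-jobs U rs (j ∷ js) with place U rs js | place-jobs U rs js | place₁-step U j (place U rs js)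
  ... | as , rs′ | sub | st = sub-step st
    where
    sub-step : ∀ {s′} → Step U j (as , rs′) s′ → map proj₁ (proj₁ s′) ⊆ j ∷ js
    sub-step (skip _)     = j ∷ʳ sub
    sub-step (slot _ _)   = refl ∷ sub
    sub-step (room _ _ _) = refl ∷ sub

  matches-slot : ∀ {U j i v} → big U j ≡ true → matches U j (i , true , v) ≡ (v ≡ᵇ cls U j)
  matches-slot b rewrite b = refl

  matches-room : ∀ {U j i v} → big U j ≡ false → matches U j (i , false , v) ≡ (w j ≤ᵇ v)
  matches-room b rewrite b = refl

  no-slots : ∀ {U j rs} → big U j ≡ true → All (λ r → matches U j r ≡ false) rs →
             ∑ rs (slotOf (cls U j)) ≡ 0
  no-slots b [] = refl
  no-slots {U} {j} {(i , true , v) ∷ rs} b (n ∷ ns)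
    rewrite trans (sym (matches-slot {U} {j} {i} {v} b)) n = no-slots {U} {j} b ns
  no-slots {U} {j} {(i , false , v) ∷ rs} b (n ∷ ns) = no-slots {U} {j} b ns

  -- Each rejecting room is strictly smaller than the job. Summing `suc v ≤ t` over the rooms gives
  -- the summand `∑ rs isRoom`, from which strict inequalities are obtained later.
  small-rooms : ∀ {U j t rs} → big U j ≡ false → w j ≤ t → All (λ r → matches U j r ≡ false) rs →
                ∑ rs roomOf + ∑ rs isRoom ≤ ∑ rs isRoom * t
  small-rooms b w≤t [] = z≤n
  small-rooms {U} {j} {rs = (i , true , v) ∷ rs} b w≤t (n ∷ ns) = small-rooms {U} {j} b w≤t ns
  small-rooms {U} {j} {t} {(i , false , v) ∷ rs} b w≤t (n ∷ ns) = begin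
    v + R + suc n′        ≡⟨ +-suc (v + R) n′ ⟩
    suc (v + R + n′)      ≡⟨ cong suc (+-assoc v R n′) ⟩
    suc v + (R + n′)      ≤⟨ +-mono-≤ (≤-trans (≤ᵇ-false (trans (sym (matches-room {U} {j} {i} b)) n)) w≤t) (small-rooms {U} {j} b w≤t ns) ⟩
    t + n′ * t            ∎
    where
    open ≤-Reasoning
    R  = ∑ rs roomOf
    n′ = ∑ rs isRoom

  -- Only totals are compared. With a single room, as on one machine, that amounts to a genuine
  -- packing.
  record Fits (U : ℕ) (js : List Job) (rs : List Resource) : Set where
    constructor fitting
    field
      slots-suffice : ∀ c → ∑ js (classOf U c) ≤ ∑ rs (slotOf c)
      rooms-suffice : ∑ js (smallOf U) ≤ ∑ rs roomOf

  open Fits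

  Ascending : List Job → Set
  Ascending = AllPairs (λ i j → w i ≤ w j)

  -- Finds in a hypothetical set of jobs one that can be traded for the job which the greedy rule
  -- places.
  remove-one : {A : Set} {P : A → Set} → (∀ x → Dec (P x)) → {xs ys : List A} → xs ⊆ ys →
               All (¬_ ∘ P) xs ⊎ ∃[ x ] ∃[ xs′ ] P x × x ∈ ys × xs′ ⊆ ys × xs ↭ x ∷ xs′
  remove-one P? [] = inj₁ []
  remove-one P? (y ∷ʳ sub) with remove-one P? sub
  ... | inj₁ ns = inj₁ ns
  ... | inj₂ (x , xs′ , px , x∈ , sub′ , perm) = inj₂ (x , xs′ , px , there x∈ , y ∷ʳ sub′ , perm)
  remove-one P? (_∷_ {x} refl sub) with P? x
  ... | yes px = inj₂ (x , _ , px , here refl , x ∷ʳ sub , ↭-refl)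
  ... | no ¬px with remove-one P? sub
  ...   | inj₁ ns = inj₁ (¬px ∷ ns)
  ...   | inj₂ (z , xs′ , pz , z∈ , sub′ , perm) =
    inj₂ (z , x ∷ xs′ , pz , there z∈ , refl ∷ sub′ , ↭-trans (↭-prep x perm) (↭-swap x z ↭-refl))

module Greedy (E : ℕ) where

  open Rounding E
  open Fits

  -- `zs` is a competing choice of jobs still to be placed, and `zs′` is what remains of it after
  -- the step. Jobs already placed plus jobs still placeable must not become fewer.
  Exchanged : ℕ → List Job → List Job → Stage → Stage → Set
  Exchanged U ys zs s s′ =
    ∃[ zs′ ] zs′ ⊆ ys × Fits U zs′ (proj₂ s′) ×
             length zs + length (proj₁ s) ≤ length zs′ + length (proj₁ s′)

  classOf-big : ∀ {U y} c → big U y ≡ true → classOf U c y ≡ slotOf c (0 , true , cls U y)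
  classOf-big c b rewrite b = refl

  smallOf-big : ∀ {U y} → big U y ≡ true → smallOf U y ≡ 0
  smallOf-big b rewrite b = refl

  smallOf-small : ∀ {U y} → big U y ≡ false → smallOf U y ≡ w y
  smallOf-small b rewrite b = refl

  slotOf-same : ∀ c i → slotOf c (i , true , c) ≡ 1
  slotOf-same c i rewrite ≡ᵇ-refl c = refl

  unplaceable : ∀ {U y zs rs} → All (λ r → matches U y r ≡ false) rs → ∑ rs isRoom ≡ 1 →
                ¬ Fits U (y ∷ zs) rs
  unplaceable {U} {y} {zs} {rs} ns oneRoom (fitting slots≤ rooms≤) = go (big U y) refl
    where
    open ≤-Reasoning
    go : ∀ b → big U y ≡ b → ⊥
    go true b = <-irrefl refl (begin-strict
      0                                   <⟨ s≤s z≤n ⟩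
      1                                   ≡⟨ slotOf-same (cls U y) 0 ⟨
      slotOf (cls U y) (0 , true , cls U y) ≡⟨ classOf-big {U} {y} (cls U y) b ⟨
      classOf U (cls U y) y               ≤⟨ m≤m+n _ _ ⟩
      ∑ (y ∷ zs) (classOf U (cls U y))    ≤⟨ slots≤ (cls U y) ⟩
      ∑ rs (slotOf (cls U y))             ≡⟨ no-slots {U} {y} b ns ⟩
      0                                   ∎)
    go false b = <-irrefl refl (begin-strict
      ∑ rs roomOf                    <⟨ n<1+n _ ⟩
      suc (∑ rs roomOf)              ≡⟨ +-comm 1 _ ⟩
      ∑ rs roomOf + 1                ≡⟨ cong (∑ rs roomOf +_) oneRoom ⟨
      ∑ rs roomOf + ∑ rs isRoom      ≤⟨ small-rooms {U} {y} b ≤-refl ns ⟩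
      ∑ rs isRoom * w y              ≡⟨ cong (_* w y) oneRoom ⟩
      1 * w y                        ≡⟨ *-identityˡ (w y) ⟩
      w y                            ≡⟨ smallOf-small {U} {y} b ⟨
      smallOf U y                    ≤⟨ m≤m+n _ _ ⟩
      ∑ (y ∷ zs) (smallOf U)         ≤⟨ rooms≤ ⟩
      ∑ rs roomOf                    ∎)

  exchange-slot : ∀ {U y z zs zs′ rs rest i} → big U y ≡ true → big U z ≡ true → cls U z ≡ cls U y →
                  rs ↭ (i , true , cls U y) ∷ rest → zs ↭ z ∷ zs′ → Fits U zs rs → Fits U zs′ rest
  exchange-slot {U} {y} {z} {zs} {zs′} {rs} {rest} {i} by bz eq p q (fitting slots≤ rooms≤) =
    fitting (λ c → +-cancelˡ-≤ (classOf U c z) _ _ (begin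
      classOf U c z + ∑ zs′ (classOf U c)   ≡⟨ ∑-↭ (classOf U c) q ⟨
      ∑ zs (classOf U c)                    ≤⟨ slots≤ c ⟩
      ∑ rs (slotOf c)                       ≡⟨ ∑-↭ (slotOf c) p ⟩
      slotOf c (i , true , cls U y) + ∑ rest (slotOf c)
        ≡⟨ cong (λ k → slotOf c (i , true , k) + ∑ rest (slotOf c)) eq ⟨
      slotOf c (0 , true , cls U z) + ∑ rest (slotOf c)
        ≡⟨ cong (_+ ∑ rest (slotOf c)) (classOf-big {U} {z} c bz) ⟨
      classOf U c z + ∑ rest (slotOf c)     ∎))
    (begin
      ∑ zs′ (smallOf U)                     ≤⟨ m≤n+m _ (smallOf U z) ⟩
      smallOf U z + ∑ zs′ (smallOf U)       ≡⟨ ∑-↭ (smallOf U) q ⟨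
      ∑ zs (smallOf U)                      ≤⟨ rooms≤ ⟩
      ∑ rs roomOf                           ≡⟨ ∑-↭ roomOf p ⟩
      ∑ rest roomOf                         ∎)
    where open ≤-Reasoning

  exchange-room : ∀ {U y z zs zs′ rs rest i v} → big U z ≡ false → w y ≤ w z → w y ≤ v →
                  rs ↭ (i , false , v) ∷ rest → zs ↭ z ∷ zs′ → Fits U zs rs →
                  Fits U zs′ ((i , false , v ∸ w y) ∷ rest)
  exchange-room {U} {y} {z} {zs} {zs′} {rs} {rest} {i} {v} bz y≤z y≤v p q (fitting slots≤ rooms≤) =
    fitting (λ c → begin
      ∑ zs′ (classOf U c)                   ≤⟨ m≤n+m _ (classOf U c z) ⟩
      classOf U c z + ∑ zs′ (classOf U c)   ≡⟨ ∑-↭ (classOf U c) q ⟨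
      ∑ zs (classOf U c)                    ≤⟨ slots≤ c ⟩
      ∑ rs (slotOf c)                       ≡⟨ ∑-↭ (slotOf c) p ⟩
      ∑ rest (slotOf c)                     ∎)
    (+-cancelˡ-≤ (w y) _ _ (begin
      w y + ∑ zs′ (smallOf U)               ≤⟨ +-monoˡ-≤ _ y≤z ⟩
      w z + ∑ zs′ (smallOf U)               ≡⟨ cong (_+ ∑ zs′ (smallOf U)) (smallOf-small {U} {z} bz) ⟨
      smallOf U z + ∑ zs′ (smallOf U)       ≡⟨ ∑-↭ (smallOf U) q ⟨
      ∑ zs (smallOf U)                      ≤⟨ rooms≤ ⟩
      ∑ rs roomOf                           ≡⟨ ∑-↭ roomOf p ⟩
      v + ∑ rest roomOf                     ≡⟨ cong (_+ ∑ rest roomOf) (m+[n∸m]≡n y≤v) ⟨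
      w y + (v ∸ w y) + ∑ rest roomOf       ≡⟨ +-assoc (w y) _ _ ⟩
      w y + (v ∸ w y + ∑ rest roomOf)       ∎))
    where open ≤-Reasoning

  length-drop : ∀ {A : Set} {z : A} {zs zs′ : List A} n → zs ↭ z ∷ zs′ → length zs + n ≤ length zs′ + suc n
  length-drop {zs′ = zs′} n q =
    ≤-reflexive (trans (cong (_+ n) (↭-length q)) (sym (+-suc (length zs′) n)))

  -- The placed job `y` displaces one member of `zs` that competes for the same kind of resource:
  -- `y` itself, or else a job of the same class, respectively a small job. A displaced small job is
  -- at least as long as `y`, because jobs come in ascending order. If there is no competitor, `zs`
  -- makes no claim on that resource.
  exchange : ∀ {U y ys zs s s′} → Step U y s s′ → All (λ z → w y ≤ w z) ys → zs ⊆ y ∷ ys →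
             ∑ (proj₂ s) isRoom ≡ 1 → Fits U zs (proj₂ s) → Exchanged U ys zs s s′
  exchange (skip ns) _ (y ∷ʳ sub) _ fits = _ , sub , fits , ≤-refl
  exchange {U} {y} (skip ns) _ (refl ∷ sub) oneRoom fits = contradiction fits (unplaceable {U} {y} ns oneRoom)
  exchange {U} {y} (slot {as} b p) _ (_∷_ {xs = zs} refl sub) _ fits =
    _ , sub , exchange-slot {U} {y} {y} b b refl p ↭-refl fits , length-drop {z = y} {zs′ = zs} (length as) ↭-refl
  exchange {U} {y} (slot {as} {rs} {i} {rest} b p) _ (_∷ʳ_ {zs} y sub) _ fits
    with remove-one (λ z → (big U z Bool.≟ true) ×-dec (cls U z ≟ cls U y)) sub
  ... | inj₂ (z , zs′ , (bz , eq) , _ , sub′ , q) =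
    zs′ , sub′ , exchange-slot {U} {y} {z} b bz eq p q fits , length-drop {zs′ = zs′} (length as) q
  ... | inj₁ ns = zs , sub , fitting (λ c → slots c (cls U y ≟ c)) (≤-trans (rooms-suffice fits) (≤-reflexive (∑-↭ roomOf p)))
                , +-monoʳ-≤ (length zs) (n≤1+n _)
    where
    absent : ∀ {z} → z ∈ zs → classOf U (cls U y) z ≡ 0
    absent {z} z∈ with big U z in bz
    ... | false = refl
    ... | true rewrite ≢⇒≡ᵇ-false {cls U z} {cls U y} (λ eq → All.lookup ns z∈ (bz , eq)) = refl
    slots : ∀ c → Dec (cls U y ≡ c) → ∑ zs (classOf U c) ≤ ∑ rest (slotOf c)
    slots c (yes refl) = ≤-trans (≤-reflexive (∑-zero zs absent)) z≤n
    slots c (no y≢c) = ≤-trans (slots-suffice fits c) (≤-reflexive (trans (∑-↭ (slotOf c) p)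
      (cong (λ x → (if x then 1 else 0) + ∑ rest (slotOf c)) (≢⇒≡ᵇ-false y≢c))))
  exchange {U} {y} (room {as} b y≤v p) _ (_∷_ {xs = zs} refl sub) _ fits =
    _ , sub , exchange-room {U} {y} {y} b ≤-refl y≤v p ↭-refl fits , length-drop {z = y} {zs′ = zs} (length as) ↭-refl
  exchange {U} {y} (room {as} {rs} {i} {v} {rest} b y≤v p) y≤ (_∷ʳ_ {zs} y sub) _ fits
    with remove-one (λ z → big U z Bool.≟ false) sub
  ... | inj₂ (z , zs′ , bz , z∈ , sub′ , q) =
    zs′ , sub′ , exchange-room {U} {y} {z} bz (All.lookup y≤ z∈) y≤v p q fits , length-drop {zs′ = zs′} (length as) q
  ... | inj₁ ns = zs , sub
    , fitting (λ c → ≤-trans (slots-suffice fits c) (≤-reflexive (∑-↭ (slotOf c) p)))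
        (≤-trans (≤-reflexive (∑-zero zs (λ {z} z∈ → smallOf-big {U} {z} (¬-not (All.lookup ns z∈))))) z≤n)
    , +-monoʳ-≤ (length zs) (n≤1+n _)

  greedy-foldl : ∀ U ys {zs} s → Ascending ys → zs ⊆ ys → ∑ (proj₂ s) isRoom ≡ 1 →
                 Fits U zs (proj₂ s) →
                 length zs + length (proj₁ s) ≤ length (proj₁ (foldl (flip (place₁ U)) s ys))
  greedy-foldl U []       s _          []  _       _    = ≤-refl
  greedy-foldl U (y ∷ ys) s (y≤ ∷ asc) sub oneRoom fits
    with exchange (place₁-step U y s) y≤ sub oneRoom fits
  ... | zs′ , sub′ , fits′ , len = ≤-trans len
    (greedy-foldl U ys (place₁ U y s) asc sub′ (trans (step-isRoom U (place₁-step U y s)) oneRoom) fits′)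

  reverse-pairs : ∀ {A : Set} {R : A → A → Set} {xs} → AllPairs (flip R) xs → AllPairs R (reverse xs)
  reverse-pairs [] = []
  reverse-pairs {R = R} {x ∷ xs} (px ∷ pxs) = subst (AllPairs R) (sym (unfold-reverse x xs))
    (AllPairs-++⁺ (reverse-pairs pxs) ([] ∷ []) (All.map (_∷ []) (All-resp-↭ (↭-sym (↭-reverse xs)) px)))

  Descending : List Job → Set
  Descending = AllPairs (λ i j → w j ≤ w i)

  -- `place` is a right fold and so begins at the end of `js`, with the shortest job. The exchange
  -- argument follows the order of placement, hence the passage to a left fold over the reversed
  -- list.
  greedy : ∀ U js {zs} rs → Descending js → zs ⊆ js → ∑ rs isRoom ≡ 1 → Fits U zs rs →
           length zs ≤ length (proj₁ (place U rs js))
  greedy U js {zs} rs desc sub oneRoom (fitting slots≤ rooms≤) = begin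
    length zs                    ≡⟨ length-reverse zs ⟨
    length (reverse zs)          ≡⟨ +-identityʳ _ ⟨
    length (reverse zs) + 0      ≤⟨ greedy-foldl U (reverse js) ([] , rs) (reverse-pairs desc)
                                      (⊆-reverse⁺ sub) oneRoom
                                      (fitting (λ c → ≤-trans (≤-reflexive (∑-↭ _ (↭-reverse zs))) (slots≤ c))
                                        (≤-trans (≤-reflexive (∑-↭ _ (↭-reverse zs))) rooms≤)) ⟩
    length (proj₁ (foldl (flip (place₁ U)) ([] , rs) (reverse js)))
      ≡⟨ cong (length ∘ proj₁) (reverse-foldl (flip (place₁ U)) ([] , rs) js) ⟩
    length (proj₁ (place U rs js)) ∎
    where open ≤-Reasoning

-- Boolean search and permutations of duplicate-free lists

∈-filterᵇ⁺ : {A : Set} {p : A → Bool} {x : A} {xs : List A} → x ∈ xs → p x ≡ true → x ∈ filterᵇ p xs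
∈-filterᵇ⁺ {p = p} x∈ px = ∈-filter⁺ (T? ∘ p) x∈ (subst T (sym px) _)

∈-filterᵇ⁻ : {A : Set} {p : A → Bool} {x : A} (xs : List A) → x ∈ filterᵇ p xs → x ∈ xs × p x ≡ true
∈-filterᵇ⁻ {p = p} xs x∈ with ∈-filter⁻ (T? ∘ p) {xs = xs} x∈
... | x∈xs , t = x∈xs , T⇒≡ t
  where
  T⇒≡ : ∀ {b} → T b → b ≡ true
  T⇒≡ {true} _ = refl

any⁺ : {A : Set} {p : A → Bool} {x : A} {xs : List A} → x ∈ xs → p x ≡ true → any p xs ≡ true
any⁺ (here refl) px rewrite px = refl
any⁺ {p = p} {xs = y ∷ _} (there x∈) px with p y
... | true  = refl
... | false = any⁺ {p = p} x∈ px

any⁻ : {A : Set} {p : A → Bool} (xs : List A) → any p xs ≡ true → ∃[ x ] x ∈ xs × p x ≡ true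
any⁻ {p = p} (x ∷ xs) eq with p x in px
... | true  = x , here refl , px
... | false with any⁻ {p = p} xs eq
...   | y , y∈ , py = y , there y∈ , py

eqJob-true : ∀ {i j} → eqJob i j ≡ true → i ≡ j
eqJob-true {a , b} {c , d} eq with a ≡ᵇ c in ac
... | true = cong₂ _,_ (≡ᵇ-true a c ac) (≡ᵇ-true b d eq)

eqJob-refl : ∀ j → eqJob j j ≡ true
eqJob-refl (a , b) rewrite ≡ᵇ-refl a = ≡ᵇ-refl b

Unique-resp-↭ : {A : Set} {xs ys : List A} → xs ↭ ys → Unique xs → Unique ys
Unique-resp-↭ {A} p = SetoidPermutation.Unique-resp-↭ (setoid A) (↭⇒↭ₛ p)

unique-↭ : {A : Set} {xs ys : List A} → Unique xs → Unique ys →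
           (∀ {z} → z ∈ xs → z ∈ ys) → (∀ {z} → z ∈ ys → z ∈ xs) → xs ↭ ys
unique-↭ {xs = []}     {[]}     _ _ _  _  = ↭-refl
unique-↭ {xs = []}     {y ∷ ys} _ _ _  to = contradiction (to (here refl)) λ ()
unique-↭ {xs = x ∷ xs} (x≢ ∷ u) u′ to from with ∈-∃++ (to (here refl))
... | ps , qs , refl with Unique-resp-↭ (shift x ps qs) u′
...   | x≢′ ∷ u″ = ↭-trans (↭-prep x (unique-↭ u u″ to′ from′)) (↭-sym (shift x ps qs))
  where
  to′ : ∀ {z} → z ∈ xs → z ∈ ps ++ qs
  to′ z∈ with ∈-resp-↭ (shift x ps qs) (to (there z∈))
  ... | here refl = contradiction refl (All.lookup x≢ z∈)
  ... | there z∈′ = z∈′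
  from′ : ∀ {z} → z ∈ ps ++ qs → z ∈ xs
  from′ z∈ with from (∈-resp-↭ (↭-sym (shift x ps qs)) (there z∈))
  ... | here refl = contradiction refl (All.lookup x≢′ z∈)
  ... | there z∈′ = z∈′

-- A key encodes the multiplicities of c, ..., c + d - 1 in a list as digits in
-- base W.

key : ℕ → ℕ → ℕ → List ℕ → ℕ
key W zero    c xs = 0
key W (suc d) c xs = count c xs + W * key W d (suc c) xs

-- The numbers with `d` digits from `ds`. There are polynomially many of them, since `d` will be the
-- constant `suc N`.
keysOf : ℕ → List ℕ → ℕ → List ℕ
keysOf W ds zero    = 0 ∷ []
keysOf W ds (suc d) = concatMap (λ k → map (λ a → a + W * k) ds) (keysOf W ds d)

key-cong : ∀ W d c {xs ys} → (∀ k → count k xs ≡ count k ys) → key W d c xs ≡ key W d c ys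
key-cong W zero    c eq = refl
key-cong W (suc d) c eq = cong₂ (λ m n → m + W * n) (eq c) (key-cong W d (suc c) eq)

key-[] : ∀ W d c → key W d c [] ≡ 0
key-[] W zero    c = refl
key-[] W (suc d) c = trans (cong (W *_) (key-[] W d (suc c))) (*-zeroʳ W)

-- Linearity holds even when digits overflow, so the keys of states may simply be added. Only
-- injectivity needs multiplicities below `W`.
key-++ : ∀ W d c xs ys → key W d c (xs ++ ys) ≡ key W d c xs + key W d c ys
key-++ W zero    c xs ys = refl
key-++ W (suc d) c xs ys = begin
  count c (xs ++ ys) + W * key W d (suc c) (xs ++ ys)
    ≡⟨ cong₂ (λ m n → m + W * n) (∑-++ xs ys _) (key-++ W d (suc c) xs ys) ⟩
  count c xs + count c ys + W * (k xs + k ys)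
    ≡⟨ cong (count c xs + count c ys +_) (*-distribˡ-+ W (k xs) (k ys)) ⟩
  count c xs + count c ys + (W * k xs + W * k ys)
    ≡⟨ +-interchange (count c xs) (count c ys) (W * k xs) (W * k ys) ⟩
  count c xs + W * k xs + (count c ys + W * k ys) ∎
  where
  open ≡-Reasoning
  k = key W d (suc c)

digit-injective : ∀ {W a b} m n → a < W → b < W → a + W * m ≡ b + W * n → a ≡ b × m ≡ n
digit-injective {W@(suc _)} {a} {b} m n a<W b<W eq = a≡b , *-cancelˡ-≡ m n W (+-cancelˡ-≡ a _ _ (trans eq (cong (_+ W * n) (sym a≡b))))
  where
  digit : ∀ {c} k → c < W → (c + W * k) % W ≡ c
  digit {c} k c<W = trans (cong (λ x → (c + x) % W) (*-comm W k)) (trans ([m+kn]%n≡m%n c k W) (m<n⇒m%n≡m c<W))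
  a≡b : a ≡ b
  a≡b = trans (sym (digit m a<W)) (trans (cong (_% W) eq) (digit n b<W))

key-injective : ∀ W d c {xs ys} → (∀ k → count k xs < W) → (∀ k → count k ys < W) →
                key W d c xs ≡ key W d c ys → ∀ k → c ≤ k → k < c + d → count k xs ≡ count k ys
key-injective W zero    c xs< ys< eq k c≤k k< =
  contradiction (≤-<-trans c≤k (<-≤-trans k< (≤-reflexive (+-identityʳ c)))) (<-irrefl refl)
key-injective W (suc d) c {xs} {ys} xs< ys< eq k c≤k k<
  with digit-injective (key W d (suc c) xs) (key W d (suc c) ys) (xs< c) (ys< c) eq
... | here≡ , rest≡ with m≤n⇒m<n∨m≡n c≤k
...   | inj₁ c<k  = key-injective W d (suc c) xs< ys< rest≡ k c<k (<-≤-trans k< (≤-reflexive (+-suc c d)))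
...   | inj₂ refl = here≡

key∈keysOf : ∀ W ds → (∀ {a} → a < W → a ∈ ds) → ∀ d c {xs} → (∀ k → count k xs < W) →
             key W d c xs ∈ keysOf W ds d
key∈keysOf W ds ds∋ zero    c xs< = here refl
key∈keysOf W ds ds∋ (suc d) c {xs} xs< =
  ∈-concatMap⁺ (λ k → map (λ a → a + W * k) ds)
    (lose (key∈keysOf W ds ds∋ d (suc c) xs<)
          (∈-map⁺ (λ a → a + W * key W d (suc c) xs) (ds∋ (xs< c))))

-- Selecting one option per machine

State : Set
State = ℕ × Stage

value : State → ℕ
value s = length (proj₁ (proj₂ s))

combine : State → State → State
combine s o = proj₁ s + proj₁ o ,
              proj₁ (proj₂ s) ++ proj₁ (proj₂ o) , proj₂ (proj₂ s) ++ proj₂ (proj₂ o)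

better : ℕ → State → List State → List State
better k s acc =
  if proj₁ s ≡ᵇ k
  then unconsᴸ acc (s ∷ []) (λ t _ → if value s ≤ᵇ value t then acc else s ∷ [])
  else acc

best : ℕ → List State → List State
best k = foldr (better k) []

-- With one state per key, the number of states stays below the number of keys instead of growing
-- exponentially with the machines.
prune : List ℕ → List State → List State
prune ks ss = concatMap (λ k → best k ss) ks

empty : State
empty = 0 , [] , []

select : List ℕ → List (List State) → List State
select ks = foldr (λ os ss → prune ks (concatMap (λ s → map (combine s) os) ss)) (empty ∷ [])

data Best (k : ℕ) (ss : List State) : List State → Set where
  none : (∀ {s} → s ∈ ss → proj₁ s ≢ k) → Best k ss []
  some : ∀ {t} → t ∈ ss → proj₁ t ≡ k → (∀ {s} → s ∈ ss → proj₁ s ≡ k → value s ≤ value t) →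
         Best k ss (t ∷ [])

best-best : ∀ k ss → Best k ss (best k ss)
best-best k []       = none λ ()
best-best k (s ∷ ss) with best k ss | best-best k ss | proj₁ s ≡ᵇ k in sk
... | _ | none ∄ | true = some (here refl) (≡ᵇ-true _ k sk) λ
  { (here refl) _ → ≤-refl ; (there x∈) xk → contradiction xk (∄ x∈) }
... | _ | none ∄ | false = none λ
  { (here refl) refl → case trans (sym sk) (≡ᵇ-refl k) of λ () ; (there x∈) → ∄ x∈ }
... | _ | some t∈ tk max | false = some (there t∈) tk λ
  { (here refl) refl → case trans (sym sk) (≡ᵇ-refl k) of λ () ; (there x∈) → max x∈ }
... | _ | some {t} t∈ tk max | true with value s ≤ᵇ value t in le
...   | true  = some (there t∈) tk λ { (here refl) _ → ≤ᵇ-true le ; (there x∈) → max x∈ }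
...   | false = some (here refl) (≡ᵇ-true _ k sk) λ
  { (here refl) _ → ≤-refl ; (there x∈) xk → ≤-trans (max x∈ xk) (<⇒≤ (≤ᵇ-false le)) }

best⊆ : ∀ k ss {s} → s ∈ best k ss → s ∈ ss × proj₁ s ≡ k
best⊆ k ss s∈ with best k ss | best-best k ss
best⊆ k ss (here refl) | _ | some t∈ tk _ = t∈ , tk

prune⊆ : ∀ ks ss {s} → s ∈ prune ks ss → s ∈ ss
prune⊆ ks ss s∈ with find (∈-concatMap⁻ (λ k → best k ss) {xs = ks} s∈)
... | k , _ , s∈best = proj₁ (best⊆ k ss s∈best)

prune-best : ∀ ks ss {s} → s ∈ ss → proj₁ s ∈ ks →
             ∃[ t ] t ∈ prune ks ss × proj₁ t ≡ proj₁ s × value s ≤ value t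
prune-best ks ss {s} s∈ k∈ with best (proj₁ s) ss in eq | best-best (proj₁ s) ss
... | _ | none ∄ = contradiction refl (∄ s∈)
... | _ | some {t} t∈ tk max = t
  , ∈-concatMap⁺ (λ k → best k ss) (lose k∈ (subst (t ∈_) (sym eq) (here refl)))
  , tk , max s∈ refl

select-sound : {A : Set} (P : List A → State → Set) (Q : A → State → Set) (os : A → List State) →
               P [] empty → (∀ {a s} → s ∈ os a → Q a s) →
               (∀ {a as s o} → Unique (a ∷ as) → P as s → Q a o → P (a ∷ as) (combine s o)) →
               ∀ ks as → Unique as → ∀ {s} → s ∈ select ks (map os as) → P as s
select-sound P Q os p[] qos step ks []       u       (here refl) = p[]
select-sound P Q os p[] qos step ks (a ∷ as) u@(_ ∷ u′) s∈
  with find (∈-concatMap⁻ (λ s → map (combine s) (os a)) {xs = select ks (map os as)}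
           (prune⊆ ks (concatMap (λ s → map (combine s) (os a)) (select ks (map os as))) s∈))
... | s , s∈′ , s∈map with ∈-map⁻ (combine s) s∈map
...   | o , o∈ , refl = step u (select-sound P Q os p[] qos step ks as u′ s∈′) (qos o∈)

-- The principle of optimality: states with equal keys admit the same extensions, so exchanging a
-- partial selection for a better one with the same key does no harm. The condition on `ks` ranges
-- over all sufficiently short lists `bs`, so that it passes to the tail in the induction.
select-complete : {A : Set} (os : A → List State) (pick : A → State) → (∀ a → pick a ∈ os a) →
                  ∀ ks as → (∀ bs → length bs ≤ length as → ∑ bs (proj₁ ∘ pick) ∈ ks) →
                  ∃[ s ] s ∈ select ks (map os as) × proj₁ s ≡ ∑ as (proj₁ ∘ pick) ×
                         ∑ as (value ∘ pick) ≤ value s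
select-complete os pick pick∈ ks []       ks∋ = empty , here refl , refl , z≤n
select-complete os pick pick∈ ks (a ∷ as) ks∋
  with select-complete os pick pick∈ ks as (λ bs len → ks∋ bs (m≤n⇒m≤1+n len))
... | s , s∈ , key≡ , val≤
  with prune-best ks (concatMap (λ s → map (combine s) (os a)) (select ks (map os as)))
         {combine s (pick a)}
         (∈-concatMap⁺ (λ s → map (combine s) (os a)) (lose s∈ (∈-map⁺ (combine s) (pick∈ a))))
         (subst (_∈ ks) (sym combined≡) (ks∋ (a ∷ as) ≤-refl))
  where
  combined≡ : proj₁ s + proj₁ (pick a) ≡ ∑ (a ∷ as) (proj₁ ∘ pick)
  combined≡ = trans (+-comm (proj₁ s) _) (cong (proj₁ (pick a) +_) key≡)
... | t , t∈ , tk , max = t , t∈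
  , trans tk (trans (+-comm (proj₁ s) _) (cong (proj₁ (pick a) +_) key≡))
  , (begin
      value (pick a) + ∑ as (value ∘ pick)  ≤⟨ +-monoʳ-≤ (value (pick a)) val≤ ⟩
      value (pick a) + value s              ≡⟨ +-comm (value (pick a)) _ ⟩
      value s + value (pick a)              ≡⟨ length-++ (proj₁ (proj₂ s)) ⟨
      value (combine s (pick a))            ≤⟨ max ⟩
      value t                               ∎)
  where open ≤-Reasoning

-- Configurations, options and the completion of a selection

module Scheme (E : ℕ) where

  open Rounding E
  open Greedy E

  lists : ℕ → List (List ℕ)
  lists zero    = [] ∷ []
  lists (suc n) = [] ∷ concatMap (λ c → map (c ∷_) (lists n)) (upTo (suc N))

  -- Depends on `E` only and thus enters the program as a constant. A multiset of classes occurs in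
  -- every order, so that the classes of the jobs on a machine form a member without being sorted.
  configs : List (List ℕ)
  configs = filterᵇ (λ x → sum x ≤ᵇ N) (lists E)

  ∈-lists⁺ : ∀ n x → length x ≤ n → (∀ {c} → c ∈ x → c ≤ N) → x ∈ lists n
  ∈-lists⁺ zero    []      _         _  = here refl
  ∈-lists⁺ (suc n) []      _         _  = here refl
  ∈-lists⁺ (suc n) (c ∷ x) (s≤s len) c≤ = there (∈-concatMap⁺ (λ c → map (c ∷_) (lists n))
    (lose (∈-upTo⁺ (s≤s (c≤ (here refl)))) (∈-map⁺ (c ∷_) (∈-lists⁺ n x len (c≤ ∘ there)))))

  ∈-lists⁻ : ∀ n x → x ∈ lists n → length x ≤ n × (∀ {c} → c ∈ x → c ≤ N)
  ∈-lists⁻ zero    .[] (here refl) = z≤n , λ ()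
  ∈-lists⁻ (suc n) .[] (here refl) = z≤n , λ ()
  ∈-lists⁻ (suc n) x   (there x∈)
    with find (∈-concatMap⁻ (λ c → map (c ∷_) (lists n)) {xs = upTo (suc N)} x∈)
  ... | c , c∈ , x∈map with ∈-map⁻ (c ∷_) x∈map
  ...   | y , y∈ , refl with ∈-lists⁻ n y y∈
  ...     | len , y≤ = s≤s len , λ { (here refl) → s≤s⁻¹ (∈-upTo⁻ c∈) ; (there d∈) → y≤ d∈ }

  ∈-configs⁺ : ∀ {x} → length x ≤ E → (∀ {c} → c ∈ x → c ≤ N) → sum x ≤ N → x ∈ configs
  ∈-configs⁺ {x} len x≤ sum≤ = ∈-filterᵇ⁺ (∈-lists⁺ E x len x≤) (≤⇒≤ᵇ-true sum≤)

  ∈-configs⁻ : ∀ {x} → x ∈ configs → length x ≤ E × (∀ {c} → c ∈ x → c ≤ N) × sum x ≤ N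
  ∈-configs⁻ {x} x∈ with ∈-filterᵇ⁻ (lists E) x∈
  ... | x∈lists , sum≤ with ∈-lists⁻ E x x∈lists
  ...   | len , x≤ = len , x≤ , ≤ᵇ-true sum≤

  resources : ℕ → Machine → List ℕ → List Resource
  resources U i x = (i , false , N * U ∸ U * sum x) ∷ map (λ c → i , true , c) x

  -- Only jobs that prefer `i` are offered to the greedy rule, so `value` counts jobs that stay.
  option : ℕ → ℕ → (Machine → Job → Bool) → List Job → Machine → List ℕ → State
  option W U pref js i x = key W (suc N) 0 x , place U (resources U i x) (filterᵇ (pref i) js)

  options : ℕ → ℕ → (Machine → Job → Bool) → List Job → Machine → List State
  options W U pref js i = map (option W U pref js i) configs

  -- No small job is longer than `E * U`. Filling the enlarged room exceeds the original one by at
  -- most that much, and as long as the original rooms suffice in total, some enlarged room accepts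
  -- the next small job.
  inflate : ℕ → Resource → Resource
  inflate U r = proj₁ r , proj₁ (proj₂ r) ,
    (if proj₁ (proj₂ r) then proj₂ (proj₂ r) else proj₂ (proj₂ r) + E * U)

  leftover : Placed → List Job → List Job
  leftover as = filterᵇ (λ j → not (any (λ e → eqJob (proj₁ e) j) as))

  -- Reaching exactly this key excludes both missing slots and spare ones; a spare slot would
  -- withhold room that the small jobs need.
  target : ℕ → ℕ → List Job → ℕ
  target W U js = key W (suc N) 0 (map (cls U) (filterᵇ (big U) js))

  complete : ℕ → List Job → State → Placed
  complete U js s =
    proj₁ (place U (map (inflate U) (proj₂ (proj₂ s))) (leftover (proj₁ (proj₂ s)) js)) ++
    proj₁ (proj₂ s)

  -- The default `empty` occurs for guesses that admit no selection with the target key.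
  selected : ℕ → ℕ → List ℕ → (Machine → Job → Bool) → List Machine → List Job → State
  selected W U ks pref ms js =
    unconsᴸ (best (target W U js) (select ks (map (options W U pref js) ms))) empty (λ s _ → s)

  levels-≤ : ∀ n U x → ∑ (levels n) (λ k → if k * U ≤ᵇ x then 1 else 0) ≤ n
  levels-≤ zero    U x = z≤n
  levels-≤ (suc n) U x with suc n * U ≤ᵇ x
  ... | true  = s≤s (levels-≤ n U x)
  ... | false = m≤n⇒m≤1+n (levels-≤ n U x)

  levels-lower : ∀ n U x → ∑ (levels n) (λ k → if k * U ≤ᵇ x then 1 else 0) * U ≤ x
  levels-lower zero    U x = z≤n
  levels-lower (suc n) U x with suc n * U ≤ᵇ x in le
  ... | true  = ≤-trans (*-monoˡ-≤ U (s≤s (levels-≤ n U x))) (≤ᵇ-true le)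
  ... | false = levels-lower n U x

  levels-reach : ∀ n U x m → m ≤ n → m * U ≤ x →
                 m ≤ ∑ (levels n) (λ k → if k * U ≤ᵇ x then 1 else 0)
  levels-reach zero    U x m m≤n m≤x = m≤n
  levels-reach (suc n) U x m m≤n m≤x with suc n * U ≤ᵇ x in le | m≤n⇒m<n∨m≡n m≤n
  ... | true  | inj₁ m<n  = m≤n⇒m≤1+n (levels-reach n U x m (s≤s⁻¹ m<n) m≤x)
  ... | false | inj₁ m<n  = levels-reach n U x m (s≤s⁻¹ m<n) m≤x
  ... | true  | inj₂ refl = s≤s (levels-reach n U x n ≤-refl (≤-trans (m≤n+m (n * U) U) m≤x))
  ... | false | inj₂ refl = contradiction (≤-<-trans m≤x (≤ᵇ-false le)) (<-irrefl refl)

  levels-upper : ∀ n U x → x ≤ suc n * U →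
                 x ≤ suc (∑ (levels n) (λ k → if k * U ≤ᵇ x then 1 else 0)) * U
  levels-upper zero    U x x≤ = x≤
  levels-upper (suc n) U x x≤ with suc n * U ≤ᵇ x in le
  ... | true  = ≤-trans x≤ (*-monoˡ-≤ U (s≤s (s≤s
                  (levels-reach n U x n ≤-refl (≤-trans (m≤n+m (n * U) U) (≤ᵇ-true le))))))
  ... | false = levels-upper n U x (<⇒≤ (≤ᵇ-false le))

  cls≤N : ∀ U j → cls U j ≤ N
  cls≤N U j = levels-≤ N U (w j)

  U*cls≤w : ∀ U j → U * cls U j ≤ w j
  U*cls≤w U j = ≤-trans (≤-reflexive (*-comm U (cls U j))) (levels-lower N U (w j))

  -- The cap of `cls` at `N` does no harm, as the job is at most `N` units long.
  w≤cls : ∀ U j → w j ≤ N * U → w j ≤ suc (cls U j) * U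
  w≤cls U j w≤ = levels-upper N U (w j) (≤-trans w≤ (m≤n+m (N * U) U))

  -- A big job exceeds `E * U`, and level `E` is counted because `E ≤ N`. This is what limits a
  -- configuration to `E` entries.
  big⇒E≤cls : ∀ U j → big U j ≡ true → E ≤ cls U j
  big⇒E≤cls U j b = levels-reach N U (w j) E (m≤m*m E) (<⇒≤ (≤ᵇ-false (not-true b)))
    where
    not-true : ∀ {x} → not x ≡ true → x ≡ false
    not-true {false} _ = refl
    m≤m*m : ∀ m → m ≤ m * m
    m≤m*m zero    = z≤n
    m≤m*m (suc m) = m≤m+n (suc m) _

  small⇒w≤ : ∀ U j → big U j ≡ false → w j ≤ E * U
  small⇒w≤ U j b = ≤ᵇ-true (not-false b)
    where
    not-false : ∀ {x} → not x ≡ false → x ≡ true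
    not-false {true} _ = refl

  slotOf-inflate : ∀ U c r → slotOf c (inflate U r) ≡ slotOf c r
  slotOf-inflate U c (i , true  , v) = refl
  slotOf-inflate U c (i , false , v) = refl

  isRoom-inflate : ∀ U r → isRoom (inflate U r) ≡ isRoom r
  isRoom-inflate U (i , true  , v) = refl
  isRoom-inflate U (i , false , v) = refl

  roomOf-inflate : ∀ U r → roomOf (inflate U r) ≡ roomOf r + isRoom r * (E * U)
  roomOf-inflate U (i , true  , v) = refl
  roomOf-inflate U (i , false , v) = cong (v +_) (sym (*-identityˡ (E * U)))

  spaceOf-inflate : ∀ U i r → spaceOf U 0 i (inflate U r) ≡ spaceOf U (E * U) i r
  spaceOf-inflate U i (m , true  , v) = refl
  spaceOf-inflate U i (m , false , v) = cong ([ m ≡ᵇ i ]∙_) (+-identityʳ (v + E * U))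

  place-slots : ∀ U c rs js → let s = place U rs js in
                ∑ (proj₂ s) (slotOf c) + ∑ (proj₁ s) (classOf U c ∘ proj₁) ≡ ∑ rs (slotOf c)
  place-slots U c rs js = place-ind U
    {λ s → ∑ (proj₂ s) (slotOf c) + ∑ (proj₁ s) (classOf U c ∘ proj₁) ≡ ∑ rs (slotOf c)} js
    (+-identityʳ _) (λ _ st eq → trans (step-slots U c st) eq)

  place-rooms : ∀ U rs js → let s = place U rs js in
                ∑ (proj₂ s) roomOf + ∑ (proj₁ s) (smallOf U ∘ proj₁) ≡ ∑ rs roomOf
  place-rooms U rs js = place-ind U
    {λ s → ∑ (proj₂ s) roomOf + ∑ (proj₁ s) (smallOf U ∘ proj₁) ≡ ∑ rs roomOf} js
    (+-identityʳ _) (λ _ st eq → trans (step-rooms U st) eq)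

  place-isRoom : ∀ U rs js → ∑ (proj₂ (place U rs js)) isRoom ≡ ∑ rs isRoom
  place-isRoom U rs js = place-ind U {λ s → ∑ (proj₂ s) isRoom ≡ ∑ rs isRoom} js
    refl (λ _ st eq → trans (step-isRoom U st) eq)

  place-space : ∀ U h i rs js → (∀ {j} → j ∈ js → w j ≤ N * U) → let s = place U rs js in
                ∑ (proj₁ s) (loadOf i) + ∑ (proj₂ s) (spaceOf U h i) ≤ ∑ rs (spaceOf U h i)
  place-space U h i rs js w≤ = place-ind U
    {λ s → ∑ (proj₁ s) (loadOf i) + ∑ (proj₂ s) (spaceOf U h i) ≤ ∑ rs (spaceOf U h i)} js
    ≤-refl (λ {j} j∈ st le → ≤-trans (step-space U h i (λ _ → w≤cls U j (w≤ j∈)) st) le)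

  place-machines : ∀ {P : Machine → Set} U rs js → All (P ∘ proj₁) rs → OnMachines {P} (place U rs js)
  place-machines {P} U rs js ps = place-ind U {OnMachines {P}} js ([] , ps)
    (λ _ st on → step-machines U st on)

  -- The counterpart of `Fits` for several rooms, where totals do not suffice: a reserve of `E * U`
  -- per room makes up for fragmentation. `some-room` excludes the case in which that reserve is
  -- empty for lack of rooms.
  record Room (U : ℕ) (js : List Job) (rs : List Resource) : Set where
    field
      slots≥ : ∀ c → ∑ js (classOf U c) ≤ ∑ rs (slotOf c)
      rooms≥ : ∑ js (smallOf U) + ∑ rs isRoom * (E * U) ≤ ∑ rs roomOf
      some-room : ∀ {j} → j ∈ js → 1 ≤ ∑ rs isRoom

  open Room

  -- If a small job were rejected, every room would be below `E * U`, so that all of them together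
  -- would fall short of the reserve. If a big job were rejected, no slot of its class would be
  -- left, although one was provided for it.
  place-all : ∀ U rs js → Room U js rs → map proj₁ (proj₁ (place U rs js)) ≡ js
  place-all U rs []       _    = refl
  place-all U rs (j ∷ js) rm
    with place U rs js | place-all U rs js tail | place₁-step U j (place U rs js)
       | place-slots U (cls U j) rs js | place-rooms U rs js | place-isRoom U rs js
    where
    tail : Room U js rs
    tail = record
      { slots≥ = λ c → ≤-trans (m≤n+m _ (classOf U c j)) (slots≥ rm c)
      ; rooms≥ = ≤-trans (+-monoˡ-≤ _ (m≤n+m _ (smallOf U j))) (rooms≥ rm)
      ; some-room = some-room rm ∘ there
      }
  ... | as , rs′ | eq | st | slots≡ | rooms≡ | isRoom≡ = done st
    where
    open ≤-Reasoning
    done : ∀ {s′} → Step U j (as , rs′) s′ → map proj₁ (proj₁ s′) ≡ j ∷ js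
    done (slot _ _)   = cong (j ∷_) eq
    done (room _ _ _) = cong (j ∷_) eq
    done (skip ns)    = ⊥-elim (impossible (big U j) refl)
      where
      placed≡ : ∀ f → ∑ as (f ∘ proj₁) ≡ ∑ js f
      placed≡ f = trans (sym (∑-map proj₁ as f)) (cong (λ l → ∑ l f) eq)
      c = cls U j
      impossible : ∀ b → big U j ≡ b → ⊥
      impossible true b = <-irrefl refl (begin-strict
        ∑ js (classOf U c)                          <⟨ n<1+n _ ⟩
        1 + ∑ js (classOf U c)                      ≡⟨ cong (_+ ∑ js (classOf U c)) (slotOf-same c 0) ⟨
        slotOf c (0 , true , c) + ∑ js (classOf U c) ≡⟨ cong (_+ ∑ js (classOf U c)) (classOf-big {U} {j} c b) ⟨
        classOf U c j + ∑ js (classOf U c)          ≤⟨ slots≥ rm c ⟩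
        ∑ rs (slotOf c)                             ≡⟨ slots≡ ⟨
        ∑ rs′ (slotOf c) + ∑ as (classOf U c ∘ proj₁) ≡⟨ cong₂ _+_ (no-slots {U} {j} b ns) (placed≡ (classOf U c)) ⟩
        ∑ js (classOf U c)                          ∎)
      impossible false b = <-irrefl refl (begin-strict
        n * (E * U)                <⟨ m<m+n _ (some-room rm (here refl)) ⟩
        n * (E * U) + n            ≤⟨ +-monoˡ-≤ n (+-cancelˡ-≤ (∑ js (smallOf U)) _ _ enough) ⟩
        ∑ rs′ roomOf + n           ≡⟨ cong (∑ rs′ roomOf +_) isRoom≡ ⟨
        ∑ rs′ roomOf + ∑ rs′ isRoom ≤⟨ small-rooms {U} {j} b (small⇒w≤ U j b) ns ⟩
        ∑ rs′ isRoom * (E * U)     ≡⟨ cong (_* (E * U)) isRoom≡ ⟩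
        n * (E * U)                ∎)
        where
        n = ∑ rs isRoom
        enough : ∑ js (smallOf U) + n * (E * U) ≤ ∑ js (smallOf U) + ∑ rs′ roomOf
        enough = begin
          ∑ js (smallOf U) + n * (E * U)               ≤⟨ +-monoˡ-≤ _ (m≤n+m _ (smallOf U j)) ⟩
          ∑ (j ∷ js) (smallOf U) + n * (E * U)         ≤⟨ rooms≥ rm ⟩
          ∑ rs roomOf                                  ≡⟨ rooms≡ ⟨
          ∑ rs′ roomOf + ∑ as (smallOf U ∘ proj₁)      ≡⟨ cong (∑ rs′ roomOf +_) (placed≡ (smallOf U)) ⟩
          ∑ rs′ roomOf + ∑ js (smallOf U)              ≡⟨ +-comm (∑ rs′ roomOf) _ ⟩
          ∑ js (smallOf U) + ∑ rs′ roomOf              ∎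

-- Invariants of partial selections

module Selection (E U W : ℕ) (pref : Machine → Job → Bool) (js : List Job)
  (pref-functional : ∀ {i i′ j} → pref i j ≡ true → pref i′ j ≡ true → i ≡ i′)
  (js-unique : Unique js) (js-descending : Greedy.Descending E js)
  (w≤ : ∀ {j} → j ∈ js → Rounding.w E j ≤ Rounding.N E * U)
  where

  open Rounding E
  open Greedy E
  open Scheme E

  -- `slots` is a ghost component: the state itself remembers only the key of the slots opened so
  -- far.
  record Valid (ms : List Machine) (s : State) : Set where
    field
      slots      : List ℕ
      key≡       : proj₁ s ≡ key W (suc N) 0 slots
      few        : length slots ≤ length ms * E
      bounded    : ∀ {c} → c ∈ slots → c ≤ N
      slots≡     : ∀ c → ∑ (proj₂ (proj₂ s)) (slotOf c) + ∑ (proj₁ (proj₂ s)) (classOf U c ∘ proj₁)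
                         ≡ count c slots
      rooms≡     : ∑ (proj₂ (proj₂ s)) roomOf + ∑ (proj₁ (proj₂ s)) (smallOf U ∘ proj₁) + U * sum slots
                   ≡ length ms * (N * U)
      isRoom≡    : ∑ (proj₂ (proj₂ s)) isRoom ≡ length ms
      -- `N * U` is the guess itself, one `E * U` pays for at most `E` slots that hold up to `U`
      -- more than their rounded size, and the other for exceeding the room. The factor `count i ms`
      -- makes the bound additive over machines.
      space≤     : ∀ i → ∑ (proj₁ (proj₂ s)) (loadOf i) + ∑ (proj₂ (proj₂ s)) (spaceOf U (E * U) i)
                         ≤ count i ms * ((N + E + E) * U)
      placed∈    : All (λ e → proj₂ e ∈ ms × pref (proj₂ e) (proj₁ e) ≡ true × proj₁ e ∈ js) (proj₁ (proj₂ s))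
      resource∈  : All (λ r → proj₁ r ∈ ms) (proj₂ (proj₂ s))
      placed-unique : Unique (map proj₁ (proj₁ (proj₂ s)))

  open Valid

  valid-empty : Valid [] empty
  valid-empty = record
    { slots = [] ; key≡ = sym (key-[] W (suc N) 0) ; few = z≤n ; bounded = λ () ; slots≡ = λ _ → refl
    ; rooms≡ = *-zeroʳ U ; isRoom≡ = refl ; space≤ = λ _ → z≤n
    ; placed∈ = [] ; resource∈ = [] ; placed-unique = [] }

  AllPairs-resp-⊆ : {A : Set} {R : A → A → Set} {xs ys : List A} →
                    xs ⊆ ys → AllPairs R ys → AllPairs R xs
  AllPairs-resp-⊆ []           []         = []
  AllPairs-resp-⊆ (_ ∷ʳ sub)   (_ ∷ ps)   = AllPairs-resp-⊆ sub ps
  AllPairs-resp-⊆ (refl ∷ sub) (p ∷ ps)   = All-resp-⊆ sub p ∷ AllPairs-resp-⊆ sub ps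

  valid-option : ∀ {i o} → o ∈ options W U pref js i → Valid (i ∷ []) o
  valid-option {i} o∈ with ∈-map⁻ (option W U pref js i) o∈
  ... | x , x∈ , refl = record
    { slots = x ; key≡ = refl
    ; few = ≤-trans (proj₁ (∈-configs⁻ x∈)) (≤-reflexive (sym (*-identityˡ E)))
    ; bounded = proj₁ (proj₂ (∈-configs⁻ x∈))
    ; slots≡ = λ c → trans (place-slots U c rs P) (∑-map _ x (slotOf c))
    ; rooms≡ = begin
        ∑ (proj₂ s) roomOf + ∑ (proj₁ s) (smallOf U ∘ proj₁) + U * sum x
          ≡⟨ cong (_+ U * sum x) (place-rooms U rs P) ⟩
        N * U ∸ U * sum x + ∑ (map (λ c → i , true , c) x) roomOf + U * sum x
          ≡⟨ cong (λ n → N * U ∸ U * sum x + n + U * sum x)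
                  (trans (∑-map _ x roomOf) (∑-zero x (λ _ → refl))) ⟩
        N * U ∸ U * sum x + 0 + U * sum x
          ≡⟨ cong (_+ U * sum x) (+-identityʳ (N * U ∸ U * sum x)) ⟩
        N * U ∸ U * sum x + U * sum x
          ≡⟨ m∸n+n≡m Usum≤ ⟩
        N * U        ≡⟨ +-identityʳ (N * U) ⟨
        1 * (N * U)  ∎
    ; isRoom≡ = trans (place-isRoom U rs P)
        (cong suc (trans (∑-map _ x isRoom) (∑-zero x (λ _ → refl))))
    ; space≤ = λ i′ → ≤-trans
        (place-space U (E * U) i′ rs P (λ j∈ → w≤ (proj₁ (∈-filterᵇ⁻ {p = pref i} js j∈))))
        (≤-trans (+-monoʳ-≤ ([ i ≡ᵇ i′ ]∙ (N * U ∸ U * sum x + E * U))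
                   (≤-reflexive (∑-map _ x (spaceOf U (E * U) i′))))
                 (space (i ≡ᵇ i′)))
    ; placed∈ = All.tabulate λ {e} e∈ →
        let m≡ = All.lookup (proj₁ on) e∈
            j∈ , p = ∈-filterᵇ⁻ {p = pref i} js (Any-resp-⊆ (place-jobs U rs P) (∈-map⁺ proj₁ e∈))
        in here m≡ , subst (λ m → pref m (proj₁ e) ≡ true) (sym m≡) p , j∈
    ; resource∈ = All.map here (proj₂ on)
    ; placed-unique = AllPairs-resp-⊆ (place-jobs U rs P) (AllPairs-filter⁺ (T? ∘ pref i) js-unique)
    }
    where
    open ≡-Reasoning
    rs = resources U i x
    P  = filterᵇ (pref i) js
    s  = place U rs P
    sum≤ = proj₂ (proj₂ (∈-configs⁻ x∈))
    Usum≤ : U * sum x ≤ N * U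
    Usum≤ = ≤-trans (*-monoʳ-≤ U sum≤) (≤-reflexive (*-comm U N))
    on : OnMachines {_≡ i} s
    on = place-machines {_≡ i} U rs P (refl ∷ All-map⁺ (All.tabulate (λ _ → refl)))
    ∑-suc : ∀ y → ∑ y (λ c → suc c * U) ≡ length y * U + U * sum y
    ∑-suc []      = sym (*-zeroʳ U)
    ∑-suc (c ∷ y) = trans (cong (suc c * U +_) (∑-suc y)) (trans (+-interchange U (c * U) (length y * U) (U * sum y))
      (cong (U + length y * U +_) (trans (cong (_+ U * sum y) (*-comm c U)) (sym (*-distribˡ-+ U c (sum y))))))
    space : ∀ b → ([ b ]∙ (N * U ∸ U * sum x + E * U)) + ∑ x (λ c → [ b ]∙ (suc c * U))
                  ≤ ((if b then 1 else 0) + 0) * ((N + E + E) * U)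
    space false = ≤-reflexive (∑-zero x (λ _ → refl))
    space true  = ≤-trans
      (≤-reflexive (trans (cong (N * U ∸ U * sum x + E * U +_) (∑-suc x))
        (solve 4 (λ a e l s → a :+ e :+ (l :+ s) := a :+ s :+ e :+ l) refl
               (N * U ∸ U * sum x) (E * U) (length x * U) (U * sum x))))
      (≤-trans (+-mono-≤ (≤-reflexive (cong (_+ E * U) (m∸n+n≡m Usum≤)))
                         (*-monoˡ-≤ U (proj₁ (∈-configs⁻ x∈))))
        (≤-reflexive (solve 3 (λ n e u → n :* u :+ e :* u :+ e :* u := (con 1 :+ con 0) :* ((n :+ e :+ e) :* u))
                            refl N E U)))

  valid-combine : ∀ {i ms s o} → Unique (i ∷ ms) → Valid ms s → Valid (i ∷ []) o →
                  Valid (i ∷ ms) (combine s o)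
  valid-combine {i} {ms} {s@(_ , as , rs)} {o@(_ , as′ , rs′)} (i≢ ∷ u) v v′ = record
    { slots = slots v ++ slots v′
    ; key≡ = trans (cong₂ _+_ (key≡ v) (key≡ v′)) (sym (key-++ W (suc N) 0 (slots v) (slots v′)))
    ; few = begin
        length (slots v ++ slots v′)         ≡⟨ length-++ (slots v) ⟩
        length (slots v) + length (slots v′) ≤⟨ +-mono-≤ (few v) (few v′) ⟩
        length ms * E + 1 * E                ≡⟨ +-comm (length ms * E) (1 * E) ⟩
        1 * E + length ms * E                ≡⟨ cong (_+ length ms * E) (*-identityˡ E) ⟩
        E + length ms * E                    ∎
    ; bounded = λ c∈ → case ∈-++⁻ (slots v) c∈ of λ
        { (inj₁ c∈₁) → bounded v c∈₁ ; (inj₂ c∈₂) → bounded v′ c∈₂ }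
    ; slots≡ = λ c → begin-equality
        ∑ (rs ++ rs′) (slotOf c) + ∑ (as ++ as′) (classOf U c ∘ proj₁)
          ≡⟨ cong₂ _+_ (∑-++ rs rs′ _) (∑-++ as as′ _) ⟩
        ∑ rs (slotOf c) + ∑ rs′ (slotOf c) + (∑ as (classOf U c ∘ proj₁) + ∑ as′ (classOf U c ∘ proj₁))
          ≡⟨ +-interchange (∑ rs (slotOf c)) (∑ rs′ (slotOf c)) _ _ ⟩
        ∑ rs (slotOf c) + ∑ as (classOf U c ∘ proj₁) + (∑ rs′ (slotOf c) + ∑ as′ (classOf U c ∘ proj₁))
          ≡⟨ cong₂ _+_ (slots≡ v c) (slots≡ v′ c) ⟩
        count c (slots v) + count c (slots v′)
          ≡⟨ ∑-++ (slots v) (slots v′) _ ⟨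
        count c (slots v ++ slots v′) ∎
    ; rooms≡ = begin-equality
        ∑ (rs ++ rs′) roomOf + ∑ (as ++ as′) (smallOf U ∘ proj₁) + U * sum (slots v ++ slots v′)
          ≡⟨ cong₂ _+_ (cong₂ _+_ (∑-++ rs rs′ _) (∑-++ as as′ _)) (cong (U *_) (sum-++ (slots v) (slots v′))) ⟩
        _ ≡⟨ solve 7 (λ a b c d e f u → a :+ b :+ (c :+ d) :+ u :* (e :+ f)
                                      := (b :+ d :+ u :* f) :+ (a :+ c :+ u :* e)) refl
               (∑ rs roomOf) (∑ rs′ roomOf) (∑ as (smallOf U ∘ proj₁)) (∑ as′ (smallOf U ∘ proj₁))
               (sum (slots v)) (sum (slots v′)) U ⟩
        _ ≡⟨ cong₂ _+_ (rooms≡ v′) (rooms≡ v) ⟩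
        1 * (N * U) + length ms * (N * U)
          ≡⟨ cong (_+ length ms * (N * U)) (*-identityˡ (N * U)) ⟩
        N * U + length ms * (N * U) ∎
    ; isRoom≡ = trans (∑-++ rs rs′ isRoom) (trans (cong₂ _+_ (isRoom≡ v) (isRoom≡ v′)) (+-comm (length ms) 1))
    ; space≤ = λ i′ → begin
        ∑ (as ++ as′) (loadOf i′) + ∑ (rs ++ rs′) (spaceOf U (E * U) i′)
          ≡⟨ cong₂ _+_ (∑-++ as as′ _) (∑-++ rs rs′ _) ⟩
        ∑ as (loadOf i′) + ∑ as′ (loadOf i′) + (∑ rs (spaceOf U (E * U) i′) + ∑ rs′ (spaceOf U (E * U) i′))
          ≡⟨ +-interchange (∑ as (loadOf i′)) (∑ as′ (loadOf i′)) _ _ ⟩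
        ∑ as (loadOf i′) + ∑ rs (spaceOf U (E * U) i′) + (∑ as′ (loadOf i′) + ∑ rs′ (spaceOf U (E * U) i′))
          ≤⟨ +-mono-≤ (space≤ v i′) (space≤ v′ i′) ⟩
        count i′ ms * B + ((if i ≡ᵇ i′ then 1 else 0) + 0) * B
          ≡⟨ solve 3 (λ m n b → m :* b :+ (n :+ con 0) :* b := (n :+ m) :* b) refl
               (count i′ ms) (if i ≡ᵇ i′ then 1 else 0) B ⟩
        count i′ (i ∷ ms) * B ∎
    ; placed∈ = All-++⁺ (All.map (λ { (m∈ , p) → there m∈ , p }) (placed∈ v))
                        (All.map (λ { (here eq , p) → here eq , p }) (placed∈ v′))
    ; resource∈ = All-++⁺ (All.map there (resource∈ v))
                          (All.map (λ { (here eq) → here eq }) (resource∈ v′))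
    ; placed-unique = subst Unique (sym (map-++ proj₁ as as′))
        (Unique-++⁺ (placed-unique v) (placed-unique v′) disjoint)
    }
    where
    open ≤-Reasoning
    B = (N + E + E) * U
    -- A job prefers at most one machine, so options of different machines place different jobs.
    disjoint : ∀ {j} → ¬ (j ∈ map proj₁ as × j ∈ map proj₁ as′)
    disjoint (j∈ , j∈′) with ∈-map⁻ proj₁ j∈ | ∈-map⁻ proj₁ j∈′
    ... | (j , m) , e∈ , refl | (_ , m′) , e∈′ , refl
      with All.lookup (placed∈ v) e∈ | All.lookup (placed∈ v′) e∈′
    ...   | m∈ , p , _ | here refl , p′ , _ with pref-functional p p′
    ...     | refl = All.lookup i≢ m∈ refl

  valid-select : ∀ ks ms → Unique ms → ∀ {s} → s ∈ select ks (map (options W U pref js) ms) → Valid ms s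
  valid-select = select-sound Valid (λ i → Valid (i ∷ [])) (options W U pref js)
    valid-empty valid-option valid-combine

-- Comparison of the selection with a given assignment

count-none : ∀ {c} xs → (∀ {x} → x ∈ xs → x ≢ c) → count c xs ≡ 0
count-none {c} xs ≢c = ∑-zero xs λ {x} x∈ → cong (λ b → if b then 1 else 0) (≢⇒≡ᵇ-false {x} {c} (≢c x∈))

key-concatMap : {A : Set} (W d c : ℕ) (f : A → List ℕ) (xs : List A) →
                key W d c (concatMap f xs) ≡ ∑ xs (λ x → key W d c (f x))
key-concatMap W d c f []       = key-[] W d c
key-concatMap W d c f (x ∷ xs) = trans (key-++ W d c (f x) (concatMap f xs))
  (cong (key W d c (f x) +_) (key-concatMap W d c f xs))

-- The assignment τ plays the part of an optimal one.
module Optimality (E U W : ℕ) {{E≢0 : NonZero E}} (pref : Machine → Job → Bool) (js : List Job)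
  (pref-functional : ∀ {i i′ j} → pref i j ≡ true → pref i′ j ≡ true → i ≡ i′)
  (js-unique : Unique js) (js-descending : Greedy.Descending E js)
  (ms : List Machine) (ms-unique : Unique ms) (ms<W : length ms * E < W) (js<W : length js < W)
  (ks : List ℕ)
  (ks∋ : ∀ {xs} → (∀ k → count k xs < W) → key W (suc (Rounding.N E)) 0 xs ∈ ks)
  (τ : Job → Machine) (τ∈ : ∀ {j} → j ∈ js → τ j ∈ ms)
  (τ-load : ∀ {i} → i ∈ ms → ∑ js (λ j → [ τ j ≡ᵇ i ]∙ Rounding.w E j) ≤ Rounding.N E * U)
  where

  open Rounding E
  open Greedy E
  open Scheme E

  w≤ : ∀ {j} → j ∈ js → w j ≤ N * U
  w≤ {j} j∈ = begin
    w j                                       ≡⟨ cong ([_]∙ w j) (≡ᵇ-refl (τ j)) ⟨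
    [ τ j ≡ᵇ τ j ]∙ w j                       ≤⟨ ∈⇒≤∑ (λ j′ → [ τ j′ ≡ᵇ τ j ]∙ w j′) j∈ ⟩
    ∑ js (λ j′ → [ τ j′ ≡ᵇ τ j ]∙ w j′)       ≤⟨ τ-load (τ∈ j∈) ⟩
    N * U                                     ∎
    where open ≤-Reasoning

  open Selection E U W pref js pref-functional js-unique js-descending w≤
  open Valid

  on : Machine → List Job
  on i = filterᵇ (λ j → τ j ≡ᵇ i) js

  -- Machines outside `ms` receive no job from `τ`. Including them makes `config i` a configuration
  -- for every `i`, as `select-complete` asks of its `pick`.
  on-load : ∀ i → ∑ (on i) w ≤ N * U
  on-load i with any (λ m → m ≡ᵇ i) ms in eq
  ... | true with any⁻ ms eq
  ...   | m , m∈ , m≡ with refl ← ≡ᵇ-true m i m≡ =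
    ≤-trans (≤-reflexive (∑-filter (λ j → τ j ≡ᵇ i) js w)) (τ-load m∈)
  on-load i | false = ≤-trans (≤-reflexive (trans (∑-filter (λ j → τ j ≡ᵇ i) js w)
    (∑-zero js (λ {j} j∈ → cong ([_]∙ w j) (≢⇒≡ᵇ-false {τ j} {i} λ τ≡i →
      case trans (sym eq) (any⁺ {p = λ m → m ≡ᵇ i} (τ∈ j∈) (trans (cong (_≡ᵇ i) τ≡i) (≡ᵇ-refl i))) of λ ()))))) z≤n

  classes : List Job → List ℕ
  classes xs = map (cls U) (filterᵇ (big U) xs)

  count-classes : ∀ c xs → count c (classes xs) ≡ ∑ xs (classOf U c)
  count-classes c xs = trans (∑-map (cls U) (filterᵇ (big U) xs) _) (∑-filter (big U) xs _)

  rounded≤ : ∀ xs → U * sum (classes xs) + ∑ xs (smallOf U) ≤ ∑ xs w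
  rounded≤ xs = begin
    U * sum (classes xs) + ∑ xs (smallOf U)
      ≡⟨ cong (λ n → U * n + ∑ xs (smallOf U)) (∑-filter (big U) xs (cls U)) ⟩
    U * ∑ xs (λ j → [ big U j ]∙ cls U j) + ∑ xs (smallOf U)
      ≡⟨ cong (_+ ∑ xs (smallOf U)) (∑-* U xs _) ⟨
    ∑ xs (λ j → U * ([ big U j ]∙ cls U j)) + ∑ xs (smallOf U)
      ≡⟨ ∑-+ xs _ _ ⟨
    ∑ xs (λ j → U * ([ big U j ]∙ cls U j) + smallOf U j)
      ≤⟨ ∑-mono xs (λ {j} _ → each j (big U j)) ⟩
    ∑ xs w ∎
    where
    open ≤-Reasoning
    each : ∀ j b → U * ([ b ]∙ cls U j) + ([ not b ]∙ w j) ≤ w j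
    each j true  = ≤-trans (≤-reflexive (+-identityʳ _)) (U*cls≤w U j)
    each j false = ≤-reflexive (cong (_+ w j) (*-zeroʳ U))

  config : Machine → List ℕ
  config i = classes (on i)

  ∈-classes : ∀ xs {c} → c ∈ classes xs → ∃[ j ] big U j ≡ true × j ∈ xs × c ≡ cls U j
  ∈-classes xs c∈ with ∈-map⁻ (cls U) c∈
  ... | j , j∈ , c≡ with ∈-filterᵇ⁻ {p = big U} xs j∈
  ...   | j∈xs , b = j , b , j∈xs , c≡

  classes≤N : ∀ xs {c} → c ∈ classes xs → c ≤ N
  classes≤N xs c∈ with ∈-classes xs c∈
  ... | j , _ , _ , refl = cls≤N U j

  config∈ : ∀ i → config i ∈ configs
  config∈ i = ∈-configs⁺ few-classes (classes≤N (on i)) sum≤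
    where
    open ≤-Reasoning
    -- For `U = 0` the factor `U` cannot be cancelled below, but then every load on the machine
    -- vanishes and no job there is big.
    no-big : ∀ {j} → j ∈ on i → U ≡ 0 → big U j ≡ true → ⊥
    no-big {j} j∈ refl b = case trans (sym b) (cong not (≤⇒≤ᵇ-true (begin
      w j          ≤⟨ ∈⇒≤∑ w j∈ ⟩
      ∑ (on i) w   ≤⟨ on-load i ⟩
      N * 0        ≡⟨ *-zeroʳ N ⟩
      0            ≤⟨ z≤n ⟩
      E * 0        ∎))) of λ ()
    U*sum≤ : U * sum (config i) ≤ U * N
    U*sum≤ = begin
      U * sum (config i)                              ≤⟨ m≤m+n _ _ ⟩
      U * sum (config i) + ∑ (on i) (smallOf U)       ≤⟨ rounded≤ (on i) ⟩
      ∑ (on i) w                                      ≤⟨ on-load i ⟩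
      N * U                                           ≡⟨ *-comm N U ⟩
      U * N                                           ∎
    sum≤ : sum (config i) ≤ N
    sum≤ with U ≟ 0
    ... | no U≢0 = *-cancelˡ-≤ U {{≢-nonZero U≢0}} U*sum≤
    ... | yes U≡0 with config i in eq
    ...   | []    = z≤n
    ...   | c ∷ x with ∈-classes (on i) (subst (c ∈_) (sym eq) (here refl))
    ...     | j , b , j∈ , _ = contradiction b (no-big j∈ U≡0)
    -- The classes in a configuration are at least `E` each and sum up to at most `E * E`.
    few-classes : length (config i) ≤ E
    few-classes = *-cancelʳ-≤ _ E E (begin
      length (config i) * E   ≡⟨ ∑-const (config i) E ⟨
      ∑ (config i) (λ _ → E)  ≤⟨ ∑-mono (config i) (λ c∈ → case ∈-classes (on i) c∈ of λ
                                   { (j , b , _ , refl) → big⇒E≤cls U j b }) ⟩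
      ∑ (config i) id         ≡⟨ cong sum (map-id (config i)) ⟩
      sum (config i)          ≤⟨ sum≤ ⟩
      E * E                   ∎)

  kept : Machine → List Job
  kept i = filterᵇ (λ j → τ j ≡ᵇ i) (filterᵇ (pref i) js)

  chosen : Machine → State
  chosen i = option W U pref js i (config i)

  kept-fits : ∀ i → Fits U (kept i) (resources U i (config i))
  kept-fits i = fitting
    (λ c → begin
      ∑ (kept i) (classOf U c)    ≤⟨ ∑-kept (classOf U c) ⟩
      ∑ (on i) (classOf U c)      ≡⟨ count-classes c (on i) ⟨
      count c (config i)          ≡⟨ ∑-map (λ c → i , true , c) (config i) (slotOf c) ⟨
      ∑ (resources U i (config i)) (slotOf c) ∎)
    (begin
      ∑ (kept i) (smallOf U)      ≤⟨ ∑-kept (smallOf U) ⟩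
      ∑ (on i) (smallOf U)        ≤⟨ m+n≤o⇒m≤o∸n _ (≤-trans (≤-reflexive (+-comm (∑ (on i) (smallOf U)) _))
                                       (≤-trans (rounded≤ (on i)) (on-load i))) ⟩
      N * U ∸ U * sum (config i)  ≤⟨ m≤m+n _ _ ⟩
      ∑ (resources U i (config i)) roomOf ∎)
    where
    open ≤-Reasoning
    ∑-kept : ∀ f → ∑ (kept i) f ≤ ∑ (on i) f
    ∑-kept f = begin
      ∑ (kept i) f  ≡⟨ ∑-filter _ (filterᵇ (pref i) js) f ⟩
      ∑ (filterᵇ (pref i) js) (λ j → [ τ j ≡ᵇ i ]∙ f j) ≡⟨ ∑-filter (pref i) js _ ⟩
      ∑ js (λ j → [ pref i j ]∙ ([ τ j ≡ᵇ i ]∙ f j)) ≤⟨ ∑-mono js (λ {j} _ → []∙-≤ (pref i j) _) ⟩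
      ∑ js (λ j → [ τ j ≡ᵇ i ]∙ f j) ≡⟨ ∑-filter _ js f ⟨
      ∑ (on i) f ∎

  kept≤ : ∀ i → length (kept i) ≤ value (chosen i)
  kept≤ i = greedy U (filterᵇ (pref i) js) (resources U i (config i))
    (AllPairs-filter⁺ (T? ∘ pref i) js-descending) (filter-⊆ (λ j → T? (τ j ≡ᵇ i)) (filterᵇ (pref i) js))
    (cong suc (trans (∑-map _ (config i) isRoom) (∑-zero (config i) (λ _ → refl)))) (kept-fits i)

  ∑-kept≡ : ∑ ms (λ i → length (kept i)) ≡ ∑ js (λ j → [ pref (τ j) j ]∙ 1)
  ∑-kept≡ = begin
    ∑ ms (λ i → length (kept i))
      ≡⟨ ∑-cong ms (λ {i} _ → trans (length-∑ (kept i))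
           (trans (∑-filter _ (filterᵇ (pref i) js) _) (∑-filter (pref i) js _))) ⟩
    ∑ ms (λ i → ∑ js (λ j → [ pref i j ]∙ ([ τ j ≡ᵇ i ]∙ 1)))
      ≡⟨ ∑-swap ms js _ ⟩
    ∑ js (λ j → ∑ ms (λ i → [ pref i j ]∙ ([ τ j ≡ᵇ i ]∙ 1)))
      ≡⟨ ∑-cong js (λ {j} j∈ → trans (∑-cong ms (λ {i} _ → exch (pref i j) (τ j ≡ᵇ i)))
           (∑-single (λ i → [ pref i j ]∙ 1) ms-unique (τ∈ j∈))) ⟩
    ∑ js (λ j → [ pref (τ j) j ]∙ 1) ∎
    where
    open ≡-Reasoning
    exch : ∀ a b → [ a ]∙ ([ b ]∙ 1) ≡ [ b ]∙ ([ a ]∙ 1)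
    exch true  b     = refl
    exch false true  = refl
    exch false false = refl

  ∑-machines : ∀ f → ∑ ms (λ i → ∑ (on i) f) ≡ ∑ js f
  ∑-machines f = begin
    ∑ ms (λ i → ∑ (on i) f)                          ≡⟨ ∑-cong ms (λ {i} _ → ∑-filter _ js f) ⟩
    ∑ ms (λ i → ∑ js (λ j → [ τ j ≡ᵇ i ]∙ f j))      ≡⟨ ∑-swap ms js _ ⟩
    ∑ js (λ j → ∑ ms (λ i → [ τ j ≡ᵇ i ]∙ f j))      ≡⟨ ∑-cong js (λ {j} j∈ → ∑-single (λ _ → f j) ms-unique (τ∈ j∈)) ⟩
    ∑ js f                                           ∎
    where open ≡-Reasoning

  -- Under `τ` each big job lies on exactly one machine and contributes one slot there, so the
  -- multiplicities of all classes agree.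
  chosen-key : ∑ ms (proj₁ ∘ chosen) ≡ target W U js
  chosen-key = trans (sym (key-concatMap W (suc N) 0 config ms)) (key-cong W (suc N) 0 λ c → begin
    count c (concatMap config ms)            ≡⟨ ∑-concatMap config ms _ ⟩
    ∑ ms (λ i → count c (config i))          ≡⟨ ∑-cong ms (λ {i} _ → count-classes c (on i)) ⟩
    ∑ ms (λ i → ∑ (on i) (classOf U c))      ≡⟨ ∑-machines (classOf U c) ⟩
    ∑ js (classOf U c)                       ≡⟨ count-classes c js ⟨
    count c (classes js)                     ∎)
    where open ≡-Reasoning

  chosen-keys : ∀ bs → length bs ≤ length ms → ∑ bs (proj₁ ∘ chosen) ∈ ks
  chosen-keys bs len = subst (_∈ ks) (key-concatMap W (suc N) 0 config bs)
    (ks∋ λ k → ≤-<-trans (begin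
      count k (concatMap config bs)       ≤⟨ count≤length k (concatMap config bs) ⟩
      length (concatMap config bs)        ≡⟨ length-∑ (concatMap config bs) ⟩
      ∑ (concatMap config bs) (λ _ → 1)   ≡⟨ ∑-concatMap config bs _ ⟩
      ∑ bs (λ i → ∑ (config i) (λ _ → 1)) ≤⟨ ∑-mono bs (λ {i} _ → ≤-trans (≤-reflexive (sym (length-∑ (config i))))
                                               (proj₁ (∈-configs⁻ (config∈ i)))) ⟩
      ∑ bs (λ _ → E)                      ≡⟨ ∑-const bs E ⟩
      length bs * E                       ≤⟨ *-monoˡ-≤ E len ⟩
      length ms * E                       ∎) ms<W)
    where open ≤-Reasoning

  s : State
  s = selected W U ks pref ms js

  -- The options derived from `τ` reach the target key, which rules out the default `empty`; on each
  -- machine the greedy rule keeps at least the jobs that `τ` keeps.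
  s-spec : Valid ms s × proj₁ s ≡ target W U js × ∑ js (λ j → [ pref (τ j) j ]∙ 1) ≤ value s
  s-spec with select-complete (options W U pref js) chosen
                (λ i → ∈-map⁺ (option W U pref js i) (config∈ i)) ks ms chosen-keys
  ... | s₀ , s₀∈ , key₀ , val₀
    with best (target W U js) (select ks (map (options W U pref js) ms))
       | best-best (target W U js) (select ks (map (options W U pref js) ms))
  ... | _ | none ∄ = contradiction (trans key₀ chosen-key) (∄ s₀∈)
  ... | _ | some {t} t∈ tk max = valid-select ks ms ms-unique t∈ , tk , (begin
      ∑ js (λ j → [ pref (τ j) j ]∙ 1)  ≡⟨ ∑-kept≡ ⟨
      ∑ ms (λ i → length (kept i))      ≤⟨ ∑-mono ms (λ {i} _ → kept≤ i) ⟩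
      ∑ ms (value ∘ chosen)             ≤⟨ val₀ ⟩
      value s₀                          ≤⟨ max s₀∈ (trans key₀ chosen-key) ⟩
      value t                           ∎)
    where open ≤-Reasoning

  v : Valid ms s
  v = proj₁ s-spec

  as : Placed
  as = proj₁ (proj₂ s)

  rs : List Resource
  rs = proj₂ (proj₂ s)

  left : List Job
  left = leftover as js

  left⊆ : ∀ {j} → j ∈ left → j ∈ js
  left⊆ j∈ = proj₁ (∈-filterᵇ⁻ js j∈)

  split : js ↭ map proj₁ as ++ left
  split = unique-↭ js-unique
    (Unique-++⁺ (placed-unique v) (AllPairs-filter⁺ (T? ∘ λ j → not (any (λ e → eqJob (proj₁ e) j) as)) js-unique) disjoint)
    into from
    where
    placed? : Job → Bool
    placed? j = any (λ e → eqJob (proj₁ e) j) as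
    disjoint : ∀ {j} → ¬ (j ∈ map proj₁ as × j ∈ left)
    disjoint (j∈ , j∈left) with ∈-map⁻ proj₁ j∈ | ∈-filterᵇ⁻ {p = not ∘ placed?} js j∈left
    ... | e , e∈ , refl | _ , ¬p =
      case trans (sym ¬p) (cong not (any⁺ {p = λ e′ → eqJob (proj₁ e′) (proj₁ e)} e∈ (eqJob-refl (proj₁ e)))) of λ ()
    into : ∀ {j} → j ∈ js → j ∈ map proj₁ as ++ left
    into {j} j∈ with placed? j in eq
    ... | false = ∈-++⁺ʳ (map proj₁ as) (∈-filterᵇ⁺ {p = not ∘ placed?} j∈ (cong not eq))
    ... | true with any⁻ {p = λ e → eqJob (proj₁ e) j} as eq
    ...   | e , e∈ , e≡ with refl ← eqJob-true {proj₁ e} {j} e≡ = ∈-++⁺ˡ (∈-map⁺ proj₁ e∈)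
    from : ∀ {j} → j ∈ map proj₁ as ++ left → j ∈ js
    from j∈ with ∈-++⁻ (map proj₁ as) j∈
    ... | inj₂ j∈left = left⊆ j∈left
    ... | inj₁ j∈as with ∈-map⁻ proj₁ j∈as
    ...   | e , e∈ , refl = proj₂ (proj₂ (All.lookup (placed∈ v) e∈))

  ∑-split : ∀ f → ∑ js f ≡ ∑ as (f ∘ proj₁) + ∑ left f
  ∑-split f = trans (∑-↭ f split) (trans (∑-++ (map proj₁ as) left f) (cong (_+ ∑ left f) (∑-map proj₁ as f)))

  -- Up to `N` the multiplicities are digits of equal keys, all below `W`. Larger classes occur on
  -- neither side.
  counts≡ : ∀ c → count c (slots v) ≡ count c (classes js)
  counts≡ c with c ≤? N
  ... | yes c≤N = key-injective W (suc N) 0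
    (λ k → ≤-<-trans (≤-trans (count≤length k (slots v)) (few v)) ms<W)
    (λ k → ≤-<-trans (≤-trans (count≤length k (classes js))
             (≤-trans (≤-reflexive (length-map (cls U) (filterᵇ (big U) js))) (length-filter (T? ∘ big U) js))) js<W)
    (trans (sym (key≡ v)) (proj₁ (proj₂ s-spec))) c z≤n (s≤s c≤N)
  ... | no c≰N = trans (count-none (slots v) (λ { x∈ refl → c≰N (bounded v x∈) }))
                       (sym (count-none (classes js) (λ { x∈ refl → c≰N (classes≤N js x∈) })))

  sum≡ : sum (slots v) ≡ sum (classes js)
  sum≡ = begin
    sum (slots v)                                       ≡⟨ cong sum (map-id (slots v)) ⟨
    ∑ (slots v) id                                      ≡⟨ ∑-by-count (suc N) (slots v) id (s≤s ∘ bounded v) ⟩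
    ∑ (upTo (suc N)) (λ c → count c (slots v) * c)      ≡⟨ ∑-cong (upTo (suc N)) (λ {c} _ → cong (_* c) (counts≡ c)) ⟩
    ∑ (upTo (suc N)) (λ c → count c (classes js) * c)   ≡⟨ ∑-by-count (suc N) (classes js) id (s≤s ∘ classes≤N js) ⟨
    ∑ (classes js) id                                   ≡⟨ cong sum (map-id (classes js)) ⟩
    sum (classes js)                                    ∎
    where open ≡-Reasoning

  rs⁺ : List Resource
  rs⁺ = map (inflate U) rs

  isRoom⁺ : ∑ rs⁺ isRoom ≡ length ms
  isRoom⁺ = trans (∑-map (inflate U) rs isRoom)
    (trans (∑-cong rs (λ {r} _ → isRoom-inflate U r)) (isRoom≡ v))

  left-fits : Room U left rs⁺
  left-fits = record
    { slots≥ = λ c → ≤-reflexive (sym (trans (∑-map (inflate U) rs (slotOf c))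
        (trans (∑-cong rs (λ {r} _ → slotOf-inflate U c r)) (slots-left c))))
    ; rooms≥ = ≤-trans (+-monoˡ-≤ _ rooms-left) (≤-reflexive (sym rooms⁺))
    ; some-room = λ j∈ → ≤-trans (nonempty (τ∈ (left⊆ j∈))) (≤-reflexive (sym isRoom⁺))
    }
    where
    nonempty : ∀ {m} {l : List Machine} → m ∈ l → 1 ≤ length l
    nonempty (here _)  = s≤s z≤n
    nonempty (there _) = s≤s z≤n
    slots-left : ∀ c → ∑ rs (slotOf c) ≡ ∑ left (classOf U c)
    slots-left c = +-cancelʳ-≡ (∑ as (classOf U c ∘ proj₁)) _ _ (begin
      ∑ rs (slotOf c) + ∑ as (classOf U c ∘ proj₁)        ≡⟨ slots≡ v c ⟩
      count c (slots v)                                   ≡⟨ counts≡ c ⟩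
      count c (classes js)                                ≡⟨ count-classes c js ⟩
      ∑ js (classOf U c)                                  ≡⟨ ∑-split (classOf U c) ⟩
      ∑ as (classOf U c ∘ proj₁) + ∑ left (classOf U c)   ≡⟨ +-comm (∑ as (classOf U c ∘ proj₁)) _ ⟩
      ∑ left (classOf U c) + ∑ as (classOf U c ∘ proj₁)   ∎)
      where open ≡-Reasoning
    -- Rooms and slots together opened `N * U` per machine. By `sum≡` the slots take exactly the
    -- rounded volume of the big jobs, and `τ` shows that this volume and all small jobs fit into
    -- the total.
    rooms-left : ∑ left (smallOf U) ≤ ∑ rs roomOf
    rooms-left = +-cancelʳ-≤ A _ _ (+-cancelʳ-≤ B _ _ (begin
      ∑ left (smallOf U) + A + B     ≡⟨ solve 3 (λ l a b → l :+ a :+ b := b :+ (a :+ l)) refl (∑ left (smallOf U)) A B ⟩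
      B + (A + ∑ left (smallOf U))   ≡⟨ cong (B +_) (∑-split (smallOf U)) ⟨
      B + ∑ js (smallOf U)           ≡⟨ cong (λ n → U * n + ∑ js (smallOf U)) sum≡ ⟩
      U * sum (classes js) + ∑ js (smallOf U) ≤⟨ rounded≤ js ⟩
      ∑ js w                         ≡⟨ ∑-machines w ⟨
      ∑ ms (λ i → ∑ (on i) w)        ≤⟨ ∑-mono ms (λ {i} _ → on-load i) ⟩
      ∑ ms (λ _ → N * U)             ≡⟨ ∑-const ms (N * U) ⟩
      length ms * (N * U)            ≡⟨ rooms≡ v ⟨
      ∑ rs roomOf + A + B            ∎))
      where
      open ≤-Reasoning
      A = ∑ as (smallOf U ∘ proj₁)
      B = U * sum (slots v)
    rooms⁺ : ∑ rs⁺ roomOf ≡ ∑ rs roomOf + ∑ rs⁺ isRoom * (E * U)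
    rooms⁺ = begin
      ∑ rs⁺ roomOf                                  ≡⟨ ∑-map (inflate U) rs roomOf ⟩
      ∑ rs (roomOf ∘ inflate U)                     ≡⟨ ∑-cong rs (λ {r} _ → roomOf-inflate U r) ⟩
      ∑ rs (λ r → roomOf r + isRoom r * (E * U))    ≡⟨ ∑-+ rs roomOf _ ⟩
      ∑ rs roomOf + ∑ rs (λ r → isRoom r * (E * U)) ≡⟨ cong (∑ rs roomOf +_) (trans (∑-cong rs (λ {r} _ → *-comm (isRoom r) (E * U)))
                                                         (trans (∑-* (E * U) rs isRoom) (*-comm (E * U) _))) ⟩
      ∑ rs roomOf + ∑ rs isRoom * (E * U)           ≡⟨ cong (λ n → ∑ rs roomOf + n * (E * U)) (trans (isRoom≡ v) (sym isRoom⁺)) ⟩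
      ∑ rs roomOf + ∑ rs⁺ isRoom * (E * U)          ∎
      where open ≡-Reasoning

  stage : Stage
  stage = place U rs⁺ left

  full : Placed
  full = complete U js s

  full-jobs : map proj₁ full ↭ js
  full-jobs = ↭-trans (↭-reflexive (trans (map-++ proj₁ (proj₁ stage) as)
                                          (cong (_++ map proj₁ as) (place-all U rs⁺ left left-fits))))
    (↭-trans (++-comm left (map proj₁ as)) (↭-sym split))

  full-machines : All (λ e → proj₂ e ∈ ms) full
  full-machines = All-++⁺ (proj₁ (place-machines U rs⁺ left (All-map⁺ (resource∈ v)))) (All.map proj₁ (placed∈ v))

  -- An enlarged room without excess counts as much as the original room with excess `E * U`, so the
  -- potential of the selection carries over to the completion.
  full-load : ∀ {i} → i ∈ ms → ∑ full (loadOf i) ≤ (N + E + E) * U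
  full-load {i} i∈ = begin
    ∑ full (loadOf i)                                     ≡⟨ ∑-++ (proj₁ stage) as _ ⟩
    ∑ (proj₁ stage) (loadOf i) + ∑ as (loadOf i)          ≤⟨ +-monoˡ-≤ (∑ as (loadOf i)) (m≤m+n (∑ (proj₁ stage) (loadOf i)) _) ⟩
    ∑ (proj₁ stage) (loadOf i) + ∑ (proj₂ stage) (spaceOf U 0 i) + ∑ as (loadOf i)
      ≤⟨ +-monoˡ-≤ _ (place-space U 0 i rs⁺ left (w≤ ∘ left⊆)) ⟩
    ∑ rs⁺ (spaceOf U 0 i) + ∑ as (loadOf i)
      ≡⟨ cong (_+ ∑ as (loadOf i)) (trans (∑-map (inflate U) rs _) (∑-cong rs (λ {r} _ → spaceOf-inflate U i r))) ⟩
    ∑ rs (spaceOf U (E * U) i) + ∑ as (loadOf i)          ≡⟨ +-comm (∑ rs (spaceOf U (E * U) i)) _ ⟩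
    ∑ as (loadOf i) + ∑ rs (spaceOf U (E * U) i)          ≤⟨ space≤ v i ⟩
    count i ms * ((N + E + E) * U)                        ≡⟨ cong (_* ((N + E + E) * U)) count≡1 ⟩
    1 * ((N + E + E) * U)                                 ≡⟨ *-identityˡ _ ⟩
    (N + E + E) * U                                       ∎
    where
    open ≤-Reasoning
    count≡1 : count i ms ≡ 1
    count≡1 = trans (∑-cong ms (λ {m} _ → cong (λ b → if b then 1 else 0) (≡ᵇ-sym m i)))
                    (∑-single (λ _ → 1) ms-unique i∈)

  full-preferred : ∑ js (λ j → [ pref (τ j) j ]∙ 1) ≤ ∑ full (λ e → [ pref (proj₂ e) (proj₁ e) ]∙ 1)
  full-preferred = begin
    ∑ js (λ j → [ pref (τ j) j ]∙ 1)               ≤⟨ proj₂ (proj₂ s-spec) ⟩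
    length as                                      ≡⟨ length-∑ as ⟩
    ∑ as (λ _ → 1)                                 ≡⟨ ∑-cong as (λ e∈ → cong ([_]∙ 1) (sym (proj₁ (proj₂ (All.lookup (placed∈ v) e∈))))) ⟩
    ∑ as (λ e → [ pref (proj₂ e) (proj₁ e) ]∙ 1)   ≤⟨ m≤n+m _ _ ⟩
    ∑ (proj₁ stage) (λ e → [ pref (proj₂ e) (proj₁ e) ]∙ 1) + ∑ as (λ e → [ pref (proj₂ e) (proj₁ e) ]∙ 1)
      ≡⟨ ∑-++ (proj₁ stage) as _ ⟨
    ∑ full (λ e → [ pref (proj₂ e) (proj₁ e) ]∙ 1) ∎
    where open ≤-Reasoning

-- Sizes of lists

∈⇒size≤ : ∀ A {x} xs → x ∈ xs → size A x ≤ size (list A) xs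
∈⇒size≤ A (x ∷ xs) (here refl) = ≤-trans (m≤m+n _ _) (≤-trans (n≤1+n _) (≤-reflexive (sym (size-∷ A x xs))))
∈⇒size≤ A (x ∷ xs) (there x∈)  = ≤-trans (∈⇒size≤ A xs x∈)
  (≤-trans (m≤n+m _ (size A x)) (≤-trans (n≤1+n _) (≤-reflexive (sym (size-∷ A x xs)))))

size-↭ : ∀ A {xs ys} → xs ↭ ys → size (list A) xs ≡ size (list A) ys
size-↭ A p = cong suc (∑-↭ (λ x → suc (size A x)) p)

size-++ : ∀ A xs ys → size (list A) (xs ++ ys) ≤ size (list A) xs + size (list A) ys
size-++ A xs ys = s≤s (≤-trans (≤-reflexive (∑-++ xs ys _)) (+-monoʳ-≤ (∑ xs _) (n≤1+n _)))

size-list≤ : ∀ A M xs → (∀ {x} → x ∈ xs → size A x ≤ M) → size (list A) xs ≤ 1 + length xs * suc M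
size-list≤ A M xs ≤M = s≤s (≤-trans (∑-mono xs (λ x∈ → s≤s (≤M x∈))) (≤-reflexive (∑-const xs (suc M))))

-- List programs

notᴾ : ∀ {Γ} → Γ ⊩ bool → Γ ⊩ bool
notᴾ s = recast (ifᴾ s falseᴾ trueᴾ) (λ ρ → not (fn s ρ)) (λ ρ → eq (fn s ρ))
  where
  eq : ∀ b → (if b then false else true) ≡ not b
  eq true  = refl
  eq false = refl

andᴾ : ∀ {Γ} → Γ ⊩ bool → Γ ⊩ bool → Γ ⊩ bool
andᴾ s t = recast (ifᴾ s t falseᴾ) (λ ρ → fn s ρ ∧ fn t ρ) (λ ρ → eq (fn s ρ))
  where
  eq : ∀ b {c} → (if b then c else false) ≡ b ∧ c
  eq true  = refl
  eq false = refl

eqᴾ : ∀ {Γ} → Γ ⊩ nat → Γ ⊩ nat → Γ ⊩ bool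
eqᴾ s t = recast (ifᴾ (leqᴾ s t) (leqᴾ t s) falseᴾ) (λ ρ → fn s ρ ≡ᵇ fn t ρ) (λ ρ → eq (fn s ρ) (fn t ρ))
  where
  eq : ∀ m n → (if m ≤ᵇ n then n ≤ᵇ m else false) ≡ (m ≡ᵇ n)
  eq m n with m ≤ᵇ n in m≤n | n ≤ᵇ m in n≤m
  ... | true  | true rewrite ≤-antisym (≤ᵇ-true {m} m≤n) (≤ᵇ-true n≤m) = sym (≡ᵇ-refl n)
  ... | true  | false = sym (≢⇒≡ᵇ-false {m} {n} λ { refl → <-irrefl refl (≤ᵇ-false {m} n≤m) })
  ... | false | _     = sym (≢⇒≡ᵇ-false {m} {n} λ { refl → <-irrefl refl (≤ᵇ-false {m} m≤n) })

mapᴾ : ∀ {Γ A B} → A ∷ Γ ⊩ B → Γ ⊩ list A → Γ ⊩ list B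
mapᴾ {Γ} {A} {B} f l = recast
  (foldᴾ (consᴾ (wk₁ f) v1) nilᴾ l (κ 1 ⊞ X ⊠ (κ 1 ⊞ bd f)) bound)
  (λ ρ → map (λ x → fn f (x ∷ ρ)) (fn l ρ)) (λ ρ → foldr-map ρ (fn l ρ))
  where
  foldr-map : ∀ ρ (xs : List ⟦ A ⟧) → foldr (λ x y → fn f (x ∷ ρ) ∷ y) [] xs ≡ map (λ x → fn f (x ∷ ρ)) xs
  foldr-map ρ []       = refl
  foldr-map ρ (x ∷ xs) = cong (_ ∷_) (foldr-map ρ xs)
  bound : ∀ ρ ys → size (list B) (foldr (λ x y → fn f (x ∷ ρ) ∷ y) [] ys) ≤
                   ⟪ κ 1 ⊞ X ⊠ (κ 1 ⊞ bd f) ⟫ (sizeEnv ρ + size (list A) ys)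
  bound ρ ys = begin
    size (list B) (foldr (λ x y → fn f (x ∷ ρ) ∷ y) [] ys)  ≡⟨ cong (size (list B)) (foldr-map ρ ys) ⟩
    size (list B) (map (λ x → fn f (x ∷ ρ)) ys)             ≤⟨ size-list≤ B M (map (λ x → fn f (x ∷ ρ)) ys) each ⟩
    1 + length (map (λ x → fn f (x ∷ ρ)) ys) * suc M        ≡⟨ cong (λ n → 1 + n * suc M) (length-map _ ys) ⟩
    1 + length ys * suc M  ≤⟨ s≤s (*-monoˡ-≤ (suc M) (≤-trans (length≤size A ys) (m≤n+m _ (sizeEnv ρ)))) ⟩
    1 + (sizeEnv ρ + size (list A) ys) * suc M              ∎
    where
    open ≤-Reasoning
    M = ⟪ bd f ⟫ (sizeEnv ρ + size (list A) ys)
    each : ∀ {z} → z ∈ map (λ x → fn f (x ∷ ρ)) ys → size B z ≤ M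
    each z∈ with ∈-map⁻ (λ x → fn f (x ∷ ρ)) z∈
    ... | x , x∈ , refl = ≤-trans (size≤ f (x ∷ ρ)) (⟪⟫-mono (bd f)
      (≤-trans (+-monoˡ-≤ (sizeEnv ρ) (∈⇒size≤ A ys x∈)) (≤-reflexive (+-comm (size (list A) ys) _))))

filterᴾ : ∀ {Γ A} → A ∷ Γ ⊩ bool → Γ ⊩ list A → Γ ⊩ list A
filterᴾ {Γ} {A} p l = recast
  (foldᴾ (ifᴾ (wk₁ p) (consᴾ v0 v1) v1) nilᴾ l X bound)
  (λ ρ → filterᵇ (λ x → fn p (x ∷ ρ)) (fn l ρ)) (λ ρ → foldr-filter (λ x → fn p (x ∷ ρ)) (fn l ρ))
  where
  foldr-filter : ∀ (q : ⟦ A ⟧ → Bool) xs → foldr (λ x y → if q x then x ∷ y else y) [] xs ≡ filterᵇ q xs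
  foldr-filter q []       = refl
  foldr-filter q (x ∷ xs) with q x
  ... | true  = cong (x ∷_) (foldr-filter q xs)
  ... | false = foldr-filter q xs
  bound : ∀ ρ ys → size (list A) (foldr (λ x y → if fn p (x ∷ ρ) then x ∷ y else y) [] ys) ≤
                   sizeEnv ρ + size (list A) ys
  bound ρ ys = ≤-trans (≤-reflexive (cong (size (list A)) (foldr-filter (λ x → fn p (x ∷ ρ)) ys)))
    (≤-trans (s≤s (≤-trans (≤-reflexive (∑-filter (λ x → fn p (x ∷ ρ)) ys _))
                           (∑-mono ys (λ {x} _ → []∙-≤ (fn p (x ∷ ρ)) _))))
             (m≤n+m _ (sizeEnv ρ)))

sumᴾ : ∀ {Γ} → Γ ⊩ list nat → Γ ⊩ nat
sumᴾ l = foldᴾ (addᴾ v0 v1) (litᴾ 0) l X λ ρ ys → ≤-trans (bound ys) (m≤n+m _ (sizeEnv ρ))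
  where
  bound : ∀ ys → bitLength (sum ys) ≤ size (list nat) ys
  bound []       = ≤-refl
  bound (y ∷ ys) = ≤-trans (bitLength-+ y (sum ys)) (≤-trans (+-monoʳ-≤ (bitLength y) (bound ys))
    (≤-trans (n≤1+n _) (≤-reflexive (sym (size-∷ nat y ys)))))

appendᴾ : ∀ {Γ A} → Γ ⊩ list A → Γ ⊩ list A → Γ ⊩ list A
appendᴾ {Γ} {A} s t = recast
  (foldᴾ (consᴾ v0 v1) t s (X ⊞ bd t) bound) (λ ρ → fn s ρ ++ fn t ρ) (λ ρ → foldr-++ (fn s ρ) (fn t ρ))
  where
  foldr-++ : ∀ (xs ys : List ⟦ A ⟧) → foldr _∷_ ys xs ≡ xs ++ ys
  foldr-++ []       ys = refl
  foldr-++ (x ∷ xs) ys = cong (x ∷_) (foldr-++ xs ys)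
  bound : ∀ ρ ys → size (list A) (foldr _∷_ (fn t ρ) ys) ≤ ⟪ X ⊞ bd t ⟫ (sizeEnv ρ + size (list A) ys)
  bound ρ ys = ≤-trans (≤-reflexive (cong (size (list A)) (foldr-++ ys (fn t ρ))))
    (≤-trans (size-++ A ys (fn t ρ))
      (+-mono-≤ (m≤n+m _ (sizeEnv ρ)) (≤-trans (size≤ t ρ) (⟪⟫-mono (bd t) (m≤m+n _ _)))))

concatᴾ : ∀ {Γ A} → Γ ⊩ list (list A) → Γ ⊩ list A
concatᴾ {Γ} {A} l = foldᴾ (appendᴾ v0 v1) nilᴾ l X λ ρ ys → ≤-trans (bound ys) (m≤n+m _ (sizeEnv ρ))
  where
  bound : ∀ ys → size (list A) (concat ys) ≤ size (list (list A)) ys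
  bound []       = ≤-refl
  bound (y ∷ ys) = ≤-trans (size-++ A y (concat ys)) (≤-trans (+-monoʳ-≤ (size (list A) y) (bound ys))
    (≤-trans (n≤1+n _) (≤-reflexive (sym (size-∷ (list A) y ys)))))

concatMapᴾ : ∀ {Γ A B} → A ∷ Γ ⊩ list B → Γ ⊩ list A → Γ ⊩ list B
concatMapᴾ f l = concatᴾ (mapᴾ f l)

anyᴾ : ∀ {Γ A} → A ∷ Γ ⊩ bool → Γ ⊩ list A → Γ ⊩ bool
anyᴾ {Γ} {A} p l = recast (foldᴾ (ifᴾ (wk₁ p) trueᴾ v1) falseᴾ l (κ 1) (λ _ _ → ≤-refl))
  (λ ρ → any (λ x → fn p (x ∷ ρ)) (fn l ρ)) (λ ρ → foldr-any (λ x → fn p (x ∷ ρ)) (fn l ρ))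
  where
  foldr-any : ∀ (q : ⟦ A ⟧ → Bool) xs → foldr (λ x y → if q x then true else y) false xs ≡ any q xs
  foldr-any q []       = refl
  foldr-any q (x ∷ xs) with q x
  ... | true  = refl
  ... | false = foldr-any q xs

lengthᴾ : ∀ {Γ A} → Γ ⊩ list A → Γ ⊩ nat
lengthᴾ {Γ} {A} l = foldᴾ (addᴾ (litᴾ 1) v1) (litᴾ 0) l (κ 1 ⊞ X) λ ρ ys →
  ≤-trans (bitLength-≤-suc (length ys)) (s≤s (≤-trans (length≤size A ys) (m≤n+m _ (sizeEnv ρ))))

maxᴾ : ∀ {Γ} → Γ ⊩ list nat → Γ ⊩ nat
maxᴾ l = recast (foldᴾ (ifᴾ (leqᴾ v0 v1) v1 v0) (litᴾ 0) l X λ ρ ys → ≤-trans (bound ys) (m≤n+m _ (sizeEnv ρ)))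
  (λ ρ → foldr _⊔_ 0 (fn l ρ)) (λ ρ → foldr-⊔ (fn l ρ))
  where
  larger : ℕ → ℕ → ℕ
  larger m n = if m ≤ᵇ n then n else m
  larger≡⊔ : ∀ m n → larger m n ≡ m ⊔ n
  larger≡⊔ m n with m ≤ᵇ n in m≤n
  ... | true  = sym (m≤n⇒m⊔n≡n (≤ᵇ-true m≤n))
  ... | false = sym (m≥n⇒m⊔n≡m (<⇒≤ (≤ᵇ-false m≤n)))
  foldr-⊔ : ∀ xs → foldr larger 0 xs ≡ foldr _⊔_ 0 xs
  foldr-⊔ []       = refl
  foldr-⊔ (x ∷ xs) = trans (larger≡⊔ x _) (cong (x ⊔_) (foldr-⊔ xs))
  bound : ∀ ys → bitLength (foldr larger 0 ys) ≤ size (list nat) ys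
  bound []       = ≤-refl
  bound (y ∷ ys) with y ≤ᵇ foldr larger 0 ys
  ... | true  = ≤-trans (bound ys) (≤-trans (≤-trans (m≤n+m _ (bitLength y)) (n≤1+n _)) (≤-reflexive (sym (size-∷ nat y ys))))
  ... | false = ∈⇒size≤ nat (y ∷ ys) (here refl)

smaller : ℕ → ℕ → ℕ
smaller m n = if m ≤ᵇ n then m else n

minᴾ : ∀ {Γ} → Γ ⊩ nat → Γ ⊩ list nat → Γ ⊩ nat
minᴾ b l = foldᴾ (ifᴾ (leqᴾ v0 v1) v0 v1) b l (X ⊞ bd b) λ ρ ys →
  ≤-trans (bound (fn b ρ) ys) (+-mono-≤ (m≤n+m _ (sizeEnv ρ)) (≤-trans (size≤ b ρ) (⟪⟫-mono (bd b) (m≤m+n _ _))))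
  where
  bound : ∀ c ys → bitLength (foldr smaller c ys) ≤ size (list nat) ys + bitLength c
  bound c []       = n≤1+n _
  bound c (y ∷ ys) with y ≤ᵇ foldr smaller c ys
  ... | true  = ≤-trans (∈⇒size≤ nat (y ∷ ys) (here refl)) (m≤m+n _ _)
  ... | false = ≤-trans (bound c ys) (+-monoˡ-≤ (bitLength c)
                  (≤-trans (≤-trans (m≤n+m _ (bitLength y)) (n≤1+n _)) (≤-reflexive (sym (size-∷ nat y ys)))))

reify : ∀ {Γ} A (x : ⟦ A ⟧) → Σ[ p ∈ Γ ⊩ A ] (∀ ρ → fn p ρ ≡ x)
reify bool     true     = trueᴾ , λ _ → refl
reify bool     false    = falseᴾ , λ _ → refl
reify nat      n        = litᴾ n , λ _ → refl
reify (A ⊗ B)  (x , y)  with reify A x | reify B y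
... | p , p≡ | q , q≡ = pairᴾ p q , λ ρ → cong₂ _,_ (p≡ ρ) (q≡ ρ)
reify (list A) []       = nilᴾ , λ _ → refl
reify (list A) (x ∷ xs) with reify A x | reify (list A) xs
... | p , p≡ | q , q≡ = consᴾ p q , λ ρ → cong₂ _∷_ (p≡ ρ) (q≡ ρ)

constᴾ : ∀ {Γ} A → ⟦ A ⟧ → Γ ⊩ A
constᴾ A x = recast (proj₁ (reify A x)) (λ _ → x) (proj₂ (reify A x))

-- Loops run over lists only, so an initial segment of the naturals is produced from a list of the
-- desired length.
iota : {A : Set} → List A → List ℕ
iota = foldr (λ _ ns → 0 ∷ map suc ns) []

iota≡upTo : {A : Set} (xs : List A) → iota xs ≡ upTo (length xs)
iota≡upTo []       = refl
iota≡upTo (x ∷ xs) = cong (0 ∷_) (trans (cong (map suc) (iota≡upTo xs)) (map-upTo suc (length xs)))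

iotaᴾ : ∀ {Γ A} → Γ ⊩ list A → Γ ⊩ list nat
iotaᴾ {Γ} {A} l = foldᴾ (consᴾ (litᴾ 0) (mapᴾ (addᴾ (litᴾ 1) v0) v1)) nilᴾ l (κ 1 ⊞ X ⊠ (κ 2 ⊞ X)) bound
  where
  bound : ∀ ρ ys → size (list nat) (iota ys) ≤ ⟪ κ 1 ⊞ X ⊠ (κ 2 ⊞ X) ⟫ (sizeEnv ρ + size (list A) ys)
  bound ρ ys = begin
    size (list nat) (iota ys)               ≡⟨ cong (size (list nat)) (iota≡upTo ys) ⟩
    size (list nat) (upTo n)                ≤⟨ size-list≤ nat (suc n) (upTo n) (λ x∈ →
                                                 ≤-trans (bitLength-≤-suc _) (m≤n⇒m≤1+n (∈-upTo⁻ x∈))) ⟩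
    1 + length (upTo n) * (2 + n)           ≡⟨ cong (λ m → 1 + m * (2 + n)) (length-upTo n) ⟩
    1 + n * (2 + n)                         ≤⟨ s≤s (*-mono-≤ n≤ (+-monoʳ-≤ 2 n≤)) ⟩
    _                                       ∎
    where
    open ≤-Reasoning
    n = length ys
    n≤ : n ≤ sizeEnv ρ + size (list A) ys
    n≤ = ≤-trans (length≤size A ys) (m≤n+m _ (sizeEnv ρ))

extractᴾ : ∀ {Γ A} → A ∷ Γ ⊩ bool → Γ ⊩ list A → Γ ⊩ list A ⊗ list A
extractᴾ {Γ} {A} p l = foldᴾ
  (unconsᴾ (fstᴾ v1)
    (ifᴾ (wk₁ p) (pairᴾ (consᴾ v0 nilᴾ) (sndᴾ v1)) (pairᴾ nilᴾ (consᴾ v0 (sndᴾ v1))))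
    (pairᴾ (fstᴾ v3) (consᴾ v2 (sndᴾ v3))))
  (pairᴾ nilᴾ nilᴾ) l (κ 1 ⊞ X)
  λ ρ ys → ≤-trans (bound (extracted (λ x → fn p (x ∷ ρ)) ys)) (s≤s (m≤n+m _ (sizeEnv ρ)))
  where
  bound : ∀ {q ys e} → Extracted q ys e → size (list A ⊗ list A) e ≤ 1 + size (list A) ys
  bound (none _)         = ≤-refl
  bound {ys = ys} (one {y} {zs} _ perm) = ≤-reflexive (begin
    suc (suc (size A y + 0) + size (list A) zs)  ≡⟨ cong (λ n → suc (suc n + size (list A) zs)) (+-identityʳ (size A y)) ⟩
    suc (suc (size A y + size (list A) zs))      ≡⟨ cong suc (size-∷ A y zs) ⟨
    suc (size (list A) (y ∷ zs))                 ≡⟨ cong suc (size-↭ A perm) ⟨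
    suc (size (list A) ys)                       ∎)
    where open ≡-Reasoning

-- Sorting jobs by descending time

insertJob : Job → List Job → List Job
insertJob x = foldr (λ y r → if time x ≤ᵇ time y then y ∷ r else unconsᴸ r [] (λ h t → h ∷ y ∷ t)) (x ∷ [])

sort : List Job → List Job
sort = foldr insertJob []

insertJob-↭ : ∀ x ys → insertJob x ys ↭ x ∷ ys
insertJob-↭ x []       = ↭-refl
insertJob-↭ x (y ∷ ys) with time x ≤ᵇ time y | insertJob x ys | insertJob-↭ x ys
... | true  | r     | p = ↭-trans (↭-prep y p) (↭-swap y x ↭-refl)
... | false | h ∷ t | p = ↭-trans (↭-swap h y ↭-refl) (↭-trans (↭-prep y p) (↭-swap y x ↭-refl))
... | false | []    | p = contradiction (↭-length p) λ ()

sort-↭ : ∀ xs → sort xs ↭ xs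
sort-↭ []       = ↭-refl
sort-↭ (x ∷ xs) = ↭-trans (insertJob-↭ x (sort xs)) (↭-prep x (sort-↭ xs))

-- Explains the second branch of `insertJob`: a fold sees the result for the tail but not the tail.
-- In that branch the result is `x ∷ ys`, as all of a descending `ys` is shorter than `x`, so it is
-- enough to put `y` behind its head.
insertJob-last : ∀ x ys → All (λ y → time y < time x) ys → insertJob x ys ≡ x ∷ ys
insertJob-last x []       []         = refl
insertJob-last x (y ∷ ys) (y< ∷ ys<) with time x ≤ᵇ time y in le
... | true  = contradiction (≤ᵇ-true {time x} le) (<⇒≱ y<)
... | false rewrite insertJob-last x ys ys< = refl

insertJob-descending : ∀ x ys → AllPairs (λ i j → time j ≤ time i) ys →
                       AllPairs (λ i j → time j ≤ time i) (insertJob x ys)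
insertJob-descending x []       []         = [] ∷ []
insertJob-descending x (y ∷ ys) (y≥ ∷ desc) with time x ≤ᵇ time y in le
... | true  = All-resp-↭ (↭-sym (insertJob-↭ x ys)) (≤ᵇ-true {time x} le ∷ y≥) ∷ insertJob-descending x ys desc
... | false rewrite insertJob-last x ys (All.map (λ z≤y → ≤-<-trans z≤y (≤ᵇ-false {time x} le)) y≥) =
  (<⇒≤ (≤ᵇ-false {time x} le) ∷ All.map (λ z≤y → ≤-trans z≤y (<⇒≤ (≤ᵇ-false {time x} le))) y≥) ∷ y≥ ∷ desc

sort-descending : ∀ xs → AllPairs (λ i j → time j ≤ time i) (sort xs)
sort-descending []       = []
sort-descending (x ∷ xs) = insertJob-descending x (sort xs) (sort-descending xs)

-- The algorithm as a function on lists

prefers : List (Job × Machine) → Machine → Job → Bool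
prefers tab i j = any (λ e → eqJob (proj₁ e) j ∧ (proj₂ e ≡ᵇ i)) tab

copies : {A : Set} → ℕ → List A → List A
copies zero    xs = []
copies (suc k) xs = xs ++ copies k xs

length-copies : {A : Set} (k : ℕ) (xs : List A) → length (copies k xs) ≡ k * length xs
length-copies zero    xs = refl
length-copies (suc k) xs = trans (length-++ xs) (cong (length xs +_) (length-copies k xs))

head₀ : List ℕ → ℕ
head₀ ms = unconsᴸ ms 0 (λ m _ → m)

-- The membership test and the default `head₀ ms` yield an assignment even if `as` stems from a
-- guess for which the construction failed.
assign : List Machine → Placed → Job → Machine
assign ms as j = foldr (λ e m → if eqJob (proj₁ e) j ∧ any (λ m′ → m′ ≡ᵇ proj₂ e) ms then proj₂ e else m) (head₀ ms) as

span : List Machine → List (Job × Machine) → ℕ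
span ms tab = foldr _⊔_ 0 (map (λ i → ∑ tab (λ e → if proj₂ e ≡ᵇ i then time (proj₁ e) else 0)) ms)

module Algorithms (E : ℕ) where

  open Rounding E
  open Scheme E

  -- A list longer than the number of jobs and than `E` times the number of machines, hence than any
  -- multiplicity that occurs. Its length is the base `W`, and `iota` turns it into the list of
  -- digits.
  digitSource : List Machine → List Job → List ℕ
  digitSource ms js = 0 ∷ (map (λ _ → 0) js ++ copies E ms)

  -- Candidates for `U = E * T` are multiples of the longest time. The extra list entry admits the
  -- factor `E * length js`, at which `U` is at least `E` times any makespan.
  units : List Job → List ℕ
  units js = map (λ k → k * foldr _⊔_ 0 (map proj₂ js)) (iota (0 ∷ map proj₁ (copies E js)))

  -- Abstract, as it is infeasible to compare terms by unfolding these.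
  abstract
    schedule : ℕ → List (Job × Machine) → List Machine → List Job → Placed
    schedule U tab ms js =
      complete U (sort js) (selected (length (digitSource ms js)) U
        (keysOf (length (digitSource ms js)) (iota (digitSource ms js)) (suc N)) (prefers tab) ms (sort js))

    schedule≡ : ∀ U tab ms js → schedule U tab ms js ≡
      complete U (sort js) (selected (length (digitSource ms js)) U
        (keysOf (length (digitSource ms js)) (iota (digitSource ms js)) (suc N)) (prefers tab) ms (sort js))
    schedule≡ U tab ms js = refl

    rounded : ℕ → List (Job × Machine) → List Machine → List Job → List (Job × Machine)
    rounded U tab ms js = map (λ j → j , assign ms (schedule U tab ms js) j) js

    rounded≡ : ∀ U tab ms js → rounded U tab ms js ≡ map (λ j → j , assign ms (schedule U tab ms js) j) js
    rounded≡ U tab ms js = refl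

    guess : List (Job × Machine) → List Machine → List Job → ℕ
    guess tab ms js =
      foldr smaller (span ms (rounded 0 tab ms js)) (map (λ U → span ms (rounded U tab ms js)) (units js))

    guess≡ : ∀ tab ms js → guess tab ms js ≡
      foldr smaller (span ms (rounded 0 tab ms js)) (map (λ U → span ms (rounded U tab ms js)) (units js))
    guess≡ tab ms js = refl

-- Programs for sorting, assigning and selecting

insertJobᴾ : ∀ {Γ} → Γ ⊩ jobTy → Γ ⊩ list jobTy → Γ ⊩ list jobTy
insertJobᴾ x l = foldᴾ
  (ifᴾ (leqᴾ (sndᴾ (wk (wk x))) (sndᴾ v0)) (consᴾ v0 v1) (unconsᴾ v1 nilᴾ (consᴾ v0 (consᴾ v2 v1))))
  (consᴾ x nilᴾ) l (κ 1 ⊞ bd x ⊞ X)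
  λ ρ ys → begin
    size (list jobTy) (insertJob (fn x ρ) ys)          ≡⟨ size-↭ jobTy (insertJob-↭ (fn x ρ) ys) ⟩
    size (list jobTy) (fn x ρ ∷ ys)                    ≡⟨ size-∷ jobTy (fn x ρ) ys ⟩
    suc (size jobTy (fn x ρ) + size (list jobTy) ys)
      ≤⟨ s≤s (+-mono-≤ (≤-trans (size≤ x ρ) (⟪⟫-mono (bd x) (m≤m+n _ _))) (m≤n+m _ (sizeEnv ρ))) ⟩
    _ ∎
  where open ≤-Reasoning

sortᴾ : ∀ {Γ} → Γ ⊩ list jobTy → Γ ⊩ list jobTy
sortᴾ l = foldᴾ (insertJobᴾ v0 v1) nilᴾ l X λ ρ ys →
  ≤-trans (≤-reflexive (size-↭ jobTy (sort-↭ ys))) (m≤n+m _ (sizeEnv ρ))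

eqJobᴾ : ∀ {Γ} → Γ ⊩ jobTy → Γ ⊩ jobTy → Γ ⊩ bool
eqJobᴾ i j = andᴾ (eqᴾ (fstᴾ i) (fstᴾ j)) (eqᴾ (sndᴾ i) (sndᴾ j))

prefersᴾ : ∀ {Γ} → Γ ⊩ tableTy → Γ ⊩ nat → Γ ⊩ jobTy → Γ ⊩ bool
prefersᴾ tab i j = anyᴾ (andᴾ (eqJobᴾ (fstᴾ v0) (wk j)) (eqᴾ (sndᴾ v0) (wk i))) tab

copiesᴾ : ∀ {Γ A} → ℕ → Γ ⊩ list A → Γ ⊩ list A
copiesᴾ {Γ} {A} k l = recast (go k) (λ ρ → copies k (fn l ρ)) (go≡ k)
  where
  go : ℕ → Γ ⊩ list A
  go zero    = nilᴾ
  go (suc k) = appendᴾ l (go k)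
  go≡ : ∀ k ρ → fn (go k) ρ ≡ copies k (fn l ρ)
  go≡ zero    ρ = refl
  go≡ (suc k) ρ = cong (fn l ρ ++_) (go≡ k ρ)

assignᴾ : ∀ {Γ} → Γ ⊩ list nat → Γ ⊩ tableTy → Γ ⊩ jobTy → Γ ⊩ nat
assignᴾ ms as j = foldᴾ
  (ifᴾ (andᴾ (eqJobᴾ (fstᴾ v0) (wk (wk j))) (anyᴾ (eqᴾ v0 (sndᴾ v1)) (wk (wk ms)))) (sndᴾ v0) v1)
  base as (X ⊞ bd base)
  λ ρ ys → ≤-trans (bound (fn ms ρ) (fn j ρ) ys)
    (+-mono-≤ (m≤n+m _ (sizeEnv ρ)) (≤-trans (size≤ base ρ) (⟪⟫-mono (bd base) (m≤m+n _ _))))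
  where
  base = unconsᴾ ms (litᴾ 0) v0
  bound : ∀ ms j ys → bitLength (assign ms ys j) ≤ size tableTy ys + bitLength (head₀ ms)
  bound ms j []       = n≤1+n _
  bound ms j (e ∷ ys) with eqJob (proj₁ e) j ∧ any (λ m′ → m′ ≡ᵇ proj₂ e) ms
  ... | true  = ≤-trans (≤-trans (m≤n+m _ (size jobTy (proj₁ e))) (∈⇒size≤ (jobTy ⊗ nat) (e ∷ ys) (here refl))) (m≤m+n _ _)
  ... | false = ≤-trans (bound ms j ys) (+-monoˡ-≤ (bitLength (head₀ ms))
                  (≤-trans (≤-trans (m≤n+m _ (size (jobTy ⊗ nat) e)) (n≤1+n _)) (≤-reflexive (sym (size-∷ (jobTy ⊗ nat) e ys)))))

spanᴾ : ∀ {Γ} → Γ ⊩ list nat → Γ ⊩ tableTy → Γ ⊩ nat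
spanᴾ ms tab = maxᴾ (mapᴾ (sumᴾ (mapᴾ (ifᴾ (eqᴾ (sndᴾ v0) v1) (sndᴾ (fstᴾ v0)) (litᴾ 0)) (wk tab))) ms)

countᴾ : ∀ {Γ} → ℕ → Γ ⊩ list nat → Γ ⊩ nat
countᴾ c l = sumᴾ (mapᴾ (ifᴾ (eqᴾ v0 (litᴾ c)) (litᴾ 1) (litᴾ 0)) l)

keyᴾ : ∀ {Γ} → Γ ⊩ nat → ℕ → ℕ → Γ ⊩ list nat → Γ ⊩ nat
keyᴾ {Γ} W d c l = recast (go d c) (λ ρ → key (fn W ρ) d c (fn l ρ)) (go≡ d c)
  where
  go : ℕ → ℕ → Γ ⊩ nat
  go zero    c = litᴾ 0
  go (suc d) c = addᴾ (countᴾ c l) (mulᴾ W (go d (suc c)))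
  go≡ : ∀ d c ρ → fn (go d c) ρ ≡ key (fn W ρ) d c (fn l ρ)
  go≡ zero    c ρ = refl
  go≡ (suc d) c ρ = cong (λ n → count c (fn l ρ) + fn W ρ * n) (go≡ d (suc c) ρ)

keysOfᴾ : ∀ {Γ} → Γ ⊩ nat → Γ ⊩ list nat → ℕ → Γ ⊩ list nat
keysOfᴾ {Γ} W ds d = recast (go d) (λ ρ → keysOf (fn W ρ) (fn ds ρ) d) (go≡ d)
  where
  go : ℕ → Γ ⊩ list nat
  go zero    = consᴾ (litᴾ 0) nilᴾ
  go (suc d) = concatMapᴾ (mapᴾ (addᴾ v0 (mulᴾ (wk (wk W)) v1)) (wk ds)) (go d)
  go≡ : ∀ d ρ → fn (go d) ρ ≡ keysOf (fn W ρ) (fn ds ρ) d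
  go≡ zero    ρ = refl
  go≡ (suc d) ρ = cong (concatMap (λ k → map (λ a → a + fn W ρ * k) (fn ds ρ))) (go≡ d ρ)

resourceTy stageTy stateTy : Ty
resourceTy = nat ⊗ bool ⊗ nat
stageTy    = tableTy ⊗ list resourceTy
stateTy    = nat ⊗ stageTy

emptyᴾ : ∀ {Γ} → Γ ⊩ stateTy
emptyᴾ = pairᴾ (litᴾ 0) (pairᴾ nilᴾ nilᴾ)

combineᴾ : ∀ {Γ} → Γ ⊩ stateTy → Γ ⊩ stateTy → Γ ⊩ stateTy
combineᴾ s o = pairᴾ (addᴾ (fstᴾ s) (fstᴾ o))
  (pairᴾ (appendᴾ (fstᴾ (sndᴾ s)) (fstᴾ (sndᴾ o))) (appendᴾ (sndᴾ (sndᴾ s)) (sndᴾ (sndᴾ o))))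

combine-size : ∀ s o → size stateTy (combine s o) ≤ size stateTy s + size stateTy o
combine-size (k , as , rs) (k′ , as′ , rs′) = ≤-trans
  (+-mono-≤ (bitLength-+ k k′) (+-mono-≤ (size-++ (jobTy ⊗ nat) as as′) (size-++ resourceTy rs rs′)))
  (≤-reflexive (solve 6 (λ a b c d e f → a :+ b :+ (c :+ d :+ (e :+ f)) := a :+ (c :+ e) :+ (b :+ (d :+ f))) refl
    (bitLength k) (bitLength k′) (size tableTy as) (size tableTy as′)
    (size (list resourceTy) rs) (size (list resourceTy) rs′)))

bestᴾ : ∀ {Γ} → Γ ⊩ nat → Γ ⊩ list stateTy → Γ ⊩ list stateTy
bestᴾ k l = foldᴾ
  (ifᴾ (eqᴾ (fstᴾ v0) (wk (wk k)))
    (unconsᴾ v1 (consᴾ v0 nilᴾ)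
      (ifᴾ (leqᴾ (lengthᴾ (fstᴾ (sndᴾ v2))) (lengthᴾ (fstᴾ (sndᴾ v0)))) v3 (consᴾ v2 nilᴾ)))
    v1)
  nilᴾ l (κ 2 ⊞ X)
  λ ρ ys → ≤-trans (bound (best-best (fn k ρ) ys)) (s≤s (s≤s (m≤n+m _ (sizeEnv ρ))))
  where
  bound : ∀ {k ys b} → Best k ys b → size (list stateTy) b ≤ 2 + size (list stateTy) ys
  bound (none _)        = s≤s z≤n
  bound {ys = ys} (some {t} t∈ _ _) =
    s≤s (≤-trans (≤-reflexive (+-identityʳ _)) (s≤s (∈⇒size≤ stateTy ys t∈)))

pruneᴾ : ∀ {Γ} → Γ ⊩ list nat → Γ ⊩ list stateTy → Γ ⊩ list stateTy
pruneᴾ ks l = concatMapᴾ (bestᴾ v0 (wk l)) ks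

-- A state joins one option per machine, so its size is bounded by a sum over the machines rather
-- than by a product.
select-size : ∀ ks os {s} → s ∈ select ks os → size stateTy s ≤ 3 + size (list (list stateTy)) os
select-size ks []       (here refl) = m≤m+n 3 1
select-size ks (o ∷ os) s∈
  with find (∈-concatMap⁻ (λ s → map (combine s) o) {xs = select ks os}
         (prune⊆ ks (concatMap (λ s → map (combine s) o) (select ks os)) s∈))
... | s , s∈′ , s∈map with ∈-map⁻ (combine s) s∈map
...   | t , t∈ , refl = begin
  size stateTy (combine s t)               ≤⟨ combine-size s t ⟩
  size stateTy s + size stateTy t          ≤⟨ +-mono-≤ (select-size ks os s∈′) (∈⇒size≤ stateTy o t∈) ⟩
  3 + O + size (list stateTy) o            ≡⟨ cong (3 +_) (+-comm O _) ⟩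
  3 + (size (list stateTy) o + O)          ≤⟨ +-monoʳ-≤ 3 (n≤1+n _) ⟩
  3 + suc (size (list stateTy) o + O)      ≡⟨ cong (3 +_) (size-∷ (list stateTy) o os) ⟨
  3 + size (list (list stateTy)) (o ∷ os)  ∎
  where
  open ≤-Reasoning
  O = size (list (list stateTy)) os

select-length : ∀ ks os → length (select ks os) ≤ suc (length ks)
select-length ks []       = s≤s z≤n
select-length ks (o ∷ os) = m≤n⇒m≤1+n (begin
  length (prune ks ss)                 ≡⟨ length-∑ (prune ks ss) ⟩
  ∑ (prune ks ss) (λ _ → 1)            ≡⟨ ∑-concatMap (λ k → best k ss) ks _ ⟩
  ∑ ks (λ k → ∑ (best k ss) (λ _ → 1)) ≤⟨ ∑-≤-length ks (λ k → at-most-one (best-best k ss)) ⟩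
  length ks                            ∎)
  where
  open ≤-Reasoning
  ss = concatMap (λ s → map (combine s) o) (select ks os)
  at-most-one : ∀ {k ys b} → Best k ys b → ∑ b (λ _ → 1) ≤ 1
  at-most-one (none _)     = z≤n
  at-most-one (some _ _ _) = ≤-refl

selectᴾ : ∀ {Γ} → Γ ⊩ list nat → Γ ⊩ list (list stateTy) → Γ ⊩ list stateTy
selectᴾ ks l = foldᴾ
  (pruneᴾ (wk (wk ks)) (concatMapᴾ (mapᴾ (combineᴾ v1 v0) v1) v1))
  (consᴾ emptyᴾ nilᴾ) l (κ 1 ⊞ (κ 1 ⊞ bd ks) ⊠ (κ 4 ⊞ X))
  λ ρ ys → ≤-trans (size-list≤ stateTy _ (select (fn ks ρ) ys) (select-size (fn ks ρ) ys))
    (s≤s (*-mono-≤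
      (≤-trans (select-length (fn ks ρ) ys) (s≤s (≤-trans (length≤size nat (fn ks ρ))
        (≤-trans (size≤ ks ρ) (⟪⟫-mono (bd ks) (m≤m+n _ _))))))
      (+-monoʳ-≤ 4 (m≤n+m _ (sizeEnv ρ)))))

-- The complete program

module Programs (E : ℕ) where

  open Rounding E
  open Scheme E
  open Algorithms E

  wᴾ : ∀ {Γ} → Γ ⊩ jobTy → Γ ⊩ nat
  wᴾ j = mulᴾ (litᴾ S) (sndᴾ j)

  bigᴾ : ∀ {Γ} → Γ ⊩ nat → Γ ⊩ jobTy → Γ ⊩ bool
  bigᴾ U j = notᴾ (leqᴾ (wᴾ j) (mulᴾ (litᴾ E) U))

  clsᴾ : ∀ {Γ} → Γ ⊩ nat → Γ ⊩ jobTy → Γ ⊩ nat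
  clsᴾ U j = sumᴾ (mapᴾ (ifᴾ (leqᴾ (mulᴾ v0 (wk U)) (wᴾ (wk j))) (litᴾ 1) (litᴾ 0)) (constᴾ (list nat) (levels N)))

  matchesᴾ : ∀ {Γ} → Γ ⊩ nat → Γ ⊩ jobTy → Γ ⊩ resourceTy → Γ ⊩ bool
  matchesᴾ U j r = ifᴾ (bigᴾ U j)
    (ifᴾ (fstᴾ (sndᴾ r)) (eqᴾ (sndᴾ (sndᴾ r)) (clsᴾ U j)) falseᴾ)
    (ifᴾ (fstᴾ (sndᴾ r)) falseᴾ (leqᴾ (wᴾ j) (sndᴾ (sndᴾ r))))

  -- Resources are used up or shrink. A new table entry repeats a job and takes its machine name
  -- from a resource, so each job adds at most its own size and that of `rs`.
  place-size : ∀ U rs js → size (list resourceTy) (proj₂ (place U rs js)) ≤ size (list resourceTy) rs ×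
               size tableTy (proj₁ (place U rs js)) ≤
               size (list jobTy) js + length js * size (list resourceTy) rs
  place-size U rs []       = ≤-refl , ≤-refl
  place-size U rs (j ∷ js) with place U rs js | place-size U rs js | place₁-step U j (place U rs js)
  ... | as , rs′ | rs≤ , as≤ | st = step-size st
    where
    open ≤-Reasoning
    R = size (list resourceTy) rs
    n = length js
    K = size (list jobTy) js
    head : ∀ r rest → size resourceTy r + size (list resourceTy) rest ≤ size (list resourceTy) (r ∷ rest)
    head r rest = ≤-trans (n≤1+n _) (≤-reflexive (sym (size-∷ resourceTy r rest)))
    grow : ∀ {i} → bitLength i ≤ R → size tableTy ((j , i) ∷ as) ≤ size (list jobTy) (j ∷ js) + suc n * R
    grow {i} i≤ = begin
      size tableTy ((j , i) ∷ as)              ≡⟨ size-∷ (jobTy ⊗ nat) (j , i) as ⟩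
      suc (size jobTy j + bitLength i + size tableTy as) ≤⟨ s≤s (+-mono-≤ (+-monoʳ-≤ (size jobTy j) i≤) as≤) ⟩
      suc (size jobTy j + R + (K + n * R))     ≡⟨ cong suc (+-interchange (size jobTy j) R K (n * R)) ⟩
      suc (size jobTy j + K) + (R + n * R)     ≡⟨ cong (_+ suc n * R) (size-∷ jobTy j js) ⟨
      size (list jobTy) (j ∷ js) + suc n * R   ∎
    step-size : ∀ {s′} → Step U j (as , rs′) s′ → size (list resourceTy) (proj₂ s′) ≤ R ×
                size tableTy (proj₁ s′) ≤ size (list jobTy) (j ∷ js) + suc n * R
    step-size (skip _) = rs≤ , ≤-trans as≤ (+-mono-≤
      (≤-trans (m≤n+m K (size jobTy j)) (≤-trans (n≤1+n _) (≤-reflexive (sym (size-∷ jobTy j js)))))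
      (m≤n+m (n * R) R))
    step-size (slot {i = i} {rest} _ p) =
      ≤-trans (m≤n+m _ (size resourceTy r)) r+rest≤ ,
      grow {i} (≤-trans (m≤m+n (bitLength i) _) (≤-trans (m≤m+n (size resourceTy r) _) r+rest≤))
      where
      r = i , true , cls U j
      r+rest≤ : size resourceTy r + size (list resourceTy) rest ≤ R
      r+rest≤ = ≤-trans (head r rest) (≤-trans (≤-reflexive (sym (size-↭ resourceTy p))) rs≤)
    step-size (room {i = i} {v} {rest} _ w≤v p) =
      (begin
        size (list resourceTy) ((i , false , v ∸ w j) ∷ rest)
          ≡⟨ size-∷ resourceTy (i , false , v ∸ w j) rest ⟩
        suc (bitLength i + (1 + bitLength (v ∸ w j)) + size (list resourceTy) rest)
          ≤⟨ s≤s (+-monoˡ-≤ _ (+-monoʳ-≤ (bitLength i) (s≤s (bitLength-mono (m∸n≤m v (w j)))))) ⟩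
        suc (size resourceTy r + size (list resourceTy) rest)
          ≡⟨ size-∷ resourceTy r rest ⟨
        size (list resourceTy) (r ∷ rest)  ≤⟨ r∷rest≤ ⟩
        R ∎) ,
      grow {i} (≤-trans (m≤m+n (bitLength i) _) (≤-trans (∈⇒size≤ resourceTy (r ∷ rest) (here refl)) r∷rest≤))
      where
      r = i , false , v
      r∷rest≤ : size (list resourceTy) (r ∷ rest) ≤ R
      r∷rest≤ = ≤-trans (≤-reflexive (sym (size-↭ resourceTy p))) rs≤

  placeᴾ : ∀ {Γ} → Γ ⊩ nat → Γ ⊩ list resourceTy → Γ ⊩ list jobTy → Γ ⊩ stageTy
  placeᴾ {Γ} U rs js = foldᴾ
    (unconsᴾ (fstᴾ found) v1
      (pairᴾ (consᴾ (pairᴾ v2 (fstᴾ v0)) (fstᴾ v3))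
        (ifᴾ (fstᴾ (sndᴾ v0)) (sndᴾ (wk (wk found)))
          (consᴾ (pairᴾ (fstᴾ v0) (pairᴾ falseᴾ (monusᴾ (sndᴾ (sndᴾ v0)) (wᴾ v2)))) (sndᴾ (wk (wk found)))))))
    (pairᴾ nilᴾ rs) js (X ⊞ X ⊠ bd rs ⊞ bd rs) bound
    where
    found : jobTy ∷ stageTy ∷ Γ ⊩ list resourceTy ⊗ list resourceTy
    found = extractᴾ (matchesᴾ (wk (wk (wk U))) v1 v0) (sndᴾ v1)
    bound : ∀ ρ ys → size stageTy (place (fn U ρ) (fn rs ρ) ys) ≤
                     ⟪ X ⊞ X ⊠ bd rs ⊞ bd rs ⟫ (sizeEnv ρ + size (list jobTy) ys)
    bound ρ ys with place-size (fn U ρ) (fn rs ρ) ys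
    ... | rs≤ , as≤ = +-mono-≤ (≤-trans as≤ (+-mono-≤ (m≤n+m _ (sizeEnv ρ))
            (*-mono-≤ (≤-trans (length≤size jobTy ys) (m≤n+m _ (sizeEnv ρ))) size-rs≤)))
          (≤-trans rs≤ size-rs≤)
      where
      size-rs≤ : size (list resourceTy) (fn rs ρ) ≤ ⟪ bd rs ⟫ (sizeEnv ρ + size (list jobTy) ys)
      size-rs≤ = ≤-trans (size≤ rs ρ) (⟪⟫-mono (bd rs) (m≤m+n _ _))

  resourcesᴾ : ∀ {Γ} → Γ ⊩ nat → Γ ⊩ nat → Γ ⊩ list nat → Γ ⊩ list resourceTy
  resourcesᴾ U i x = consᴾ
    (pairᴾ i (pairᴾ falseᴾ (monusᴾ (mulᴾ (litᴾ N) U) (mulᴾ U (sumᴾ x)))))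
    (mapᴾ (pairᴾ (wk i) (pairᴾ trueᴾ v0)) x)

  optionsᴾ : ∀ {Γ} → Γ ⊩ nat → Γ ⊩ nat → Γ ⊩ tableTy → Γ ⊩ list jobTy → Γ ⊩ nat → Γ ⊩ list stateTy
  optionsᴾ W U tab js i = recast
    (mapᴾ
      (pairᴾ (keyᴾ (wk W) (suc N) 0 v0)
        (placeᴾ (wk U) (resourcesᴾ (wk U) (wk i) v0)
          (filterᴾ (prefersᴾ (wk (wk tab)) (wk (wk i)) v0) (wk js))))
      (constᴾ (list (list nat)) configs))
    (λ ρ → options (fn W ρ) (fn U ρ) (prefers (fn tab ρ)) (fn js ρ) (fn i ρ)) (λ _ → refl)

  targetᴾ : ∀ {Γ} → Γ ⊩ nat → Γ ⊩ nat → Γ ⊩ list jobTy → Γ ⊩ nat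
  targetᴾ W U js = keyᴾ W (suc N) 0 (mapᴾ (clsᴾ (wk U) v0) (filterᴾ (bigᴾ (wk U) v0) js))

  selectedᴾ : ∀ {Γ} → Γ ⊩ nat → Γ ⊩ nat → Γ ⊩ list nat → Γ ⊩ tableTy → Γ ⊩ list nat → Γ ⊩ list jobTy →
              Γ ⊩ stateTy
  selectedᴾ W U ks tab ms js = recast
    (unconsᴾ
      (bestᴾ (targetᴾ W U js) (selectᴾ ks (mapᴾ (optionsᴾ (wk W) (wk U) (wk tab) (wk js) v0) ms)))
      emptyᴾ v0)
    (λ ρ → selected (fn W ρ) (fn U ρ) (fn ks ρ) (prefers (fn tab ρ)) (fn ms ρ) (fn js ρ)) (λ _ → refl)

  inflateᴾ : ∀ {Γ} → Γ ⊩ nat → Γ ⊩ resourceTy → Γ ⊩ resourceTy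
  inflateᴾ U r = pairᴾ (fstᴾ r) (pairᴾ (fstᴾ (sndᴾ r))
    (ifᴾ (fstᴾ (sndᴾ r)) (sndᴾ (sndᴾ r)) (addᴾ (sndᴾ (sndᴾ r)) (mulᴾ (litᴾ E) U))))

  leftoverᴾ : ∀ {Γ} → Γ ⊩ tableTy → Γ ⊩ list jobTy → Γ ⊩ list jobTy
  leftoverᴾ as js = filterᴾ (notᴾ (anyᴾ (eqJobᴾ (fstᴾ v0) v1) (wk as))) js

  completeᴾ : ∀ {Γ} → Γ ⊩ nat → Γ ⊩ list jobTy → Γ ⊩ stateTy → Γ ⊩ tableTy
  completeᴾ U js s = recast
    (appendᴾ
      (fstᴾ (placeᴾ U (mapᴾ (inflateᴾ (wk U) v0) (sndᴾ (sndᴾ s))) (leftoverᴾ (fstᴾ (sndᴾ s)) js)))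
      (fstᴾ (sndᴾ s)))
    (λ ρ → complete (fn U ρ) (fn js ρ) (fn s ρ)) (λ _ → refl)

  digitSourceᴾ : ∀ {Γ} → Γ ⊩ list nat → Γ ⊩ list jobTy → Γ ⊩ list nat
  digitSourceᴾ ms js = consᴾ (litᴾ 0) (appendᴾ (mapᴾ (litᴾ 0) js) (copiesᴾ E ms))

  scheduleᴾ : ∀ {Γ} → Γ ⊩ nat → Γ ⊩ tableTy → Γ ⊩ list nat → Γ ⊩ list jobTy → Γ ⊩ tableTy
  scheduleᴾ {Γ} U tab ms js = recast
    (letᴾ (sortᴾ js)
      (letᴾ (selectedᴾ W (wk U) (keysOfᴾ W (iotaᴾ source) (suc N)) (wk tab) (wk ms) v0)
        (completeᴾ (wk (wk U)) v1 v0)))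
    (λ ρ → schedule (fn U ρ) (fn tab ρ) (fn ms ρ) (fn js ρ))
    (λ ρ → sym (schedule≡ (fn U ρ) (fn tab ρ) (fn ms ρ) (fn js ρ)))
    where
    source : list jobTy ∷ Γ ⊩ list nat
    source = recast (digitSourceᴾ (wk ms) (wk js)) (λ { (_ ∷ ρ) → digitSource (fn ms ρ) (fn js ρ) })
      (λ { (_ ∷ _) → refl })
    W = lengthᴾ source

  roundedᴾ : ∀ {Γ} → Γ ⊩ nat → Γ ⊩ tableTy → Γ ⊩ list nat → Γ ⊩ list jobTy → Γ ⊩ tableTy
  roundedᴾ U tab ms js = recast
    (letᴾ (scheduleᴾ U tab ms js) (mapᴾ (pairᴾ v0 (assignᴾ (wk (wk ms)) v1 v0)) (wk js)))
    (λ ρ → rounded (fn U ρ) (fn tab ρ) (fn ms ρ) (fn js ρ))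
    (λ ρ → sym (rounded≡ (fn U ρ) (fn tab ρ) (fn ms ρ) (fn js ρ)))

  unitsᴾ : ∀ {Γ} → Γ ⊩ list jobTy → Γ ⊩ list nat
  unitsᴾ js = recast
    (mapᴾ (mulᴾ v0 (wk (maxᴾ (mapᴾ (sndᴾ v0) js))))
      (iotaᴾ (consᴾ (litᴾ 0) (mapᴾ (fstᴾ v0) (copiesᴾ E js)))))
    (λ ρ → units (fn js ρ)) (λ _ → refl)

  guessᴾ : ∀ {Γ} → Γ ⊩ tableTy → Γ ⊩ list nat → Γ ⊩ list jobTy → Γ ⊩ nat
  guessᴾ tab ms js = recast
    (minᴾ (spanᴾ ms (roundedᴾ (litᴾ 0) tab ms js))
      (mapᴾ (spanᴾ (wk ms) (roundedᴾ v0 (wk tab) (wk ms) (wk js))) (unitsᴾ js)))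
    (λ ρ → guess (fn tab ρ) (fn ms ρ) (fn js ρ)) (λ ρ → sym (guess≡ (fn tab ρ) (fn ms ρ) (fn js ρ)))

  tabᴾ : inputTy ∷ [] ⊩ tableTy
  tabᴾ = fstᴾ (sndᴾ v0)

  msᴾ : inputTy ∷ [] ⊩ list nat
  msᴾ = fstᴾ (sndᴾ (sndᴾ v0))

  jsᴾ : inputTy ∷ [] ⊩ list jobTy
  jsᴾ = sndᴾ (sndᴾ (sndᴾ v0))

  abstract
    mainᴾ : inputTy ∷ [] ⊩ tableTy
    mainᴾ = roundedᴾ (mulᴾ (litᴾ E) (guessᴾ tabᴾ msᴾ jsᴾ)) tabᴾ msᴾ jsᴾ

    mainᴾ-fn : ∀ i tab ms js → fn mainᴾ ((i , tab , ms , js) ∷ []) ≡ rounded (E * guess tab ms js) tab ms js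
    mainᴾ-fn i tab ms js = refl

-- Makespans and transition costs as sums

∑-filter? : {A : Set} {P : A → Set} (P? : ∀ x → Dec (P x)) (xs : List A) (f : A → ℕ) →
            ∑ (filter P? xs) f ≡ ∑ xs (λ x → [ does (P? x) ]∙ f x)
∑-filter? P? []       f = refl
∑-filter? P? (x ∷ xs) f with does (P? x)
... | true  = cong (f x +_) (∑-filter? P? xs f)
... | false = ∑-filter? P? xs f

load≡ : ∀ I σ i → load I σ i ≡ ∑ (jobs I) (λ j → [ σ j ≡ᵇ i ]∙ time j)
load≡ I σ i = ∑-filter? (λ j → σ j ≟ i) (jobs I) time

span≡ : ∀ I σ → span (machines I) (table I σ) ≡ makespan I σ
span≡ I σ = cong (foldr _⊔_ 0) (map-cong
  (λ i → trans (∑-map (λ j → j , σ j) (jobs I) _) (sym (load≡ I σ i))) (machines I))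

∈⇒≤max : ∀ {A : Set} (f : A → ℕ) {x xs} → x ∈ xs → f x ≤ foldr _⊔_ 0 (map f xs)
∈⇒≤max f {xs = x ∷ xs} (here refl) = m≤m⊔n (f x) _
∈⇒≤max f {xs = y ∷ xs} (there x∈)  = ≤-trans (∈⇒≤max f x∈) (m≤n⊔m (f y) _)

max≤ : ∀ {A : Set} (f : A → ℕ) xs {b} → (∀ {x} → x ∈ xs → f x ≤ b) → foldr _⊔_ 0 (map f xs) ≤ b
max≤ f []       h = z≤n
max≤ f (x ∷ xs) h = ⊔-lub (h (here refl)) (max≤ f xs (h ∘ there))

prefers-table : ∀ I₀ σ₀ i j → prefers (table I₀ σ₀) i j ≡ does ((j ∈? jobs I₀) ×-dec (σ₀ j ≟ i))
prefers-table I₀ σ₀ i j with prefers (table I₀ σ₀) i j in eq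
... | true with any⁻ {p = λ e → eqJob (proj₁ e) j ∧ (proj₂ e ≡ᵇ i)} (table I₀ σ₀) eq
...   | e , e∈ , pe with ∈-map⁻ (λ j → j , σ₀ j) e∈
...     | j′ , j′∈ , refl with eqJob j′ j in j≡
...       | true with refl ← eqJob-true {j′} {j} j≡ =
  sym (dec-true ((j ∈? jobs I₀) ×-dec (σ₀ j ≟ i)) (j′∈ , ≡ᵇ-true (σ₀ j) i pe))
prefers-table I₀ σ₀ i j | false = sym (dec-false ((j ∈? jobs I₀) ×-dec (σ₀ j ≟ i)) λ { (j∈ , refl) →
  case trans (sym eq) (any⁺ {p = λ e → eqJob (proj₁ e) j ∧ (proj₂ e ≡ᵇ i)} (∈-map⁺ (λ j → j , σ₀ j) j∈)
    (cong₂ _∧_ (eqJob-refl j) (≡ᵇ-refl (σ₀ j)))) of λ () })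

does-true : {P : Set} (P? : Dec P) → does P? ≡ true → P
does-true (yes p) _ = p

prefers-functional : ∀ I₀ σ₀ {i i′ j} → prefers (table I₀ σ₀) i j ≡ true → prefers (table I₀ σ₀) i′ j ≡ true → i ≡ i′
prefers-functional I₀ σ₀ {i} {i′} {j} p p′ = trans (sym (σ₀≡ p)) (σ₀≡ p′)
  where
  σ₀≡ : ∀ {i} → prefers (table I₀ σ₀) i j ≡ true → σ₀ j ≡ i
  σ₀≡ {i} p = proj₂ (does-true ((j ∈? jobs I₀) ×-dec (σ₀ j ≟ i)) (trans (sym (prefers-table I₀ σ₀ i j)) p))

-- A job either costs 1 or is kept, which turns upper bounds on costs into lower bounds on the
-- number of kept jobs.
cost+kept : ∀ I₀ σ₀ I σ → transitionCost I₀ σ₀ I σ + ∑ (jobs I) (λ j → [ prefers (table I₀ σ₀) (σ j) j ]∙ 1) ≡ length (jobs I)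
cost+kept I₀ σ₀ I σ = trans (sym (∑-+ (jobs I) (λ j → jobCost I₀ σ₀ j σ) _))
  (trans (∑-cong (jobs I) (λ {j} _ → trans (cong (λ b → jobCost I₀ σ₀ j σ + ([ b ]∙ 1)) (prefers-table I₀ σ₀ (σ j) j))
                                           (one-of (does ((j ∈? jobs I₀) ×-dec (σ₀ j ≟ σ j))))))
         (sym (length-∑ (jobs I))))
  where
  one-of : ∀ b → (if b then 0 else 1) + ([ b ]∙ 1) ≡ 1
  one-of true  = refl
  one-of false = refl

assign∈ : ∀ {m} ms as j → m ∈ ms → assign ms as j ∈ ms
assign∈ (m ∷ ms) []       j _  = here refl
assign∈ ms       (e ∷ as) j m∈ with eqJob (proj₁ e) j | any (λ m′ → m′ ≡ᵇ proj₂ e) ms in eq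
... | false | _     = assign∈ ms as j m∈
... | true  | false = assign∈ ms as j m∈
... | true  | true with any⁻ {p = λ m′ → m′ ≡ᵇ proj₂ e} ms eq
...   | m′ , m′∈ , m′≡ = subst (_∈ ms) (≡ᵇ-true m′ _ m′≡) m′∈

assign-placed : ∀ ms as {j m} → Unique (map proj₁ as) → (j , m) ∈ as → m ∈ ms → assign ms as j ≡ m
assign-placed ms (e ∷ as) {j} {m} _ (here refl) m∈
  rewrite eqJob-refl j | any⁺ {p = λ m′ → m′ ≡ᵇ m} m∈ (≡ᵇ-refl m) = refl
assign-placed ms (e ∷ as) {j} (e≢ ∷ u) (there e∈) m∈ with eqJob (proj₁ e) j in eq
... | true  = contradiction (eqJob-true {proj₁ e} {j} eq) (All.lookup e≢ (∈-map⁺ proj₁ e∈))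
... | false = assign-placed ms as u e∈ m∈

∑-assign : ∀ ms as {js} (f : Machine → Job → ℕ) → Unique js → map proj₁ as ↭ js → All (λ e → proj₂ e ∈ ms) as →
           ∑ js (λ j → f (assign ms as j) j) ≡ ∑ as (λ e → f (proj₂ e) (proj₁ e))
∑-assign ms as f u p on = trans (∑-↭ _ (↭-sym p)) (trans (∑-map proj₁ as _)
  (∑-cong as λ {e} e∈ → cong (λ m → f m (proj₁ e))
    (assign-placed ms as (Unique-resp-↭ (↭-sym p) u) e∈ (All.lookup on e∈))))

smaller-≤ˡ : ∀ m n → smaller m n ≤ m
smaller-≤ˡ m n with m ≤ᵇ n in le
... | true  = ≤-refl
... | false = <⇒≤ (≤ᵇ-false le)

smaller-≤ʳ : ∀ m n → smaller m n ≤ n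
smaller-≤ʳ m n with m ≤ᵇ n in le
... | true  = ≤ᵇ-true le
... | false = ≤-refl

minimum-attained : ∀ {P : ℕ → Set} b xs → P b → All P xs → P (foldr smaller b xs)
minimum-attained b []       pb []         = pb
minimum-attained b (x ∷ xs) pb (px ∷ pxs) with x ≤ᵇ foldr smaller b xs
... | true  = px
... | false = minimum-attained b xs pb pxs

minimum-≤ : ∀ b {x xs} → x ∈ xs → foldr smaller b xs ≤ x
minimum-≤ b {x} {_ ∷ xs} (here refl) = smaller-≤ˡ x _
minimum-≤ b {x} {y ∷ xs} (there x∈)  = ≤-trans (smaller-≤ʳ y _) (minimum-≤ b x∈)

multiple-near : ∀ p K t → t ≤ K * p → ∃[ k ] k ≤ K × t ≤ k * p × k * p ≤ t + p
multiple-near p zero    t t≤ = 0 , z≤n , t≤ , z≤n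
multiple-near p (suc K) t t≤ with t ≤? K * p
... | yes t≤′ with multiple-near p K t t≤′
...   | k , k≤ , h = k , m≤n⇒m≤1+n k≤ , h
multiple-near p (suc K) t t≤ | no t≰ =
  suc K , ≤-refl , t≤ , ≤-trans (≤-reflexive (+-comm p (K * p))) (+-monoˡ-≤ p (<⇒≤ (≰⇒> t≰)))

-- Quality of the guess and of the result

module Analysis (E : ℕ) {{E≢0 : NonZero E}} (x : Input) where

  open Rounding E
  open Scheme E
  open Algorithms E

  I₀ I : Instance
  I₀ = initial x
  I  = new x

  ms : List Machine
  ms = machines I

  js : List Job
  js = jobs I

  tab : List (Job × Machine)
  tab = table I₀ (σ₀ x)

  transition : (Job → Machine) → ℕ
  transition = transitionCost I₀ (σ₀ x) I

  σ : ℕ → Job → Machine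
  σ U = assign ms (schedule U tab ms js)

  σ-assigns : ∀ U → IsAssignment I (σ U)
  σ-assigns U {j} j∈ = assign∈ ms (schedule U tab ms js) j (proj₂ (new-feasible x) j∈)

  load≤makespan : ∀ τ {i} → i ∈ ms → load I τ i ≤ makespan I τ
  load≤makespan τ = ∈⇒≤max (load I τ)

  scaled-load : ∀ τ i → ∑ js (λ j → [ τ j ≡ᵇ i ]∙ w j) ≡ S * load I τ i
  scaled-load τ i = trans (∑-cong js (λ {j} _ → pull (τ j ≡ᵇ i) (time j)))
    (trans (∑-* S js _) (cong (S *_) (sym (load≡ I τ i))))
    where
    pull : ∀ b t → [ b ]∙ (S * t) ≡ S * ([ b ]∙ t)
    pull true  t = refl
    pull false t = sym (*-zeroʳ S)

  module _ (U : ℕ) (τ : Job → Machine) (τ-assigns : IsAssignment I τ) (τ≤ : S * makespan I τ ≤ N * U) where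

    source = digitSource ms js
    W = length source

    length-source : W ≡ suc (length js + E * length ms)
    length-source = cong suc (trans (length-++ (map (λ _ → 0) js)) (cong₂ _+_ (length-map _ js) (length-copies E ms)))

    open Optimality E U W (prefers tab) (sort js) (prefers-functional I₀ (σ₀ x))
      (Unique-resp-↭ (↭-sym (sort-↭ js)) (jobs-unique I))
      (AllPairs.map (*-monoʳ-≤ S) (sort-descending js))
      ms (machines-unique I)
      (≤-trans (s≤s (≤-trans (≤-reflexive (*-comm (length ms) E)) (m≤n+m _ (length js)))) (≤-reflexive (sym length-source)))
      (≤-trans (s≤s (≤-trans (≤-reflexive (↭-length (sort-↭ js))) (m≤m+n _ _))) (≤-reflexive (sym length-source)))
      (keysOf W (iota source) (suc N))
      (λ {xs} counts< → key∈keysOf W (iota source) (λ {a} a< → subst (a ∈_) (sym (iota≡upTo source)) (∈-upTo⁺ a<)) (suc N) 0 {xs} counts<)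
      τ (λ j∈ → τ-assigns (∈-resp-↭ (sort-↭ js) j∈))
      (λ {i} i∈ → ≤-trans (≤-reflexive (trans (∑-↭ _ (sort-↭ js)) (scaled-load τ i)))
                    (≤-trans (*-monoʳ-≤ S (load≤makespan τ i∈)) τ≤))

    placed : Placed
    placed = schedule U tab ms js

    placed≡ : full ≡ placed
    placed≡ = sym (schedule≡ U tab ms js)

    placed-jobs : map proj₁ placed ↭ js
    placed-jobs = subst (λ as → map proj₁ as ↭ js) placed≡ (↭-trans full-jobs (sort-↭ js))

    placed-machines : All (λ e → proj₂ e ∈ ms) placed
    placed-machines = subst (All (λ e → proj₂ e ∈ ms)) placed≡ full-machines

    σ-makespan : S * makespan I (σ U) ≤ (N + E + E) * U
    σ-makespan = begin
      S * makespan I (σ U)  ≤⟨ scaled-max ms (λ i∈ → σ-load i∈) ⟩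
      (N + E + E) * U       ∎
      where
      open ≤-Reasoning
      σ-load : ∀ {i} → i ∈ ms → S * load I (σ U) i ≤ (N + E + E) * U
      σ-load {i} i∈ = begin
        S * load I (σ U) i                      ≡⟨ scaled-load (σ U) i ⟨
        ∑ js (λ j → [ σ U j ≡ᵇ i ]∙ w j)        ≡⟨ ∑-assign ms placed (λ m j → [ m ≡ᵇ i ]∙ w j) (jobs-unique I) placed-jobs placed-machines ⟩
        ∑ placed (loadOf i)                     ≤⟨ subst (λ as → ∑ as (loadOf i) ≤ (N + E + E) * U) placed≡ (full-load i∈) ⟩
        (N + E + E) * U                         ∎
      scaled-max : ∀ is {b} → (∀ {i} → i ∈ is → S * load I (σ U) i ≤ b) →
                   S * foldr _⊔_ 0 (map (load I (σ U)) is) ≤ b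
      scaled-max []       h = ≤-trans (≤-reflexive (*-zeroʳ S)) z≤n
      scaled-max (i ∷ is) h = ≤-trans (≤-reflexive (*-distribˡ-⊔ S (load I (σ U) i) _))
        (⊔-lub (h (here refl)) (scaled-max is (h ∘ there)))

    σ-transition : transition (σ U) ≤ transition τ
    σ-transition = +-cancelʳ-≤ (kept# τ) _ _ (begin
      transition (σ U) + kept# τ        ≤⟨ +-monoʳ-≤ (transition (σ U)) kept#≤ ⟩
      transition (σ U) + kept# (σ U)    ≡⟨ cost+kept I₀ (σ₀ x) I (σ U) ⟩
      length js                         ≡⟨ cost+kept I₀ (σ₀ x) I τ ⟨
      transition τ + kept# τ            ∎)
      where
      open ≤-Reasoning
      kept# : (Job → Machine) → ℕ
      kept# σ′ = ∑ js (λ j → [ prefers tab (σ′ j) j ]∙ 1)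
      kept#≤ : kept# τ ≤ kept# (σ U)
      kept#≤ = begin
        kept# τ                                            ≡⟨ ∑-↭ _ (sort-↭ js) ⟨
        ∑ (sort js) (λ j → [ prefers tab (τ j) j ]∙ 1)     ≤⟨ full-preferred ⟩
        ∑ full (λ e → [ prefers tab (proj₂ e) (proj₁ e) ]∙ 1)
          ≡⟨ cong (λ as → ∑ as (λ e → [ prefers tab (proj₂ e) (proj₁ e) ]∙ 1)) placed≡ ⟩
        ∑ placed (λ e → [ prefers tab (proj₂ e) (proj₁ e) ]∙ 1)
          ≡⟨ ∑-assign ms placed (λ m j → [ prefers tab m j ]∙ 1) (jobs-unique I) placed-jobs placed-machines ⟨
        kept# (σ U)                                        ∎

  G : ℕ
  G = guess tab ms js

  G≡ : G ≡ foldr smaller (span ms (rounded 0 tab ms js)) (map (λ U → span ms (rounded U tab ms js)) (units js))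
  G≡ = guess≡ tab ms js

  span-rounded : ∀ U → span ms (rounded U tab ms js) ≡ makespan I (σ U)
  span-rounded U = trans (cong (span ms) (rounded≡ U tab ms js)) (span≡ I (σ U))

  G-attained : ∃[ U ] G ≡ makespan I (σ U)
  G-attained = subst (λ g → ∃[ U ] g ≡ makespan I (σ U)) (sym G≡)
    (minimum-attained {λ g → ∃[ U ] g ≡ makespan I (σ U)} _
      (map (λ U → span ms (rounded U tab ms js)) (units js)) (0 , span-rounded 0)
      (All-map⁺ (All.tabulate λ {U} _ → U , span-rounded U)))

  -- `G` is the makespan of an actual assignment, no matter whether the unit behind it came from a
  -- sensible guess.
  G-lower : ∀ m → (∀ τ → IsAssignment I τ → m ≤ makespan I τ) → m ≤ G
  G-lower m m≤ = ≤-trans (m≤ (σ (proj₁ G-attained)) (σ-assigns (proj₁ G-attained)))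
                         (≤-reflexive (sym (proj₂ G-attained)))

  pmax : ℕ
  pmax = foldr _⊔_ 0 (map proj₂ js)

  pmax≤makespan : ∀ τ → IsAssignment I τ → pmax ≤ makespan I τ
  pmax≤makespan τ τ-assigns = max≤ proj₂ js λ {j} j∈ → begin
    time j                                        ≡⟨ cong ([_]∙ time j) (≡ᵇ-refl (τ j)) ⟨
    [ τ j ≡ᵇ τ j ]∙ time j                        ≤⟨ ∈⇒≤∑ (λ j′ → [ τ j′ ≡ᵇ τ j ]∙ time j′) j∈ ⟩
    ∑ js (λ j′ → [ τ j′ ≡ᵇ τ j ]∙ time j′)        ≡⟨ load≡ I τ (τ j) ⟨
    load I τ (τ j)                                ≤⟨ load≤makespan τ (τ-assigns j∈) ⟩
    makespan I τ                                  ∎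
    where open ≤-Reasoning

  makespan≤ : ∀ τ → makespan I τ ≤ length js * pmax
  makespan≤ τ = max≤ (load I τ) ms λ {i} _ → begin
    load I τ i                                ≡⟨ load≡ I τ i ⟩
    ∑ js (λ j → [ τ j ≡ᵇ i ]∙ time j)         ≤⟨ ∑-mono js (λ {j} j∈ → ≤-trans ([]∙-≤ (τ j ≡ᵇ i) _) (∈⇒≤max proj₂ j∈)) ⟩
    ∑ js (λ _ → pmax)                         ≡⟨ ∑-const js pmax ⟩
    length js * pmax                          ∎
    where open ≤-Reasoning

  -- Some multiple of `pmax` lies between `E * makespan I τ` and that number plus `pmax`. As `pmax`
  -- is itself at most the makespan, the grid is fine enough.
  G-upper : ∀ τ → IsAssignment I τ → S * G ≤ (N + E + E) * (E * makespan I τ + makespan I τ)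
  G-upper τ τ-assigns with multiple-near pmax (E * length js) (E * makespan I τ)
    (≤-trans (*-monoʳ-≤ E (makespan≤ τ)) (≤-reflexive (sym (*-assoc E (length js) pmax))))
  ... | k , k≤ , near , far = begin
    S * G                                        ≤⟨ *-monoʳ-≤ S G≤ ⟩
    S * makespan I (σ (k * pmax))                ≤⟨ σ-makespan (k * pmax) τ τ-assigns enough ⟩
    (N + E + E) * (k * pmax)                     ≤⟨ *-monoʳ-≤ (N + E + E) (≤-trans far (+-monoʳ-≤ _ (pmax≤makespan τ τ-assigns))) ⟩
    (N + E + E) * (E * makespan I τ + makespan I τ) ∎
    where
    open ≤-Reasoning
    enough : S * makespan I τ ≤ N * (k * pmax)
    enough = ≤-trans (≤-reflexive (*-assoc N E _)) (*-monoʳ-≤ N near)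
    indices = 0 ∷ map proj₁ (copies E js)
    k∈ : k ∈ iota indices
    k∈ = subst (k ∈_) (sym (iota≡upTo indices)) (∈-upTo⁺ (s≤s (≤-trans k≤
      (≤-reflexive (sym (trans (length-map proj₁ (copies E js)) (length-copies E js)))))))
    G≤ : G ≤ makespan I (σ (k * pmax))
    G≤ = ≤-trans (≤-reflexive G≡) (≤-trans (minimum-≤ _ (∈-map⁺ (λ U → span ms (rounded U tab ms js)) (∈-map⁺ (_* pmax) k∈)))
                 (≤-reflexive (span-rounded (k * pmax))))

  result : Job → Machine
  result = σ (E * G)

  G-suffices : ∀ τ → makespan I τ ≤ G → S * makespan I τ ≤ N * (E * G)
  G-suffices τ τ≤ = ≤-trans (*-monoʳ-≤ S τ≤) (≤-reflexive (*-assoc N E G))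

  -- The final run loses `(E + 2)/E` against `G`, and `G` loses `(E + 2)/E` and `(E + 1)/E` against
  -- the optimum. Both sides are multiplied by `N` twice in order to stay within natural numbers.
  result-makespan : ∀ τ → IsAssignment I τ → (∀ τ′ → IsAssignment I τ′ → makespan I τ ≤ makespan I τ′) →
                    E * makespan I result ≤ (E + 17) * makespan I τ
  result-makespan τ τ-assigns τ-min = *-cancelˡ-≤ (E * E) {{m*n≢0 E E}} (*-cancelˡ-≤ (E * E) {{m*n≢0 E E}} (begin
    N * (N * (E * M))                      ≡⟨ solve 2 (λ e m → e :* e :* (e :* e :* (e :* m)) := e :* e :* (e :* e :* e :* m)) refl E M ⟩
    N * (S * M)                            ≤⟨ *-monoʳ-≤ N (σ-makespan (E * G) τ τ-assigns (G-suffices τ (G-lower m τ-min))) ⟩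
    N * ((N + E + E) * (E * G))            ≡⟨ solve 2 (λ e g → e :* e :* ((e :* e :+ e :+ e) :* (e :* g)) := (e :* e :+ e :+ e) :* (e :* e :* e :* g)) refl E G ⟩
    (N + E + E) * (S * G)                  ≤⟨ *-monoʳ-≤ (N + E + E) (G-upper τ τ-assigns) ⟩
    (N + E + E) * ((N + E + E) * (E * m + m)) ≡⟨ solve 2 (λ e m → (e :* e :+ e :+ e) :* ((e :* e :+ e :+ e) :* (e :* m :+ m))
                                                := e :* e :* ((e :* e :* e :+ con 5 :* (e :* e) :+ con 8 :* e :+ con 4) :* m)) refl E m ⟩
    N * ((E * E * E + 5 * (E * E) + 8 * E + 4) * m) ≤⟨ *-monoʳ-≤ N (*-monoˡ-≤ m cubic) ⟩
    N * ((E * E * E + 17 * (E * E)) * m)   ≡⟨ solve 2 (λ e m → e :* e :* ((e :* e :* e :+ con 17 :* (e :* e)) :* m) := e :* e :* (e :* e :* ((e :+ con 17) :* m))) refl E m ⟩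
    N * (N * ((E + 17) * m))               ∎))
    where
    open ≤-Reasoning
    M = makespan I result
    m = makespan I τ
    1≤E : 1 ≤ E
    1≤E = >-nonZero⁻¹ E
    E≤E*E : E ≤ E * E
    E≤E*E = m≤m*n E E
    -- The left side is the expansion of `(E + 2) * (E + 2) * (E + 1)`, and 17 is `5 + 8 + 4`.
    cubic : E * E * E + 5 * (E * E) + 8 * E + 4 ≤ E * E * E + 17 * (E * E)
    cubic = begin
      E * E * E + 5 * (E * E) + 8 * E + 4
        ≤⟨ +-mono-≤ (+-monoʳ-≤ (E * E * E + 5 * (E * E)) (*-monoʳ-≤ 8 E≤E*E)) (*-monoʳ-≤ 4 (≤-trans 1≤E E≤E*E)) ⟩
      E * E * E + 5 * (E * E) + 8 * (E * E) + 4 * (E * E)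
        ≡⟨ solve 1 (λ e → e :* e :* e :+ con 5 :* (e :* e) :+ con 8 :* (e :* e) :+ con 4 :* (e :* e) := e :* e :* e :+ con 17 :* (e :* e)) refl E ⟩
      E * E * E + 17 * (E * E) ∎

  result-transition : ∀ τ → IsOptimal I τ → transition result ≤ transition τ
  result-transition τ (τ-assigns , τ-min) =
    σ-transition (E * G) τ τ-assigns (G-suffices τ (G-lower (makespan I τ) τ-min))

  -- Running time is measured by the instances and not by the table of `σ₀`. By `σ₀-assigns` each
  -- machine name in the table occurs in `I₀`, so the table is at most quadratic in `∣ I₀ ∣`.
  table-size : size tableTy tab ≤ ∣ I₀ ∣ + ∣ I₀ ∣ * ∣ I₀ ∣
  table-size = s≤s (begin
    ∑ (map (λ j → j , σ₀ x j) js₀) (λ e → suc (size (jobTy ⊗ nat) e))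
      ≡⟨ ∑-map (λ j → j , σ₀ x j) js₀ _ ⟩
    ∑ js₀ (λ j → suc (size jobTy j + bitLength (σ₀ x j)))
      ≤⟨ ∑-mono js₀ (λ {j} j∈ → +-monoʳ-≤ (suc (size jobTy j)) (≤-trans (∈⇒size≤ nat (machines I₀) (σ₀-assigns x j∈)) (m≤m+n _ _))) ⟩
    ∑ js₀ (λ j → suc (size jobTy j) + ∣ I₀ ∣)
      ≡⟨ ∑-+ js₀ (λ j → suc (size jobTy j)) _ ⟩
    ∑ js₀ (λ j → suc (size jobTy j)) + ∑ js₀ (λ _ → ∣ I₀ ∣)
      ≤⟨ +-mono-≤ (≤-trans (n≤1+n _) (m≤n+m _ M₀))
           (≤-trans (≤-reflexive (∑-const js₀ ∣ I₀ ∣))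
             (*-monoˡ-≤ ∣ I₀ ∣ (≤-trans (length≤size jobTy js₀) (m≤n+m _ (size (list nat) (machines I₀)))))) ⟩
    M₀ + size (list jobTy) js₀ + ∣ I₀ ∣ * ∣ I₀ ∣ ∎)
    where
    open ≤-Reasoning
    js₀ = jobs I₀
    M₀ = sum (map (λ m → suc (bitLength m)) (machines I₀))

-- From natural numbers to rational factors

fromℕ-≤ : ∀ ε → 0ℚ ℚ.< ε → let d = ℚ.denominatorℕ ε in
          ∀ {a b} → d * a ≤ (d + 1) * b → fromℕ a ℚ.≤ (1ℚ ℚ.+ ε) ℚ.* fromℕ b
fromℕ-≤ ε@(mkℚ (ℤ.+ zero) d _)   (ℚ.*<* (ℤ.+<+ ()))
fromℕ-≤ ε@(mkℚ ℤ.-[1+ _ ] d _)   (ℚ.*<* ())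
fromℕ-≤ ε@(mkℚ (ℤ.+ suc p) d _) _ {a} {b} le = ℚₚ.toℚᵘ-cancel-≤ (begin
  toℚᵘ (fromℕ a)                                   ≃⟨ ℚₚ.toℚᵘ-fromℚᵘ (mkℚᵘ (ℤ.+ a) 0) ⟩
  mkℚᵘ (ℤ.+ a) 0                                   ≤⟨ ℚᵘ.*≤* (subst₂ ℤ._≤_ lhs≡ rhs≡ (ℤ.+≤+ le′)) ⟩
  (mkℚᵘ (ℤ.+ 1) 0 ℚᵘ.+ mkℚᵘ (ℤ.+ suc p) d) ℚᵘ.* mkℚᵘ (ℤ.+ b) 0
    ≃⟨ ℚᵘₚ.*-cong (ℚₚ.toℚᵘ-homo-+ 1ℚ ε) (ℚₚ.toℚᵘ-fromℚᵘ (mkℚᵘ (ℤ.+ b) 0)) ⟨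
  toℚᵘ (1ℚ ℚ.+ ε) ℚᵘ.* toℚᵘ (fromℕ b)              ≃⟨ ℚₚ.toℚᵘ-homo-* (1ℚ ℚ.+ ε) (fromℕ b) ⟨
  toℚᵘ ((1ℚ ℚ.+ ε) ℚ.* fromℕ b)                    ∎)
  where
  open ℚᵘₚ.≤-Reasoning
  -- The numerator `suc p` of a positive `ε` is at least 1, so `1 + ε` is at least one plus the
  -- reciprocal of the denominator.
  le′ : suc d * a ≤ (suc d + suc p) * b
  le′ = ≤-trans le (*-monoˡ-≤ b (+-monoʳ-≤ (suc d) (s≤s z≤n)))
  lhs≡ : ℤ.+ (suc d * a) ≡ ℤ.+ a ℤ.* ℚᵘ.↧ ((mkℚᵘ (ℤ.+ 1) 0 ℚᵘ.+ mkℚᵘ (ℤ.+ suc p) d) ℚᵘ.* mkℚᵘ (ℤ.+ b) 0)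
  lhs≡ = trans (cong ℤ.+_ (trans (*-comm (suc d) a) (cong (a *_) (sym denominator≡))))
               (ℤₚ.pos-* a _)
    where
    denominator≡ : ℚᵘ.↧ₙ ((mkℚᵘ (ℤ.+ 1) 0 ℚᵘ.+ mkℚᵘ (ℤ.+ suc p) d) ℚᵘ.* mkℚᵘ (ℤ.+ b) 0) ≡ suc d
    denominator≡ = cong suc (trans (*-identityʳ (d + 0)) (+-identityʳ d))
  rhs≡ : ℤ.+ ((suc d + suc p) * b) ≡ ℚᵘ.↥ ((mkℚᵘ (ℤ.+ 1) 0 ℚᵘ.+ mkℚᵘ (ℤ.+ suc p) d) ℚᵘ.* mkℚᵘ (ℤ.+ b) 0) ℤ.* ℚᵘ.↧ (mkℚᵘ (ℤ.+ a) 0)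
  rhs≡ = trans (ℤₚ.pos-* (suc d + suc p) b)
    (trans (cong (ℤ._* ℤ.+ b) (cong₂ ℤ._+_ (sym (ℤₚ.*-identityˡ (ℤ.+ suc d))) (sym (ℤₚ.*-identityʳ (ℤ.+ suc p)))))
           (sym (ℤₚ.*-identityʳ _)))

fromℕ-mono : ∀ {a b} → a ≤ b → fromℕ a ℚ.≤ fromℕ b
fromℕ-mono {a} {b} a≤b = ℚₚ.toℚᵘ-cancel-≤ (begin
  toℚᵘ (fromℕ a)   ≃⟨ ℚₚ.toℚᵘ-fromℚᵘ (mkℚᵘ (ℤ.+ a) 0) ⟩
  mkℚᵘ (ℤ.+ a) 0   ≤⟨ ℚᵘ.*≤* (ℤₚ.*-monoʳ-≤-nonNeg (ℤ.+ 1) (ℤ.+≤+ a≤b)) ⟩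
  mkℚᵘ (ℤ.+ b) 0   ≃⟨ ℚₚ.toℚᵘ-fromℚᵘ (mkℚᵘ (ℤ.+ b) 0) ⟨
  toℚᵘ (fromℕ b)   ∎)
  where open ℚᵘₚ.≤-Reasoning

-- Polynomial running time and the theorem

bounded⇒polynomialTime : ∀ P p → (∀ x → runningTime P x ≤ ⟪ p ⟫ (∣ initial x ∣ + ∣ new x ∣)) →
                         IsPolynomialTime P
bounded⇒polynomialTime P p bound with ⟪⟫-polynomial p
... | c , k , p≤ = c , k , λ x → ≤-trans (bound x) (p≤ (∣ initial x ∣ + ∣ new x ∣))

module _ (E : ℕ) {{E≢0 : NonZero E}} where

  open Programs E

  inputPol : Pol
  inputPol = X ⊞ (X ⊞ X ⊠ X ⊞ X)

  input-size : ∀ x → sizeEnv (encodeInput x ∷ []) ≤ ⟪ inputPol ⟫ (∣ initial x ∣ + ∣ new x ∣)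
  input-size x = ≤-trans (≤-reflexive (+-identityʳ _)) (+-mono-≤ (m≤m+n a b) (+-mono-≤
    (≤-trans (Analysis.table-size E x) (+-mono-≤ (m≤m+n a b) (*-mono-≤ (m≤m+n a b) (m≤m+n a b))))
    (m≤n+m b a)))
    where
    a = ∣ initial x ∣
    b = ∣ new x ∣

  polynomialTime : IsPolynomialTime (tm mainᴾ)
  polynomialTime = bounded⇒polynomialTime (tm mainᴾ) (bd mainᴾ ⊚ inputPol) λ x →
    ≤-trans (cost≤ mainᴾ (encodeInput x ∷ [])) (⟪⟫-mono (bd mainᴾ) (input-size x))

  run≡ : ∀ x → run (tm mainᴾ) x ≡ table (new x) (Analysis.result E x)
  run≡ x = trans (eval≡ mainᴾ (encodeInput x ∷ []))
    (trans (mainᴾ-fn (encodeInstance (initial x)) (table (initial x) (σ₀ x)) (machines (new x)) (jobs (new x)))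
      (Algorithms.rounded≡ E (E * Analysis.G E x) (table (initial x) (σ₀ x)) (machines (new x)) (jobs (new x))))

theorem4p1 : (ε : ℚ) → 0ℚ ℚ.< ε →
    ∃[ P ] IsPolynomialTime P × IsReapproximationAlgorithm 1ℚ (1ℚ ℚ.+ ε) P
theorem4p1 ε ε>0 = tm (Programs.mainᴾ E) , polynomialTime E , λ x →
  let open Analysis E x in
  result , run≡ E x , σ-assigns (E * G) ,
  (λ { m ((τ , τ-assigns , refl) , min) → fromℕ-≤ ε ε>0 {makespan (new x) result} {makespan (new x) τ} (*-cancelˡ-≤ 17 (begin
    17 * (d * makespan (new x) result)   ≡⟨ *-assoc 17 d _ ⟨
    E * makespan (new x) result          ≤⟨ result-makespan τ τ-assigns min ⟩
    (E + 17) * makespan (new x) τ        ≡⟨ cong (_* makespan (new x) τ) (*-distribˡ-+ 17 d 1) ⟨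
    17 * (d + 1) * makespan (new x) τ    ≡⟨ *-assoc 17 (d + 1) _ ⟩
    17 * ((d + 1) * makespan (new x) τ)  ∎)) }) ,
  (λ { m ((τ , τ-optimal , refl) , _) → subst (fromℕ (transition result) ℚ.≤_) (sym (ℚₚ.*-identityˡ _))
    (fromℕ-mono {transition result} {transition τ} (result-transition τ τ-optimal)) })
  where
  open ≤-Reasoning
  d = ℚ.denominatorℕ ε
  -- Turns the factor `(E + 17)/E` into `(d + 1)/d`, which is at most `1 + ε`.
  E = 17 * d
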